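{- Let $M=\{1^{k_{1}},2^{k_{2}},\ldots,m^{k_{m}}\}$ be a multiset with $k_{i}\geq1$ for all $i\in[m]$, and let $\mathcal{P}_{M}$ be the set of words in $\mathfrak{S}_{M}$ in which the last occurrences of $1,2,\ldots,m$ occur in this order (from left to right). Then for every positive integer $d$ and every positive integer $r$, \[ \sum_{w\in\mathcal{P}_{M}}q^{\mathrm{INV}(w)}=\sum_{w\in\mathcal{P}_{M}}q^{\mathrm{MAJ}(w)}=\sum_{w\in\mathcal{P}_{M}}q^{\mathrm{MAJ}_{d}(w)}=\sum_{w\in\mathcal{P}_{M}}q^{\mathrm{Z}(w)}=\sum_{w\in\mathcal{P}_{M}}q^{r\text{ - }\mathrm{MAJ}(w)}=\sum_{w\in\mathcal{P}_{M}}q^{\mathrm{DEN}(w)}=\sum_{w\in\mathcal{P}_{M}}q^{\mathrm{MAK}(w)}=\sum_{w\in\mathcal{P}_{M}}q^{\mathrm{MAD}(w)}. \]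
   Context: $M=\{1^{k_1},\dots,m^{k_m}\}$ denotes the multiset with $k_i$ copies of $i$; $n=k_1+\dots+k_m$; $\mathfrak{S}_M$ is the set of words $w=w_1\cdots w_n$ that are rearrangements of $M$. (Via the representation of a set partition of $[n]$ with blocks $B_1,\dots,B_m$, $\max B_1<\dots<\max B_m$, $|B_i|=k_i$, by the word $w$ with $i\in B_{w_i}$, $\mathcal{P}_M$ is exactly the set of partitions of $[n]$ of type $(k_1,\dots,k_m)$.) Statistics, for $w=w_1\cdots w_n$: - $\mathrm{INV}(w)=|\{(i,j):i<j,\ w_i>w_j\}|$; $\mathrm{Des}(w)=\{i\in[n-1]:w_i>w_{i+1}\}$; $\mathrm{MAJ}(w)=\sum_{i\in\mathrm{Des}(w)}i$. - $\mathrm{MAJ}_d(w)=|\{(i,j):i<j<i+d,\ w_i>w_j\}|+\sum_{i:\,w_i>w_{i+d}} i$. - $\mathrm{Z}(w)=\sum_{i<j}\mathrm{MAJ}(w_{ij})$, where $w_{ij}$ is the subword of $w$ obtained by deleting all letters other than $i$ and $j$. - $r\text{ - }\mathrm{MAJ}(w)=|\{(i,j):i<j,\ w_i-r<w_j<w_i\}|+\sum_{i\in[n-1]:\,w_i\ge w_{i+1}+r} i$. - Let $a_1a_2\cdots a_n$ be the nondecreasing rearrangement of $w$. An excedance place is an $i$ with $w_i>a_i$; $\mathrm{Exc}\,w$ is the subword of $w$ consisting of the letters $w_i$ at excedance places, and $\mathrm{Nexc}\,w$ the subword of the remaining letters. With $\mathrm{imv}(u)=|\{(i,j):i<j,\ u_i\ge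 u_j\}|$, $\mathrm{DEN}(w)=\sum_{i:\,w_i>a_i}i+\mathrm{imv}(\mathrm{Exc}\,w)+\mathrm{INV}(\mathrm{Nexc}\,w)$. - The height $h(a)$ of a letter $a$ is one more than the number of letters of $w$ strictly smaller than $a$; the value of the $i$th letter is $v_i=h(w_i)+|\{j<i:w_j=w_i\}|$. For a descent $i$, $w_i$ is a descent top and $w_{i+1}$ a descent bottom. $\mathrm{Dtop}(w)$ is the sum of the heights of the descent tops, $\mathrm{Dbot}(w)$ the sum of the values of the descent bottoms, $\mathrm{Ddif}=\mathrm{Dtop}-\mathrm{Dbot}$. Cut $w$ into descent blocks by placing a dash between $w_i$ and $w_{i+1}$ whenever $w_i\le w_{i+1}$; a descent block with at least two letters is proper, its leftmost letter is its closer $C(B)$ and its rightmost letter its opener $O(B)$; a letter $a$ is embraced by $B$ if $C(B)\ge a>O(B)$. The right embracing number $e_i$ is the number of descent blocks strictly to the right of $w_i$ that embrace $w_i$; $\mathrm{Res}(w)=\sum_i e_i$. Then $\mathrm{MAK}(w)=\mathrm{Dbot}(w)+\mathrm{Res}(w)$ and $\mathrm{MAD}(w)=\mathrm{Ddif}(w)+\mathrm{Res}(w)$. -}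

module Defs where

open import Data.Nat using (ℕ; zero; suc; _+_; _∸_; _≤ᵇ_; _<ᵇ_; _≡ᵇ_; _⊔_)
open import Data.Bool using (Bool; true; false; if_then_else_; _∧_; not)
open import Data.List using (List; []; _∷_; [_]; length; map; foldr; upTo; concatMap)
open import Data.Nat.ListAction using (sum)
open import Data.Bool.ListAction using (and)
open import Data.Product using (_×_; _,_)

Word : Set
Word = List ℕ

filterᵇ : {A : Set} → (A → Bool) → List A → List A
filterᵇ p [] = []
filterᵇ p (x ∷ xs) = if p x then x ∷ filterᵇ p xs else filterᵇ p xs

range : ℕ → List ℕ
range n = map suc (upTo n)

-- 1-based access w_i (0 when out of range; never used out of range below)
at : Word → ℕ → ℕ
at (x ∷ xs) (suc zero) = x
at (x ∷ xs) (suc (suc i)) = at xs (suc i)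
at _ _ = 0

ind : Bool → ℕ
ind b = if b then 1 else 0

ΣL : List ℕ → (ℕ → ℕ) → ℕ
ΣL xs f = sum (map f xs)

pairs : ℕ → (ℕ → ℕ → Bool) → ℕ
pairs n p = ΣL (range n) (λ i → ΣL (range n) (λ j → ind (p i j)))

-- The multiset M = {1^{k_1},...,m^{k_m}} is given by k = k_1 ∷ ... ∷ k_m,
-- so m = length k and k_i = at k i.

countL : ℕ → Word → ℕ
countL a w = length (filterᵇ (λ x → x ≡ᵇ a) w)

inSM : List ℕ → Word → Bool
inSM k w = and (map (λ x → (1 ≤ᵇ x) ∧ (x ≤ᵇ length k)) w)
         ∧ and (map (λ i → countL i w ≡ᵇ at k i) (range (length k)))

-- position of the last occurrence of letter a in w (0 if absent)
lastPos : ℕ → Word → ℕ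
lastPos a w = foldr _⊔_ 0 (filterᵇ (λ j → at w j ≡ᵇ a) (range (length w)))

lastInOrder : ℕ → Word → Bool
lastInOrder m w = and (map (λ i → lastPos i w <ᵇ lastPos (suc i) w) (range (m ∸ 1)))

words : ℕ → ℕ → List Word
words zero m = [ [] ]
words (suc n) m = concatMap (λ a → map (a ∷_) (words n m)) (range m)

-- 𝒫_M as an explicit finite list (every word of 𝔖_M has length n = Σ k_i)
PM : List ℕ → List Word
PM k = filterᵇ (λ w → inSM k w ∧ lastInOrder (length k) w) (words (sum k) (length k))

-- coefficient of q^e in Σ_{w ∈ 𝒫_M} q^{stat(w)}
coeff : List ℕ → (Word → ℕ) → ℕ → ℕ
coeff k stat e = length (filterᵇ (λ w → stat w ≡ᵇ e) (PM k))

INV : Word → ℕ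
INV w = pairs (length w) (λ i j → (i <ᵇ j) ∧ (at w j <ᵇ at w i))

isDes : Word → ℕ → Bool
isDes w i = at w (suc i) <ᵇ at w i

MAJ : Word → ℕ
MAJ w = ΣL (range (length w ∸ 1)) (λ i → if isDes w i then i else 0)

MAJd : ℕ → Word → ℕ
MAJd d w = pairs (length w) (λ i j → (i <ᵇ j) ∧ (j <ᵇ i + d) ∧ (at w j <ᵇ at w i))
         + ΣL (range (length w)) (λ i → if (i + d ≤ᵇ length w) ∧ (at w (i + d) <ᵇ at w i) then i else 0)

sub2 : ℕ → ℕ → Word → Word
sub2 a b w = filterᵇ (λ x → (x ≡ᵇ a) Data.Bool.∨ (x ≡ᵇ b)) w

Z : ℕ → Word → ℕ
Z m w = ΣL (range m) (λ a → ΣL (range m) (λ b → if a <ᵇ b then MAJ (sub2 a b w) else 0))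

-- w_i - r < w_j < w_i  is written  w_i < w_j + r ∧ w_j < w_i
rMAJ : ℕ → Word → ℕ
rMAJ r w = pairs (length w) (λ i j → (i <ᵇ j) ∧ (at w i <ᵇ at w j + r) ∧ (at w j <ᵇ at w i))
         + ΣL (range (length w ∸ 1)) (λ i → if at w (suc i) + r ≤ᵇ at w i then i else 0)

insertN : ℕ → List ℕ → List ℕ
insertN x [] = [ x ]
insertN x (y ∷ ys) = if x ≤ᵇ y then x ∷ y ∷ ys else y ∷ insertN x ys

sortN : List ℕ → List ℕ
sortN = foldr insertN []

imv : Word → ℕ
imv u = pairs (length u) (λ i j → (i <ᵇ j) ∧ (at u j ≤ᵇ at u i))

isExc : Word → ℕ → Bool
isExc w i = at (sortN w) i <ᵇ at w i

excPlaces : Word → List ℕ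
excPlaces w = filterᵇ (isExc w) (range (length w))

Exc : Word → Word
Exc w = map (at w) (excPlaces w)

Nexc : Word → Word
Nexc w = map (at w) (filterᵇ (λ i → not (isExc w i)) (range (length w)))

DEN : Word → ℕ
DEN w = sum (excPlaces w) + imv (Exc w) + INV (Nexc w)

height : Word → ℕ → ℕ
height w a = suc (length (filterᵇ (λ x → x <ᵇ a) w))

val : Word → ℕ → ℕ
val w i = height w (at w i) + length (filterᵇ (λ j → at w j ≡ᵇ at w i) (range (i ∸ 1)))

Dtop : Word → ℕ
Dtop w = ΣL (range (length w ∸ 1)) (λ i → if isDes w i then height w (at w i) else 0)

Dbot : Word → ℕ
Dbot w = ΣL (range (length w ∸ 1)) (λ i → if isDes w i then val w (suc i) else 0)

-- Ddif = Dtop - Dbot (always ≥ 0)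
Ddif : Word → ℕ
Ddif w = Dtop w ∸ Dbot w

blocks : Word → List Word
blocks [] = []
blocks (x ∷ xs) with blocks xs
... | [] = [ [ x ] ]
... | [] ∷ bs = [ x ] ∷ [] ∷ bs
... | (y ∷ b) ∷ bs = if y <ᵇ x then (x ∷ y ∷ b) ∷ bs else [ x ] ∷ (y ∷ b) ∷ bs

withStarts : ℕ → List Word → List (ℕ × Word)
withStarts p [] = []
withStarts p (b ∷ bs) = (p , b) ∷ withStarts (p + length b) bs

firstL : Word → ℕ
firstL [] = 0
firstL (x ∷ _) = x

lastL : Word → ℕ
lastL [] = 0
lastL (x ∷ []) = x
lastL (_ ∷ y ∷ ys) = lastL (y ∷ ys)

proper : Word → Bool
proper b = 2 ≤ᵇ length b

-- a is embraced by B : C(B) ≥ a > O(B)  (closer = leftmost, opener = rightmost)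
embraces : Word → ℕ → Bool
embraces b a = proper b ∧ (a ≤ᵇ firstL b) ∧ (lastL b <ᵇ a)

eR : Word → ℕ → ℕ
eR w i = length (filterᵇ (λ sb → rightOf sb) (withStarts 1 (blocks w)))
  where
  rightOf : ℕ × Word → Bool
  rightOf (s , b) = (i <ᵇ s) ∧ embraces b (at w i)

Res : Word → ℕ
Res w = ΣL (range (length w)) (eR w)

MAK : Word → ℕ
MAK w = Dbot w + Res w

MAD : Word → ℕ
MAD w = Ddif w + Res w

{-# OPTIONS --safe #-}
-- Write S_f for Σ q^f over 𝒫_M, evaluated at natural numbers q; these values determine the
-- coefficients.  With n_i = k_1 + ⋯ + k_i and [j] = 1 + q + ⋯ + q^(j-1), every statistic f satisfies
-- S_f · ∏_i [n_i] [k_i - 1]! = [n]!.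
--
-- INV, MAJ_d, r-MAJ, Z, DEN: remove the last letter.  The words obtained from 𝒫_M by removing
-- letters at the end are those in which the last occurrences of 1,…,t are in order; t shrinks.  The
-- letters ≤ t then behave like one letter, and everything reduces to Σ_b q^(number of letters
-- above b) [number of letters b] = [n], valid for every linear order of the letters.  The orders
-- that occur are the natural one for INV, its cyclic shifts for MAJ_d, r-MAJ and DEN, and for Z
-- the one that moves the removed letter to the top.
--
-- MAK, MAD: insert all copies of the largest letter at once.  Each letter of a word u has a label,
-- the cost of inserting a larger letter just before it.  By induction, Σ_u q^(cost u) ∏_ℓ (1 + q^ℓ z)
-- over the labels ℓ of u is a constant times ∏_{i=1}^n (1 + q^i z), although the labels of a
-- single u need not be 1,…,n: inserting the new letters acts on the product through one operator
-- V(y) ↦ (z + y)/(1 - q y) V(q y), where y marks the inserted letters.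
module Submission where

open import Defs
open import Data.Nat using (ℕ; zero; suc; _+_; _*_; _^_; _∸_; _⊓_; _⊔_; pred; _≤_; _<_; z≤n; s≤s; s≤s⁻¹; _≤ᵇ_; _<ᵇ_; _≡ᵇ_; >-nonZero)
open import Data.Nat.Properties
open import Data.Nat.ListAction using (sum)
open import Data.Nat.ListAction.Properties using (sum-++; sum-↭)
open import Data.Nat.Tactic.RingSolver using (solve-∀)
open import Data.Bool using (Bool; true; false; if_then_else_; _∧_; _∨_; not; T)
open import Data.Bool.Properties using (∧-zeroʳ; ∧-identityʳ; ∧-comm)
open import Data.Unit using (tt)
open import Data.Empty using (⊥; ⊥-elim)
open import Data.Product using (_×_; _,_; proj₁; proj₂; ∃)
open import Data.Sum using (inj₁; inj₂)
open import Data.List using (List; []; _∷_; [_]; _++_; _∷ʳ_; length; map; concatMap; upTo; reverse; take; drop; replicate; foldr)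
open import Data.List.Properties using (map-++; map-∘; unfold-reverse; length-reverse; reverse-involutive; reverse-injective; ++-assoc; upTo-∷ʳ; length-drop; take++drop≡id; map-id; map-applyUpTo; ∷-injectiveʳ)
open import Data.List.Membership.Propositional using (_∈_; find; lose; _∉_)
open import Data.List.Relation.Unary.Any using (here; there)
open import Data.List.Relation.Binary.Permutation.Propositional using (_↭_; ↭-sym; ↭-trans; prep; ↭⇒↭ₛ)
open import Data.List.Relation.Unary.All using (All; []; _∷_)
open import Function using (_∘_; id; mk⇔)
open import Relation.Nullary using (contradiction)
open import Relation.Binary.PropositionalEquality using (_≡_; _≢_; refl; sym; trans; cong; cong₂; subst; subst₂; module ≡-Reasoning; setoid)
open import Data.List.Membership.Propositional.Properties using (∈-map⁺; ∈-map⁻; ∈-concatMap⁺; ∈-concatMap⁻; ∈-∃++; ∈-++⁺ˡ; ∈-++⁺ʳ; ∈-++⁻; ∈-upTo⁺; ∈-upTo⁻)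
open import Data.List.Relation.Unary.Unique.Propositional using (Unique)
open import Data.List.Relation.Unary.AllPairs using ([]; _∷_; AllPairs)
open import Data.List.Relation.Binary.Permutation.Setoid.Properties using (Unique-resp-↭)
open import Data.Bool.ListAction using (and)
open import Data.List.Membership.Propositional.Properties.WithK using (unique∧set⇒bag)
open import Data.List.Relation.Binary.BagAndSetEquality using (∼bag⇒↭)
open import Data.Nat.DivMod using (_%_; [m+kn]%n≡m%n; m<n⇒m%n≡m)
import Data.List.Relation.Binary.Permutation.Propositional.Properties as ↭
import Data.List.Relation.Unary.All as All
import Data.List.Relation.Binary.Permutation.Propositional as Perm
import Data.List.Relation.Unary.Unique.Propositional.Properties as Unique

-- Boolean comparisons

-- All identities are kept multiplied by the denominator, so nothing is divided; since the
-- denominator is positive, sums are compared by cancellation. Removing the last letter is not a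
-- self-contained recursion for most of the statistics. For r-MAJ and MAJ_d its contribution depends
-- on letters that remain, so they are compared with INV under an arbitrary extra weight θ of the
-- last letter, or of the last d letters; the arbitrary weight lets the induction close. For Z the
-- removal changes the order by which the remaining letters are compared, so the claim is made for a
-- whole class of orders at once. The definition of DEN treats excedance places and other places
-- separately and shows no recursion; it is first turned into a sum over pairs of positions, and the
-- sorted full word stays fixed while letters disappear. For MAK and MAD the labels of a word after
-- insertion depend on where the letters went. The way out is linearity: the result of an insertion
-- is linear in the label polynomial, so only the sum of these polynomials over all words has to be
-- known, weighted by the cost.

data Decided (P Q : Set) : Bool → Set where
  is   : P → Decided P Q true
  isnt : Q → Decided P Q false

-- A `with` on the test together with this value replaces the test in the goal and supplies the
-- inequality in one match; the negative case carries a positive inequality instead of a negation.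
<ᵇ-dec : ∀ m n → Decided (m < n) (n ≤ m) (m <ᵇ n)
<ᵇ-dec m n with m <ᵇ n in eq
... | true  = is (<ᵇ⇒< m n (subst T (sym eq) tt))
... | false = isnt (≮⇒≥ (λ m<n → subst T eq (<⇒<ᵇ m<n)))

≤ᵇ-dec : ∀ m n → Decided (m ≤ n) (n < m) (m ≤ᵇ n)
≤ᵇ-dec m n with m ≤ᵇ n in eq
... | true  = is (≤ᵇ⇒≤ m n (subst T (sym eq) tt))
... | false = isnt (≰⇒> (λ m≤n → subst T eq (≤⇒≤ᵇ m≤n)))

≡ᵇ-dec : ∀ m n → Decided (m ≡ n) (m ≢ n) (m ≡ᵇ n)
≡ᵇ-dec m n with m ≡ᵇ n in eq
... | true  = is (≡ᵇ⇒≡ m n (subst T (sym eq) tt))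
... | false = isnt (λ m≡n → subst T eq (≡⇒≡ᵇ m n m≡n))

<ᵇ-true : ∀ {m n} → m < n → (m <ᵇ n) ≡ true
<ᵇ-true {m} {n} m<n with m <ᵇ n | <ᵇ-dec m n
... | _ | is _ = refl
... | _ | isnt n≤m = contradiction m<n (≤⇒≯ n≤m)

<ᵇ-false : ∀ {m n} → n ≤ m → (m <ᵇ n) ≡ false
<ᵇ-false {m} {n} n≤m with m <ᵇ n | <ᵇ-dec m n
... | _ | is m<n = contradiction m<n (≤⇒≯ n≤m)
... | _ | isnt _ = refl

≤ᵇ-true : ∀ {m n} → m ≤ n → (m ≤ᵇ n) ≡ true
≤ᵇ-true {m} {n} m≤n with m ≤ᵇ n | ≤ᵇ-dec m n
... | _ | is _ = refl
... | _ | isnt n<m = contradiction n<m (≤⇒≯ m≤n)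

≤ᵇ-false : ∀ {m n} → n < m → (m ≤ᵇ n) ≡ false
≤ᵇ-false {m} {n} n<m with m ≤ᵇ n | ≤ᵇ-dec m n
... | _ | is m≤n = contradiction n<m (≤⇒≯ m≤n)
... | _ | isnt _ = refl

≡ᵇ-refl : ∀ n → (n ≡ᵇ n) ≡ true
≡ᵇ-refl zero    = refl
≡ᵇ-refl (suc n) = ≡ᵇ-refl n

≡ᵇ-false : ∀ {m n} → m ≢ n → (m ≡ᵇ n) ≡ false
≡ᵇ-false {m} {n} m≢n with m ≡ᵇ n | ≡ᵇ-dec m n
... | _ | is m≡n = contradiction m≡n m≢n
... | _ | isnt _ = refl

+-interchange : ∀ a b c d → (a + b) + (c + d) ≡ (a + c) + (b + d)
+-interchange = solve-∀

+-exchange : ∀ a b c → a + (b + c) ≡ b + (a + c)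
+-exchange = solve-∀

-- Finite sums

∑ : {A : Set} → List A → (A → ℕ) → ℕ
∑ xs f = sum (map f xs)

module _ {A : Set} where

  ∑-cong-∈ : ∀ (xs : List A) {f g : A → ℕ} → (∀ x → x ∈ xs → f x ≡ g x) → ∑ xs f ≡ ∑ xs g
  ∑-cong-∈ []       h = refl
  ∑-cong-∈ (x ∷ xs) h = cong₂ _+_ (h x (here refl)) (∑-cong-∈ xs (λ y → h y ∘ there))

  ∑-cong : ∀ (xs : List A) {f g : A → ℕ} → (∀ x → f x ≡ g x) → ∑ xs f ≡ ∑ xs g
  ∑-cong xs h = ∑-cong-∈ xs (λ x _ → h x)

  ∑-++ : ∀ (xs ys : List A) f → ∑ (xs ++ ys) f ≡ ∑ xs f + ∑ ys f
  ∑-++ xs ys f = trans (cong sum (map-++ f xs ys)) (sum-++ (map f xs) (map f ys))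

  ∑-∷ʳ : ∀ (xs : List A) x f → ∑ (xs ∷ʳ x) f ≡ ∑ xs f + f x
  ∑-∷ʳ xs x f = trans (∑-++ xs [ x ] f) (cong (∑ xs f +_) (+-identityʳ (f x)))

  ∑-↭ : ∀ {xs ys : List A} f → xs ↭ ys → ∑ xs f ≡ ∑ ys f
  ∑-↭ f p = sum-↭ (↭.map⁺ f p)

  ∑-reverse : ∀ (xs : List A) f → ∑ (reverse xs) f ≡ ∑ xs f
  ∑-reverse xs f = ∑-↭ f (↭.↭-reverse xs)

  ∑-zero : ∀ (xs : List A) → ∑ xs (λ _ → 0) ≡ 0
  ∑-zero []       = refl
  ∑-zero (_ ∷ xs) = ∑-zero xs

  ∑-zero-∈ : ∀ (xs : List A) {f} → (∀ x → x ∈ xs → f x ≡ 0) → ∑ xs f ≡ 0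
  ∑-zero-∈ xs h = trans (∑-cong-∈ xs h) (∑-zero xs)

  ∑-+ : ∀ (xs : List A) f g → ∑ xs (λ x → f x + g x) ≡ ∑ xs f + ∑ xs g
  ∑-+ []       f g = refl
  ∑-+ (x ∷ xs) f g = trans (cong (f x + g x +_) (∑-+ xs f g)) (+-interchange (f x) (g x) _ _)

  ∑-*ˡ : ∀ (xs : List A) k f → ∑ xs (λ x → k * f x) ≡ k * ∑ xs f
  ∑-*ˡ []       k f = sym (*-zeroʳ k)
  ∑-*ˡ (x ∷ xs) k f = trans (cong (k * f x +_) (∑-*ˡ xs k f)) (sym (*-distribˡ-+ k (f x) _))

  ∑-*ʳ : ∀ (xs : List A) k f → ∑ xs (λ x → f x * k) ≡ ∑ xs f * k
  ∑-*ʳ xs k f = trans (∑-cong xs (λ x → *-comm (f x) k)) (trans (∑-*ˡ xs k f) (*-comm k _))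

module _ {A B : Set} where

  ∑-map : ∀ (g : A → B) xs f → ∑ (map g xs) f ≡ ∑ xs (f ∘ g)
  ∑-map g xs f = cong sum (sym (map-∘ xs))

  ∑-concatMap : ∀ (g : A → List B) xs f → ∑ (concatMap g xs) f ≡ ∑ xs (λ x → ∑ (g x) f)
  ∑-concatMap g []       f = refl
  ∑-concatMap g (x ∷ xs) f = trans (∑-++ (g x) (concatMap g xs) f) (cong (∑ (g x) f +_) (∑-concatMap g xs f))

  ∑-swap : ∀ (xs : List A) (ys : List B) (f : A → B → ℕ) → ∑ xs (λ x → ∑ ys (f x)) ≡ ∑ ys (λ y → ∑ xs (λ x → f x y))
  ∑-swap []       ys f = sym (∑-zero ys)
  ∑-swap (x ∷ xs) ys f = trans (cong (∑ ys (f x) +_) (∑-swap xs ys f)) (sym (∑-+ ys (f x) _))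

length-filterᵇ : {A : Set} (p : A → Bool) (xs : List A) → length (filterᵇ p xs) ≡ ∑ xs (ind ∘ p)
length-filterᵇ p [] = refl
length-filterᵇ p (x ∷ xs) with p x
... | true  = cong suc (length-filterᵇ p xs)
... | false = length-filterᵇ p xs

∑-filterᵇ : {A : Set} (p : A → Bool) (xs : List A) (f : A → ℕ) → ∑ (filterᵇ p xs) f ≡ ∑ xs (λ x → if p x then f x else 0)
∑-filterᵇ p [] f = refl
∑-filterᵇ p (x ∷ xs) f with p x
... | true  = cong (f x +_) (∑-filterᵇ p xs f)
... | false = ∑-filterᵇ p xs f

range-suc : ∀ n → range (suc n) ≡ range n ∷ʳ suc n
range-suc n = trans (cong (map suc) (sym (upTo-∷ʳ n))) (map-++ suc (upTo n) [ n ])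

∑-range-suc : ∀ n f → ∑ (range (suc n)) f ≡ ∑ (range n) f + f (suc n)
∑-range-suc n f = trans (cong (λ l → ∑ l f) (range-suc n)) (∑-∷ʳ (range n) (suc n) f)

∑-range-cong : ∀ n {f g} → (∀ i → 1 ≤ i → i ≤ n → f i ≡ g i) → ∑ (range n) f ≡ ∑ (range n) g
∑-range-cong zero h = refl
∑-range-cong (suc n) {f} {g} h =
  trans (∑-range-suc n f)
    (trans (cong₂ _+_ (∑-range-cong n (λ i 1≤i i≤n → h i 1≤i (m≤n⇒m≤1+n i≤n))) (h (suc n) (s≤s z≤n) ≤-refl))
           (sym (∑-range-suc n g)))

∑-range-zero : ∀ n {f} → (∀ i → 1 ≤ i → i ≤ n → f i ≡ 0) → ∑ (range n) f ≡ 0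
∑-range-zero n h = trans (∑-range-cong n h) (∑-zero (range n))

cnt : (ℕ → Bool) → Word → ℕ
cnt p v = ∑ v (ind ∘ p)

cnt-reverse : ∀ p v → cnt p (reverse v) ≡ cnt p v
cnt-reverse p v = ∑-reverse v (ind ∘ p)

length-∑ : ∀ (w : Word) → length w ≡ ∑ w (λ _ → 1)
length-∑ []      = refl
length-∑ (x ∷ w) = cong suc (length-∑ w)

cnt-none : ∀ f w → All (λ x → f x ≡ false) w → cnt f w ≡ 0
cnt-none f []      []      = refl
cnt-none f (x ∷ w) (e ∷ a) rewrite e = cnt-none f w a

-- Words are handled through their reversals, so that the last letter comes first.

at-∷ʳ-old : ∀ w x i → i ≤ length w → at (w ∷ʳ x) i ≡ at w i
at-∷ʳ-old []      x zero          _ = refl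
at-∷ʳ-old (y ∷ w) x zero          _ = refl
at-∷ʳ-old (y ∷ w) x (suc zero)    _ = refl
at-∷ʳ-old (y ∷ w) x (suc (suc i)) (s≤s h) = at-∷ʳ-old w x (suc i) h

at-∷ʳ-new : ∀ w x → at (w ∷ʳ x) (suc (length w)) ≡ x
at-∷ʳ-new []          x = refl
at-∷ʳ-new (y ∷ [])    x = refl
at-∷ʳ-new (y ∷ z ∷ w) x = at-∷ʳ-new (z ∷ w) x

-- Positions are still counted from the left end of the word: a new head of `v` takes position
-- `length v + 1`, and no old position moves.
atʳ : Word → ℕ → ℕ
atʳ v = at (reverse v)

atʳ-old : ∀ x v i → i ≤ length v → atʳ (x ∷ v) i ≡ atʳ v i
atʳ-old x v i h = trans (cong (λ w → at w i) (unfold-reverse x v))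
  (at-∷ʳ-old (reverse v) x i (subst (i ≤_) (sym (length-reverse v)) h))

atʳ-new : ∀ x v → atʳ (x ∷ v) (suc (length v)) ≡ x
atʳ-new x v = trans (cong₂ at (unfold-reverse x v) (cong suc (sym (length-reverse v)))) (at-∷ʳ-new (reverse v) x)

∑-atʳ : ∀ v (f : ℕ → ℕ) → ∑ (range (length v)) (λ i → f (atʳ v i)) ≡ ∑ v f
∑-atʳ [] f = refl
∑-atʳ (x ∷ v) f = begin
  ∑ (range (suc (length v))) (λ i → f (atʳ (x ∷ v) i))
    ≡⟨ ∑-range-suc (length v) _ ⟩
  ∑ (range (length v)) (λ i → f (atʳ (x ∷ v) i)) + f (atʳ (x ∷ v) (suc (length v)))
    ≡⟨ cong₂ _+_ (∑-range-cong (length v) (λ i _ h → cong f (atʳ-old x v i h))) (cong f (atʳ-new x v)) ⟩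
  ∑ (range (length v)) (λ i → f (atʳ v i)) + f x
    ≡⟨ cong (_+ f x) (∑-atʳ v f) ⟩
  ∑ v f + f x
    ≡⟨ +-comm _ (f x) ⟩
  f x + ∑ v f ∎
  where open ≡-Reasoning

∑< : ℕ → (ℕ → ℕ → ℕ) → ℕ
∑< n F = ∑ (range n) (λ i → ∑ (range n) (λ j → if i <ᵇ j then F i j else 0))

∑<-cong : ∀ n {F G} → (∀ i j → 1 ≤ i → i < j → j ≤ n → F i j ≡ G i j) → ∑< n F ≡ ∑< n G
∑<-cong n {F} {G} h = ∑-range-cong n (λ i 1≤i i≤n → ∑-range-cong n (λ j 1≤j j≤n → aux i j 1≤i j≤n))
  where
  aux : ∀ i j → 1 ≤ i → j ≤ n → (if i <ᵇ j then F i j else 0) ≡ (if i <ᵇ j then G i j else 0)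
  aux i j 1≤i j≤n with i <ᵇ j | <ᵇ-dec i j
  ... | _ | is i<j = h i j 1≤i i<j j≤n
  ... | _ | isnt _    = refl

∑<-suc : ∀ n F → ∑< (suc n) F ≡ ∑< n F + ∑ (range n) (λ i → F i (suc n))
∑<-suc n F = begin
  ∑ (range (suc n)) (λ i → ∑ (range (suc n)) (G i))
    ≡⟨ ∑-range-suc n _ ⟩
  ∑ (range n) (λ i → ∑ (range (suc n)) (G i)) + ∑ (range (suc n)) (G (suc n))
    ≡⟨ cong₂ _+_ (∑-range-cong n (λ i _ i≤n → trans (∑-range-suc n (G i)) (cong (∑ (range n) (G i) +_) (last i i≤n))))
                 (∑-range-zero (suc n) (λ j _ j≤ → cong (λ b → if b then F (suc n) j else 0) (<ᵇ-false j≤))) ⟩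
  ∑ (range n) (λ i → ∑ (range n) (G i) + F i (suc n)) + 0
    ≡⟨ +-identityʳ _ ⟩
  ∑ (range n) (λ i → ∑ (range n) (G i) + F i (suc n))
    ≡⟨ ∑-+ (range n) _ _ ⟩
  ∑< n F + ∑ (range n) (λ i → F i (suc n)) ∎
  where
  open ≡-Reasoning
  G : ℕ → ℕ → ℕ
  G i j = if i <ᵇ j then F i j else 0
  last : ∀ i → i ≤ n → G i (suc n) ≡ F i (suc n)
  last i i≤n = cong (λ b → if b then F i (suc n) else 0) (<ᵇ-true (s≤s i≤n))

ind-∧ : ∀ b c → ind (b ∧ c) ≡ (if b then ind c else 0)
ind-∧ true  c = refl
ind-∧ false c = refl

pairs-∑< : ∀ n (p : ℕ → ℕ → Bool) → pairs n (λ i j → (i <ᵇ j) ∧ p i j) ≡ ∑< n (λ i j → ind (p i j))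
pairs-∑< n p = ∑-cong (range n) (λ i → ∑-cong (range n) (λ j → ind-∧ (i <ᵇ j) (p i j)))

-- `F` sees positions as well as letters: for MAJ_d and for DEN a pair counts according to where it
-- stands.
pairsʳ : (ℕ → ℕ → ℕ → ℕ → ℕ) → Word → ℕ
pairsʳ F v = ∑< (length v) (λ i j → F i j (atʳ v i) (atʳ v j))

pairsʳ-∷ : ∀ F x v → pairsʳ F (x ∷ v) ≡ pairsʳ F v + ∑ (range (length v)) (λ i → F i (suc (length v)) (atʳ v i) x)
pairsʳ-∷ F x v = trans (∑<-suc (length v) _)
  (cong₂ _+_ (∑<-cong (length v) (λ i j _ i<j j≤n →
                cong₂ (F i j) (atʳ-old x v i (≤-trans (<⇒≤ i<j) j≤n)) (atʳ-old x v j j≤n)))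
             (∑-range-cong (length v) (λ i _ i≤n →
                cong₂ (F i (suc (length v))) (atʳ-old x v i i≤n) (atʳ-new x v))))

pairs-reverse : ∀ (p : ℕ → ℕ → ℕ → ℕ → Bool) v →
  pairs (length (reverse v)) (λ i j → (i <ᵇ j) ∧ p i j (atʳ v i) (atʳ v j)) ≡ pairsʳ (λ i j a b → ind (p i j a b)) v
pairs-reverse p v = trans (pairs-∑< (length (reverse v)) (λ i j → p i j (atʳ v i) (atʳ v j)))
  (cong (λ n → ∑< n (λ i j → ind (p i j (atʳ v i) (atʳ v j)))) (length-reverse v))

-- Recursions of INV, r-MAJ, MAJ and MAJ_d in the last letter

hd : Word → ℕ
hd []      = 0
hd (x ∷ _) = x

if-const : ∀ {A : Set} b {x : A} → (if b then x else x) ≡ x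
if-const true  = refl
if-const false = refl

inv : Word → ℕ
inv []      = 0
inv (x ∷ v) = inv v + cnt (x <ᵇ_) v

INV-reverse : ∀ v → INV (reverse v) ≡ inv v
INV-reverse v = trans (pairs-reverse (λ _ _ a b → b <ᵇ a) v) (go v)
  where
  F : ℕ → ℕ → ℕ → ℕ → ℕ
  F _ _ a b = ind (b <ᵇ a)
  go : ∀ v → pairsʳ F v ≡ inv v
  go []      = refl
  go (x ∷ v) = trans (pairsʳ-∷ F x v) (cong₂ _+_ (go v) (∑-atʳ v (λ a → ind (x <ᵇ a))))

-- The new last letter `x` closes pairs with all earlier letters and at most one jump, which sits at
-- position `length v`. The default `hd [] = 0` is harmless, because the jump then adds
-- `length [] = 0`.
rmaj : ℕ → Word → ℕ
rmaj r []      = 0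
rmaj r (x ∷ v) = rmaj r v + (cnt (λ a → (a <ᵇ x + r) ∧ (x <ᵇ a)) v + (if x + r ≤ᵇ hd v then length v else 0))

rMAJ-reverse : ∀ r v → rMAJ r (reverse v) ≡ rmaj r v
rMAJ-reverse r v = trans (cong₂ _+_ (pairs-reverse (λ _ _ a b → (a <ᵇ b + r) ∧ (b <ᵇ a)) v)
                                    (cong (λ n → ∑ (range (n ∸ 1)) (λ i → jump i (atʳ v i) (atʳ v (suc i)))) (length-reverse v)))
                         (go v)
  where
  F : ℕ → ℕ → ℕ → ℕ → ℕ
  F _ _ a b = ind ((a <ᵇ b + r) ∧ (b <ᵇ a))
  inner : Word → ℕ
  inner = pairsʳ F
  jump : ℕ → ℕ → ℕ → ℕ
  jump i a b = if b + r ≤ᵇ a then i else 0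
  outer : Word → ℕ
  outer v = ∑ (range (length v ∸ 1)) (λ i → jump i (atʳ v i) (atʳ v (suc i)))
  outer-∷ : ∀ x v → outer (x ∷ v) ≡ outer v + (if x + r ≤ᵇ hd v then length v else 0)
  outer-∷ x [] = sym (if-const (x + r ≤ᵇ 0))
  outer-∷ x (y ∷ v) = trans (∑-range-suc (length v) _)
    (cong₂ _+_ (∑-range-cong (length v) (λ i _ i≤n →
                  cong₂ (jump i) (atʳ-old x (y ∷ v) i (m≤n⇒m≤1+n i≤n)) (atʳ-old x (y ∷ v) (suc i) (s≤s i≤n))))
               (cong₂ (jump (suc (length v))) (trans (atʳ-old x (y ∷ v) _ ≤-refl) (atʳ-new y v)) (atʳ-new x (y ∷ v))))
  go : ∀ v → inner v + outer v ≡ rmaj r v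
  go []      = refl
  go (x ∷ v) = trans (cong₂ _+_ (trans (pairsʳ-∷ F x v) (cong (inner v +_) (∑-atʳ v (λ a → ind ((a <ᵇ x + r) ∧ (x <ᵇ a))))))
                                (outer-∷ x v))
    (trans (+-interchange (inner v) _ (outer v) _) (cong (_+ (cnt (λ a → (a <ᵇ x + r) ∧ (x <ᵇ a)) v + (if x + r ≤ᵇ hd v then length v else 0))) (go v)))

nothing-between : ∀ a b → ((a <ᵇ b + 1) ∧ (b <ᵇ a)) ≡ false
nothing-between a b with b <ᵇ a | <ᵇ-dec b a
... | _ | isnt _ = ∧-zeroʳ (a <ᵇ b + 1)
... | _ | is b<a rewrite <ᵇ-false (≤-trans (≤-reflexive (+-comm b 1)) b<a) = refl

-- For r = 1 there is no letter strictly between `w_i - 1` and `w_i`, so the pair term vanishes and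
-- only the descent positions remain.
MAJ-rMAJ : ∀ w → MAJ w ≡ rMAJ 1 w
MAJ-rMAJ w = cong₂ _+_ (sym (trans (pairs-∑< (length w) _)
    (trans (∑<-cong (length w) (λ i j _ _ _ → cong ind (nothing-between (at w i) (at w j)))) (∑<-0 (length w)))))
  (∑-cong (range (length w ∸ 1)) (λ i → cong (λ b → if b then i else 0) (des (at w i) (at w (suc i)))))
  where
  ∑<-0 : ∀ n → ∑< n (λ _ _ → 0) ≡ 0
  ∑<-0 n = ∑-range-zero n (λ i _ _ → ∑-range-zero n (λ j _ _ → if-const (i <ᵇ j)))
  des : ∀ a b → (b <ᵇ a) ≡ (b + 1 ≤ᵇ a)
  des a b rewrite +-comm b 1 = refl

MAJ-∷ : ∀ x v → MAJ (reverse (x ∷ v)) ≡ MAJ (reverse v) + (if x <ᵇ hd v then length v else 0)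
MAJ-∷ x v = begin
  MAJ (reverse (x ∷ v)) ≡⟨ MAJ-rMAJ (reverse (x ∷ v)) ⟩
  rMAJ 1 (reverse (x ∷ v)) ≡⟨ rMAJ-reverse 1 (x ∷ v) ⟩
  rmaj 1 v + (cnt (λ a → (a <ᵇ x + 1) ∧ (x <ᵇ a)) v + (if x + 1 ≤ᵇ hd v then length v else 0))
    ≡⟨ cong₂ (λ a b → a + (b + (if x + 1 ≤ᵇ hd v then length v else 0)))
         (trans (sym (rMAJ-reverse 1 v)) (sym (MAJ-rMAJ (reverse v))))
         (trans (∑-cong v (λ a → cong ind (nothing-between a x))) (∑-zero v)) ⟩
  MAJ (reverse v) + (if x + 1 ≤ᵇ hd v then length v else 0)
    ≡⟨ cong (λ y → MAJ (reverse v) + (if y ≤ᵇ hd v then length v else 0)) (+-comm x 1) ⟩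
  MAJ (reverse v) + (if x <ᵇ hd v then length v else 0) ∎
  where
  open ≡-Reasoning

-- The index is shifted by one: this is MAJ with parameter d + 1. The letters of `take d v` are
-- those at distance less than d + 1 from the new letter, and `hd (drop d v)`, whose position is
-- `length (drop d v)`, is the one at distance exactly d + 1.
majd : ℕ → Word → ℕ
majd d []      = 0
majd d (x ∷ v) = majd d v + (cnt (x <ᵇ_) (take d v) + (if x <ᵇ hd (drop d v) then length (drop d v) else 0))

window : ∀ (p : ℕ → Bool) d v →
  ∑ (range (length v)) (λ l → ind ((suc (length v) <ᵇ l + suc d) ∧ p (atʳ v l))) ≡ cnt p (take d v)
window p zero v = ∑-range-zero (length v) (λ l _ l≤n →
  cong (λ b → ind (b ∧ p (atʳ v l))) (<ᵇ-false (≤-trans (≤-reflexive (+-comm l 1)) (s≤s l≤n))))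
window p (suc d) [] = refl
window p (suc d) (x ∷ v) = begin
  ∑ (range (suc (length v))) (λ l → ind ((suc (suc (length v)) <ᵇ l + suc (suc d)) ∧ p (atʳ (x ∷ v) l)))
    ≡⟨ ∑-range-suc (length v) _ ⟩
  ∑ (range (length v)) (λ l → ind ((suc (suc (length v)) <ᵇ l + suc (suc d)) ∧ p (atʳ (x ∷ v) l)))
    + ind ((suc (suc (length v)) <ᵇ suc (length v) + suc (suc d)) ∧ p (atʳ (x ∷ v) (suc (length v))))
    ≡⟨ cong₂ _+_ (∑-range-cong (length v) (λ l _ l≤n → cong₂ (λ a b → ind (a ∧ p b))
                    (cong (suc (suc (length v)) <ᵇ_) (+-suc l (suc d))) (atʳ-old x v l l≤n)))
                 (cong₂ (λ a b → ind (a ∧ p b)) (<ᵇ-true inside) (atʳ-new x v)) ⟩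
  ∑ (range (length v)) (λ l → ind ((suc (length v) <ᵇ l + suc d) ∧ p (atʳ v l))) + ind (p x)
    ≡⟨ cong (_+ ind (p x)) (window p d v) ⟩
  cnt p (take d v) + ind (p x)
    ≡⟨ +-comm _ (ind (p x)) ⟩
  cnt p (take (suc d) (x ∷ v)) ∎
  where
  open ≡-Reasoning
  inside : suc (suc (length v)) < suc (length v) + suc (suc d)
  inside = s≤s (subst (suc (suc (length v)) ≤_) (sym (trans (+-suc (length v) (suc d)) (cong suc (+-suc (length v) d))))
                 (s≤s (s≤s (m≤m+n (length v) d))))

-- Only l = `length v` - d can pass the test. If d is at least the length, no l does, and `drop d v`
-- is empty on the other side.
jumpSum : ∀ (p : ℕ → Bool) d v →
  ∑ (range (length v)) (λ l → if (l + suc d ≡ᵇ suc (length v)) ∧ p (atʳ v l) then l else 0)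
    ≡ (if p (hd (drop d v)) then length (drop d v) else 0)
jumpSum p zero [] = sym (if-const (p 0))
jumpSum p (suc d) [] = sym (if-const (p 0))
jumpSum p zero (x ∷ v) = trans (∑-range-suc (length v) _)
  (cong₂ _+_ (∑-range-zero (length v) (λ l _ l≤n → cong (λ b → if b ∧ p (atʳ (x ∷ v) l) then l else 0)
                (≡ᵇ-false (λ e → <⇒≢ (s≤s l≤n) (suc-injective (trans (+-comm 1 l) e))))))
             (cong₂ (λ a b → if a ∧ p b then suc (length v) else 0)
                (trans (cong (_≡ᵇ suc (suc (length v))) (+-comm (suc (length v)) 1)) (≡ᵇ-refl (length v))) (atʳ-new x v)))
jumpSum p (suc d) (x ∷ v) = trans (∑-range-suc (length v) _)
  (trans (cong₂ _+_ (∑-range-cong (length v) (λ l _ l≤n → cong₂ (λ a b → if a ∧ p b then l else 0)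
                       (cong (_≡ᵇ suc (suc (length v))) (+-suc l (suc d))) (atʳ-old x v l l≤n)))
                    (cong (λ a → if a ∧ p (atʳ (x ∷ v) (suc (length v))) then suc (length v) else 0) (≡ᵇ-false big)))
         (trans (+-identityʳ _) (jumpSum p d v)))
  where
  big : suc (length v) + suc (suc d) ≢ suc (suc (length v))
  big e = <⇒≢ (s≤s (m≤m+n (length v) d)) (sym (suc-injective (suc-injective
            (trans (sym (cong suc (trans (+-suc (length v) (suc d)) (cong suc (+-suc (length v) d))))) e))))

MAJd-reverse : ∀ d v → MAJd (suc d) (reverse v) ≡ majd d v
MAJd-reverse d v = trans (cong₂ _+_ (pairs-reverse (λ i j a b → (j <ᵇ i + suc d) ∧ (b <ᵇ a)) v)
                                    (cong (λ n → ∑ (range n) (λ i → if (i + suc d ≤ᵇ n) ∧ (at (reverse v) (i + suc d) <ᵇ at (reverse v) i) then i else 0)) (length-reverse v)))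
                         (go v)
  where
  F : ℕ → ℕ → ℕ → ℕ → ℕ
  F i j a b = ind ((j <ᵇ i + suc d) ∧ (b <ᵇ a))
  inner : Word → ℕ
  inner = pairsʳ F
  jump : ℕ → Bool → ℕ → ℕ → ℕ
  jump i s a b = if s ∧ (b <ᵇ a) then i else 0
  outer : Word → ℕ
  outer v = ∑ (range (length v)) (λ i → jump i (i + suc d ≤ᵇ length v) (atʳ v i) (atʳ v (i + suc d)))
  -- The new position `length v + 1` ends at most one pair at distance d + 1; a pair that ended
  -- earlier keeps both its letters.
  split : ∀ x v i → i ≤ length v →
    jump i (i + suc d ≤ᵇ suc (length v)) (atʳ (x ∷ v) i) (atʳ (x ∷ v) (i + suc d))
      ≡ jump i (i + suc d ≤ᵇ length v) (atʳ v i) (atʳ v (i + suc d))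
        + jump i (i + suc d ≡ᵇ suc (length v)) (atʳ v i) x
  split x v i i≤n with i + suc d ≤ᵇ length v | ≤ᵇ-dec (i + suc d) (length v)
  ... | _ | is h rewrite ≤ᵇ-true (m≤n⇒m≤1+n h) | ≡ᵇ-false (<⇒≢ (s≤s h)) | atʳ-old x v i i≤n | atʳ-old x v (i + suc d) h = sym (+-identityʳ _)
  ... | _ | isnt h with i + suc d ≡ᵇ suc (length v) | ≡ᵇ-dec (i + suc d) (suc (length v))
  ...   | _ | is e rewrite e | ≤ᵇ-true (≤-refl {suc (length v)}) | atʳ-old x v i i≤n | atʳ-new x v = refl
  ...   | _ | isnt ne rewrite ≤ᵇ-false (≤∧≢⇒< h (ne ∘ sym)) = refl
  outer-∷ : ∀ x v → outer (x ∷ v) ≡ outer v + (if x <ᵇ hd (drop d v) then length (drop d v) else 0)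
  outer-∷ x v = begin
    outer (x ∷ v) ≡⟨ ∑-range-suc (length v) _ ⟩
    ∑ (range (length v)) (λ i → jump i (i + suc d ≤ᵇ suc (length v)) (atʳ (x ∷ v) i) (atʳ (x ∷ v) (i + suc d)))
      + jump (suc (length v)) (suc (length v) + suc d ≤ᵇ suc (length v)) (atʳ (x ∷ v) (suc (length v))) (atʳ (x ∷ v) (suc (length v) + suc d))
      ≡⟨ cong₂ _+_ (∑-range-cong (length v) (λ i _ → split x v i))
           (cong (λ b → jump (suc (length v)) b (atʳ (x ∷ v) (suc (length v))) (atʳ (x ∷ v) (suc (length v) + suc d)))
             (≤ᵇ-false (subst (suc (suc (length v)) ≤_) (sym (+-suc (suc (length v)) d)) (s≤s (m≤m+n (suc (length v)) d))))) ⟩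
    ∑ (range (length v)) (λ i → jump i (i + suc d ≤ᵇ length v) (atʳ v i) (atʳ v (i + suc d)) + jump i (i + suc d ≡ᵇ suc (length v)) (atʳ v i) x) + 0
      ≡⟨ +-identityʳ _ ⟩
    _ ≡⟨ ∑-+ (range (length v)) _ _ ⟩
    outer v + ∑ (range (length v)) (λ i → jump i (i + suc d ≡ᵇ suc (length v)) (atʳ v i) x)
      ≡⟨ cong (outer v +_) (jumpSum (x <ᵇ_) d v) ⟩
    _ ∎
    where open ≡-Reasoning
  go : ∀ v → inner v + outer v ≡ majd d v
  go []      = refl
  go (x ∷ v) = trans (cong₂ _+_ (trans (pairsʳ-∷ F x v) (cong (inner v +_) (window (x <ᵇ_) d v))) (outer-∷ x v))
    (trans (+-interchange (inner v) _ (outer v) _) (cong (_+ (cnt (x <ᵇ_) (take d v) + (if x <ᵇ hd (drop d v) then length (drop d v) else 0))) (go v)))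

cnt-≤-> : ∀ b v → cnt (_≤ᵇ b) v + cnt (b <ᵇ_) v ≡ length v
cnt-≤-> b [] = refl
cnt-≤-> b (x ∷ v) = trans (+-interchange (ind (x ≤ᵇ b)) _ _ _) (cong₂ _+_ (one x) (cnt-≤-> b v))
  where
  one : ∀ x → ind (x ≤ᵇ b) + ind (b <ᵇ x) ≡ 1
  one x with x ≤ᵇ b | ≤ᵇ-dec x b
  ... | _ | is h rewrite <ᵇ-false h = refl
  ... | _ | isnt h rewrite <ᵇ-true h = refl

cnt-between : ∀ {b c} → b ≤ c → ∀ v → cnt (λ a → (b <ᵇ a) ∧ (a ≤ᵇ c)) v + cnt (_≤ᵇ b) v ≡ cnt (_≤ᵇ c) v
cnt-between b≤c [] = refl
cnt-between {b} {c} b≤c (x ∷ v) = trans (+-interchange (ind ((b <ᵇ x) ∧ (x ≤ᵇ c))) _ _ _) (cong₂ _+_ (one x) (cnt-between b≤c v))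
  where
  one : ∀ x → ind ((b <ᵇ x) ∧ (x ≤ᵇ c)) + ind (x ≤ᵇ b) ≡ ind (x ≤ᵇ c)
  one x with x ≤ᵇ b | ≤ᵇ-dec x b
  ... | _ | is h rewrite <ᵇ-false h | ≤ᵇ-true (≤-trans h b≤c) = refl
  ... | _ | isnt h rewrite <ᵇ-true h = +-identityʳ _

-- Multiplicities, and words enumerated by their last letter

infixl 6 _⊖_

_⊖_ : (ℕ → ℕ) → ℕ → ℕ → ℕ
(κ ⊖ b) x = if x ≡ᵇ b then pred (κ x) else κ x

⊖-same : ∀ κ b → (κ ⊖ b) b ≡ pred (κ b)
⊖-same κ b rewrite ≡ᵇ-refl b = refl

⊖-other : ∀ κ {b x} → x ≢ b → (κ ⊖ b) x ≡ κ x
⊖-other κ x≢b rewrite ≡ᵇ-false x≢b = refl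

N : (ℕ → ℕ) → ℕ → ℕ
N κ zero    = 0
N κ (suc c) = N κ c + κ (suc c)

N-mono : ∀ κ {b c} → b ≤ c → N κ b ≤ N κ c
N-mono κ {b} {zero} z≤n = ≤-refl
N-mono κ {b} {suc c} b≤ with m≤n⇒m<n∨m≡n b≤
... | inj₁ (s≤s b≤c) = ≤-trans (N-mono κ b≤c) (m≤m+n (N κ c) (κ (suc c)))
... | inj₂ refl = ≤-refl

N-⊖ : ∀ κ {b} → 1 ≤ b → 1 ≤ κ b → ∀ c → N κ c ≡ ind (b ≤ᵇ c) + N (κ ⊖ b) c
N-⊖ κ {b} 1≤b 1≤κb zero rewrite ≤ᵇ-false 1≤b = refl
N-⊖ κ {b} 1≤b 1≤κb (suc c) with b ≤ᵇ suc c | ≤ᵇ-dec b (suc c)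
... | _ | isnt c<b = trans (cong₂ _+_ (trans (N-⊖ κ 1≤b 1≤κb c) (cong (λ y → ind y + N (κ ⊖ b) c) (≤ᵇ-false (<⇒≤ c<b))))
                                      (sym (⊖-other κ (<⇒≢ c<b)))) refl
... | _ | is b≤ with suc c ≡ᵇ b | ≡ᵇ-dec (suc c) b
...   | _ | is refl = begin
    N κ c + κ (suc c)
      ≡⟨ cong₂ _+_ (trans (N-⊖ κ 1≤b 1≤κb c) (cong (λ y → ind y + N (κ ⊖ suc c) c) (≤ᵇ-false (≤-refl {suc c})))) (sym (suc-pred (κ (suc c)) {{>-nonZero 1≤κb}})) ⟩
    N (κ ⊖ suc c) c + suc (pred (κ (suc c)))
      ≡⟨ +-suc _ _ ⟩
    suc (N (κ ⊖ suc c) c + pred (κ (suc c))) ∎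
  where open ≡-Reasoning
...   | _ | isnt ne = trans (cong (_+ κ (suc c)) (trans (N-⊖ κ 1≤b 1≤κb c)
                        (cong (λ y → ind y + N (κ ⊖ b) c) (≤ᵇ-true (s≤s⁻¹ (≤∧≢⇒< b≤ (ne ∘ sym))))))) refl

N-⊖-below : ∀ κ {b} c → c < b → N (κ ⊖ b) c ≡ N κ c
N-⊖-below κ zero    _   = refl
N-⊖-below κ (suc c) c<b = cong₂ _+_ (N-⊖-below κ c (<⇒≤ c<b)) (⊖-other κ (<⇒≢ c<b))

from : ℕ → ℕ → List ℕ
from t zero    = []
from t (suc s) = t ∷ from (suc t) s

from-++ : ∀ t a b → from t (a + b) ≡ from t a ++ from (t + a) b
from-++ t zero    b = cong (λ u → from u b) (sym (+-identityʳ t))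
from-++ t (suc a) b = cong (t ∷_) (trans (from-++ (suc t) a b) (cong (λ u → from (suc t) a ++ from u b) (sym (+-suc t a))))

∈-from⁻ : ∀ {b} t s → b ∈ from t s → t ≤ b × b < t + s
∈-from⁻ t (suc s) (here refl) = ≤-refl , subst (suc t ≤_) (sym (+-suc t s)) (s≤s (m≤m+n t s))
∈-from⁻ {b} t (suc s) (there b∈) with ∈-from⁻ (suc t) s b∈
... | t<b , b<e = <⇒≤ t<b , subst (b <_) (sym (+-suc t s)) b<e

∈-from⁺ : ∀ {b} t s → t ≤ b → b < t + s → b ∈ from t s
∈-from⁺ t zero    t≤b b<e = ⊥-elim (<⇒≱ b<e (subst (_≤ _) (sym (+-identityʳ t)) t≤b))
∈-from⁺ {b} t (suc s) t≤b b<e with m≤n⇒m<n∨m≡n t≤b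
... | inj₁ t<b  = there (∈-from⁺ (suc t) s t<b (subst (b <_) (+-suc t s) b<e))
... | inj₂ refl = here refl

lower : ℕ → ℕ → ℕ
lower t b = if b ≡ᵇ t then pred t else t

lower-≤ : ∀ t b → lower t b ≤ t
lower-≤ t b with b ≡ᵇ t
... | true  = pred[n]≤n
... | false = ≤-refl

-- E n κ t enumerates the reversals of the words of length n with κ i letters i ≤ m in which the
-- last occurrences of 1,…,t are in this order; it branches on the last letter b, which must be
-- at least t, and b = t releases the constraint between t - 1 and t.
module LastLetter (m : ℕ) where

  letters : ℕ → List ℕ
  letters t = from t (suc m ∸ t)

  E : ℕ → (ℕ → ℕ) → ℕ → List Word
  E zero    κ t = [ [] ]
  E (suc n) κ t = concatMap (λ b → if 1 ≤ᵇ κ b then map (b ∷_) (E n (κ ⊖ b) (lower t b)) else []) (letters t)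

  -- `κ0` empties the branch of the letter 0, which `letters 0` contains; `pos` guarantees that
  -- every constrained letter has a last occurrence.
  record State (n : ℕ) (κ : ℕ → ℕ) (t : ℕ) : Set where
    field
      κ0  : κ 0 ≡ 0
      pos : ∀ i → 1 ≤ i → i ≤ t → 1 ≤ κ i
      t≤m : t ≤ m
      tot : N κ m ≡ n
  open State public

  record Allowed (κ : ℕ → ℕ) (t b : ℕ) : Set where
    constructor allowed
    field
      t≤b : t ≤ b
      b≤m : b ≤ m
      κb  : 1 ≤ κ b
  open Allowed public

  1≤b : ∀ {n κ t b} → State n κ t → Allowed κ t b → 1 ≤ b
  1≤b {b = zero}  S A = subst (1 ≤_) (κ0 S) (κb A)
  1≤b {b = suc b} S A = s≤s z≤n

  next : ∀ {n κ t b} → State (suc n) κ t → Allowed κ t b → State n (κ ⊖ b) (lower t b)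
  next {n} {κ} {t} {b} S A = record
    { κ0  = trans (⊖-other κ (<⇒≢ (1≤b S A))) (κ0 S)
    ; pos = pos′
    ; t≤m = ≤-trans (lower-≤ t b) (t≤m S)
    ; tot = suc-injective (trans (sym (trans (N-⊖ κ (1≤b S A) (κb A) m) (cong (λ y → ind y + N (κ ⊖ b) m) (≤ᵇ-true (b≤m A))))) (tot S))
    }
    where
    pos′ : ∀ i → 1 ≤ i → i ≤ lower t b → 1 ≤ (κ ⊖ b) i
    pos′ i 1≤i i≤ with b ≡ᵇ t | ≡ᵇ-dec b t
    pos′ i 1≤i i≤ | _ | is refl = subst (1 ≤_) (sym (⊖-other κ (<⇒≢ i<b))) (pos S i 1≤i (<⇒≤ i<b))
      where
      i<b : i < b
      i<b = subst (i <_) (suc-pred b {{>-nonZero (1≤b S A)}}) (s≤s i≤)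
    pos′ i 1≤i i≤ | _ | isnt ne = subst (1 ≤_) (sym (⊖-other κ (<⇒≢ (≤-<-trans i≤ (≤∧≢⇒< (t≤b A) (ne ∘ sym)))))) (pos S i 1≤i i≤)

  ∈-letters⁻ : ∀ {t b} → t ≤ m → b ∈ letters t → t ≤ b × b ≤ m
  ∈-letters⁻ {t} {b} t≤m b∈ with ∈-from⁻ t (suc m ∸ t) b∈
  ... | t≤b , b<e = t≤b , s≤s⁻¹ (subst (b <_) (m+[n∸m]≡n (m≤n⇒m≤1+n t≤m)) b<e)

  ∈-letters⁺ : ∀ {t b} → t ≤ b → b ≤ m → b ∈ letters t
  ∈-letters⁺ {t} {b} t≤b b≤m = ∈-from⁺ t (suc m ∸ t) t≤b (subst (b <_) (sym (m+[n∸m]≡n (m≤n⇒m≤1+n (≤-trans t≤b b≤m)))) (s≤s b≤m))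

  ∈E⁻ : ∀ {n κ t v} → State (suc n) κ t → v ∈ E (suc n) κ t →
    ∃ λ b → ∃ λ v′ → Allowed κ t b × v ≡ b ∷ v′ × v′ ∈ E n (κ ⊖ b) (lower t b)
  ∈E⁻ {n} {κ} {t} {v} S v∈ with find (∈-concatMap⁻ _ {xs = letters t} v∈)
  ... | b , b∈ , v∈b with 1 ≤ᵇ κ b | ≤ᵇ-dec 1 (κ b)
  ∈E⁻ S v∈ | b , b∈ , v∈b | _ | is h with ∈-map⁻ (b ∷_) v∈b | ∈-letters⁻ (t≤m S) b∈
  ... | v′ , v′∈ , refl | t≤b , b≤m = b , v′ , allowed t≤b b≤m h , refl , v′∈
  ∈E⁻ S v∈ | b , b∈ , () | _ | isnt h

  ∈E⁺ : ∀ {n κ t b v} → Allowed κ t b → v ∈ E n (κ ⊖ b) (lower t b) → b ∷ v ∈ E (suc n) κ t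
  ∈E⁺ {n} {κ} {t} {b} {v} A v∈ = ∈-concatMap⁺ _ {xs = letters t} (lose (∈-letters⁺ (t≤b A) (b≤m A)) mem)
    where
    mem : b ∷ v ∈ (if 1 ≤ᵇ κ b then map (b ∷_) (E n (κ ⊖ b) (lower t b)) else [])
    mem rewrite ≤ᵇ-true (κb A) = ∈-map⁺ (b ∷_) v∈

  ∑-E : ∀ n κ t (g : Word → ℕ) → ∑ (E (suc n) κ t) g
    ≡ ∑ (letters t) (λ b → if 1 ≤ᵇ κ b then ∑ (E n (κ ⊖ b) (lower t b)) (λ v → g (b ∷ v)) else 0)
  ∑-E n κ t g = trans (∑-concatMap _ (letters t) g) (∑-cong (letters t) aux)
    where
    aux : ∀ b → ∑ (if 1 ≤ᵇ κ b then map (b ∷_) (E n (κ ⊖ b) (lower t b)) else []) g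
              ≡ (if 1 ≤ᵇ κ b then ∑ (E n (κ ⊖ b) (lower t b)) (λ v → g (b ∷ v)) else 0)
    aux b with 1 ≤ᵇ κ b
    ... | true  = ∑-map (b ∷_) (E n (κ ⊖ b) (lower t b)) g
    ... | false = refl

  ∑-E-cong : ∀ {n κ t} (g h : Word → ℕ) → State (suc n) κ t →
    (∀ b → Allowed κ t b → ∑ (E n (κ ⊖ b) (lower t b)) (λ v → g (b ∷ v)) ≡ ∑ (E n (κ ⊖ b) (lower t b)) (λ v → h (b ∷ v))) →
    ∑ (E (suc n) κ t) g ≡ ∑ (E (suc n) κ t) h
  ∑-E-cong {n} {κ} {t} g h S eq = trans (∑-E n κ t g) (trans (∑-cong-∈ (letters t) aux) (sym (∑-E n κ t h)))
    where
    branch : (Word → ℕ) → ℕ → ℕ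
    branch g b = if 1 ≤ᵇ κ b then ∑ (E n (κ ⊖ b) (lower t b)) (λ v → g (b ∷ v)) else 0
    aux : ∀ b → b ∈ letters t → branch g b ≡ branch h b
    aux b b∈ with 1 ≤ᵇ κ b | ≤ᵇ-dec 1 (κ b)
    ... | _ | is p   = eq b (allowed (proj₁ (∈-letters⁻ (t≤m S) b∈)) (proj₂ (∈-letters⁻ (t≤m S) b∈)) p)
    ... | _ | isnt _ = refl

  E-length : ∀ n {κ t} → State n κ t → ∀ v → v ∈ E n κ t → length v ≡ n
  E-length zero    S .[] (here refl) = refl
  E-length (suc n) S v v∈ with ∈E⁻ S v∈
  ... | b , v′ , A , refl , v′∈ = cong suc (E-length n (next S A) v′ v′∈)

  E-cnt≤ : ∀ n {κ t} → State n κ t → ∀ v → v ∈ E n κ t → ∀ c → c ≤ m → cnt (_≤ᵇ c) v ≡ N κ c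
  E-cnt≤ zero {κ} S .[] (here refl) c c≤m = sym (n≤0⇒n≡0 (subst (N κ c ≤_) (tot S) (N-mono κ c≤m)))
  E-cnt≤ (suc n) {κ} S v v∈ c c≤m with ∈E⁻ S v∈
  ... | b , v′ , A , refl , v′∈ = trans (cong (ind (b ≤ᵇ c) +_) (E-cnt≤ n (next S A) v′ v′∈ c c≤m)) (sym (N-⊖ κ (1≤b S A) (κb A) c))

  E-cnt> : ∀ n {κ t} → State n κ t → ∀ v → v ∈ E n κ t → ∀ c → c ≤ m → cnt (c <ᵇ_) v ≡ n ∸ N κ c
  E-cnt> n {κ} S v v∈ c c≤m = sym (begin
    n ∸ N κ c ≡⟨ cong₂ _∸_ (sym (trans (cnt-≤-> c v) (E-length n S v v∈))) (sym (E-cnt≤ n S v v∈ c c≤m)) ⟩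
    cnt (_≤ᵇ c) v + cnt (c <ᵇ_) v ∸ cnt (_≤ᵇ c) v ≡⟨ m+n∸m≡n (cnt (_≤ᵇ c) v) _ ⟩
    cnt (c <ᵇ_) v ∎)
    where open ≡-Reasoning

  E-cnt-between : ∀ n {κ t} → State n κ t → ∀ v → v ∈ E n κ t → ∀ b c → b ≤ c → c ≤ m →
    cnt (λ a → (b <ᵇ a) ∧ (a ≤ᵇ c)) v ≡ N κ c ∸ N κ b
  E-cnt-between n {κ} S v v∈ b c b≤c c≤m = sym (begin
    N κ c ∸ N κ b ≡⟨ cong₂ _∸_ (sym (trans (cnt-between b≤c v) (E-cnt≤ n S v v∈ c c≤m))) (sym (E-cnt≤ n S v v∈ b (≤-trans b≤c c≤m))) ⟩
    cnt (λ a → (b <ᵇ a) ∧ (a ≤ᵇ c)) v + cnt (_≤ᵇ b) v ∸ cnt (_≤ᵇ b) v ≡⟨ m+n∸n≡m _ (cnt (_≤ᵇ b) v) ⟩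
    cnt (λ a → (b <ᵇ a) ∧ (a ≤ᵇ c)) v ∎)
    where open ≡-Reasoning

  N-next : ∀ {n κ t b} → State (suc n) κ t → Allowed κ t b → ∀ c → b ≤ c → N κ c ≡ suc (N (κ ⊖ b) c)
  N-next {κ = κ} {b = b} S A c b≤c = trans (N-⊖ κ (1≤b S A) (κb A) c) (cong (λ y → ind y + N (κ ⊖ b) c) (≤ᵇ-true b≤c))

-- q-integers and the hook product

module QNumbers (q : ℕ) where

  ⟦_⟧ : ℕ → ℕ
  ⟦ zero ⟧  = 0
  ⟦ suc n ⟧ = 1 + q * ⟦ n ⟧

  ⟦_⟧! : ℕ → ℕ
  ⟦ zero ⟧!  = 1
  ⟦ suc n ⟧! = ⟦ suc n ⟧ * ⟦ n ⟧!

  ⟦+⟧ : ∀ a b → ⟦ a + b ⟧ ≡ ⟦ a ⟧ + q ^ a * ⟦ b ⟧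
  ⟦+⟧ zero    b = sym (*-identityˡ ⟦ b ⟧)
  ⟦+⟧ (suc a) b = trans (cong (λ x → 1 + q * x) (⟦+⟧ a b)) (aux q ⟦ a ⟧ (q ^ a) ⟦ b ⟧)
    where
    aux : ∀ q x y z → 1 + q * (x + y * z) ≡ 1 + q * x + (q * y) * z
    aux = solve-∀

  ⟦⟧!-pos : ∀ n → 1 ≤ ⟦ n ⟧!
  ⟦⟧!-pos zero    = ≤-refl
  ⟦⟧!-pos (suc n) = *-mono-≤ {1} {⟦ suc n ⟧} {1} {⟦ n ⟧!} (s≤s z≤n) (⟦⟧!-pos n)

module Hooks (q m : ℕ) where
  open QNumbers q
  open LastLetter m

  -- The factors of a q-hook product of a forest. For i ≤ t the last i comes after all `N κ i`
  -- letters at most i and has that hook; the other copies of i, and all copies of a letter beyond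
  -- t, are interchangeable leaves and give a factorial.
  φ : (ℕ → ℕ) → ℕ → ℕ → ℕ
  φ κ t i = if i ≤ᵇ t then ⟦ N κ i ⟧ * ⟦ pred (κ i) ⟧! else ⟦ κ i ⟧!

  D : ℕ → (ℕ → ℕ) → ℕ → ℕ
  D zero    κ t = 1
  D (suc i) κ t = D i κ t * φ κ t (suc i)

  -- The quotient of the hook products before and after the removal of b. For b = t the whole hook
  -- `N κ t` disappears, since t becomes unconstrained: this is the size of the merged letter.
  μ : (ℕ → ℕ) → ℕ → ℕ → ℕ
  μ κ t b = if b ≡ᵇ t then N κ t else κ b

  D-pos : ∀ {n κ t} → State n κ t → ∀ i → 1 ≤ D i κ t
  D-pos S zero = ≤-refl
  D-pos {κ = κ} {t} S (suc i) = *-mono-≤ {1} {D i κ t} {1} {φ κ t (suc i)} (D-pos S i) aux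
    where
    pos⟦⟧ : ∀ {k} → 1 ≤ k → 1 ≤ ⟦ k ⟧
    pos⟦⟧ (s≤s _) = s≤s z≤n
    aux : 1 ≤ φ κ t (suc i)
    aux with suc i ≤ᵇ t | ≤ᵇ-dec (suc i) t
    ... | _ | is h   = *-mono-≤ {1} {_} {1} (pos⟦⟧ (≤-trans (pos S (suc i) (s≤s z≤n) h) (m≤n+m (κ (suc i)) (N κ i)))) (⟦⟧!-pos (pred (κ (suc i))))
    ... | _ | isnt _ = ⟦⟧!-pos (κ (suc i))

  φ-below : ∀ {n κ t b} → State (suc n) κ t → Allowed κ t b → ∀ i → i < b → φ (κ ⊖ b) (lower t b) i ≡ φ κ t i
  φ-below {κ = κ} {t} {b} S A i i<b rewrite ⊖-other κ (<⇒≢ i<b) | N-⊖-below κ i i<b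
    = cong (λ y → if y then ⟦ N κ i ⟧ * ⟦ pred (κ i) ⟧! else ⟦ κ i ⟧!) test
    where
    test : (i ≤ᵇ lower t b) ≡ (i ≤ᵇ t)
    test with b ≡ᵇ t | ≡ᵇ-dec b t
    ... | _ | is refl = trans (≤ᵇ-true (s≤s⁻¹ (subst (i <_) (sym (suc-pred b {{>-nonZero (1≤b S A)}})) i<b))) (sym (≤ᵇ-true (<⇒≤ i<b)))
    ... | _ | isnt _  = refl

  φ-at : ∀ {n κ t b} → State (suc n) κ t → Allowed κ t b → φ κ t b ≡ ⟦ μ κ t b ⟧ * φ (κ ⊖ b) (lower t b) b
  φ-at {κ = κ} {t} {b} S A rewrite ⊖-same κ b with b ≡ᵇ t | ≡ᵇ-dec b t
  ... | _ | is refl rewrite ≤ᵇ-true (≤-refl {b}) | ≤ᵇ-false (subst (pred b <_) (suc-pred b {{>-nonZero (1≤b S A)}}) ≤-refl) = refl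
  ... | _ | isnt ne rewrite ≤ᵇ-false (≤∧≢⇒< (t≤b A) (ne ∘ sym)) = aux (κ b) (κb A)
    where
    aux : ∀ k → 1 ≤ k → ⟦ k ⟧! ≡ ⟦ k ⟧ * ⟦ pred k ⟧!
    aux (suc k) _ = refl

  φ-above : ∀ {n κ t b} → State (suc n) κ t → Allowed κ t b → ∀ i → b < i → φ (κ ⊖ b) (lower t b) i ≡ φ κ t i
  φ-above {κ = κ} {t} {b} S A i b<i rewrite ⊖-other κ (>⇒≢ b<i) | ≤ᵇ-false (≤-<-trans (t≤b A) b<i)
    | ≤ᵇ-false (≤-<-trans (lower-≤ t b) (≤-<-trans (t≤b A) b<i)) = refl

  D-below : ∀ {n κ t b} → State (suc n) κ t → Allowed κ t b → ∀ i → i < b → D i (κ ⊖ b) (lower t b) ≡ D i κ t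
  D-below S A zero    _   = refl
  D-below S A (suc i) i<b = cong₂ _*_ (D-below S A i (<⇒≤ i<b)) (φ-below S A (suc i) i<b)

  D-step : ∀ {n κ t b} → State (suc n) κ t → Allowed κ t b → ∀ i → b ≤ i → D i κ t ≡ ⟦ μ κ t b ⟧ * D i (κ ⊖ b) (lower t b)
  D-step S A zero b≤ = contradiction (≤-trans (1≤b S A) b≤) λ ()
  D-step {κ = κ} {t} {b} S A (suc i) b≤ with m≤n⇒m<n∨m≡n b≤
  ... | inj₁ (s≤s b≤i) = trans (cong₂ _*_ (D-step S A i b≤i) (sym (φ-above S A (suc i) (s≤s b≤i)))) (*-assoc ⟦ μ κ t b ⟧ _ _)
  ... | inj₂ refl = trans (cong₂ _*_ (sym (D-below S A i ≤-refl)) (φ-at S A))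
                          (comm (D i (κ ⊖ b) (lower t b)) ⟦ μ κ t b ⟧ _)
    where
    comm : ∀ a b c → a * (b * c) ≡ b * (a * c)
    comm = solve-∀

  -- The induction shared by the statistics below. Multiplied by the hook product, the branch of b
  -- contributes `q ^ wt b * ⟦ μ κ t b ⟧` by `D-step`, so the claim reduces to one identity between
  -- q-integers. The constant `c` leaves room for a power of q, as in `inv-jump`.
  step : ∀ {n κ t} → State (suc n) κ t → ∀ (f : Word → ℕ) (c : ℕ) (wt : ℕ → ℕ) →
    (∀ b → Allowed κ t b → ∑ (E n (κ ⊖ b) (lower t b)) (λ v → q ^ f (b ∷ v)) * D m (κ ⊖ b) (lower t b) ≡ c * (q ^ wt b * ⟦ n ⟧!)) →
    ∑ (letters t) (λ b → q ^ wt b * ⟦ μ κ t b ⟧) ≡ ⟦ suc n ⟧ →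
    ∑ (E (suc n) κ t) (λ v → q ^ f v) * D m κ t ≡ c * ⟦ suc n ⟧!
  step {n} {κ} {t} S f c wt each total = begin
    ∑ (E (suc n) κ t) (λ v → q ^ f v) * D m κ t
      ≡⟨ cong (_* D m κ t) (∑-E n κ t _) ⟩
    ∑ (letters t) term * D m κ t
      ≡⟨ sym (∑-*ʳ (letters t) (D m κ t) term) ⟩
    ∑ (letters t) (λ b → term b * D m κ t)
      ≡⟨ ∑-cong-∈ (letters t) one ⟩
    ∑ (letters t) (λ b → (c * ⟦ n ⟧!) * (q ^ wt b * ⟦ μ κ t b ⟧))
      ≡⟨ ∑-*ˡ (letters t) (c * ⟦ n ⟧!) _ ⟩
    (c * ⟦ n ⟧!) * ∑ (letters t) (λ b → q ^ wt b * ⟦ μ κ t b ⟧)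
      ≡⟨ cong (c * ⟦ n ⟧! *_) total ⟩
    (c * ⟦ n ⟧!) * ⟦ suc n ⟧
      ≡⟨ comm c ⟦ n ⟧! ⟦ suc n ⟧ ⟩
    c * ⟦ suc n ⟧! ∎
    where
    open ≡-Reasoning
    comm : ∀ a b c → a * b * c ≡ a * (c * b)
    comm = solve-∀
    term : ℕ → ℕ
    term b = if 1 ≤ᵇ κ b then ∑ (E n (κ ⊖ b) (lower t b)) (λ v → q ^ f (b ∷ v)) else 0
    -- A letter that is used up has an empty branch on one side and the summand [0] = 0 on the
    -- other, so the sum may run over all of `letters t`.
    μ-zero : ∀ b → κ b ≡ 0 → μ κ t b ≡ 0
    μ-zero b κb≡0 with b ≡ᵇ t | ≡ᵇ-dec b t
    ... | _ | isnt _ = κb≡0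
    μ-zero zero    κb≡0 | _ | is refl = refl
    μ-zero (suc b) κb≡0 | _ | is refl = contradiction (subst (1 ≤_) κb≡0 (pos S (suc b) (s≤s z≤n) ≤-refl)) λ ()
    one : ∀ b → b ∈ letters t → term b * D m κ t ≡ (c * ⟦ n ⟧!) * (q ^ wt b * ⟦ μ κ t b ⟧)
    one b b∈ with 1 ≤ᵇ κ b | ≤ᵇ-dec 1 (κ b)
    ... | _ | isnt κb<1 rewrite μ-zero b (n<1⇒n≡0 κb<1) = sym (trans (cong (c * ⟦ n ⟧! *_) (*-zeroʳ (q ^ wt b))) (*-zeroʳ (c * ⟦ n ⟧!)))
    ... | _ | is p = begin
        Σb * D m κ t ≡⟨ cong (Σb *_) (D-step S A m (b≤m A)) ⟩
        Σb * (⟦ μ κ t b ⟧ * D m (κ ⊖ b) (lower t b)) ≡⟨ sw Σb ⟦ μ κ t b ⟧ _ ⟩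
        ⟦ μ κ t b ⟧ * (Σb * D m (κ ⊖ b) (lower t b)) ≡⟨ cong (⟦ μ κ t b ⟧ *_) (each b A) ⟩
        ⟦ μ κ t b ⟧ * (c * (q ^ wt b * ⟦ n ⟧!)) ≡⟨ sw2 ⟦ μ κ t b ⟧ c (q ^ wt b) ⟦ n ⟧! ⟩
        (c * ⟦ n ⟧!) * (q ^ wt b * ⟦ μ κ t b ⟧) ∎
      where
      A : Allowed κ t b
      A = allowed (proj₁ (∈-letters⁻ (t≤m S) b∈)) (proj₂ (∈-letters⁻ (t≤m S) b∈)) p
      Σb : ℕ
      Σb = ∑ (E n (κ ⊖ b) (lower t b)) (λ v → q ^ f (b ∷ v))
      sw : ∀ a b c → a * (b * c) ≡ b * (a * c)
      sw = solve-∀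
      sw2 : ∀ a b c d → a * (b * (c * d)) ≡ (b * d) * (c * a)
      sw2 = solve-∀

  D-base : ∀ {κ t} → State 0 κ t → ∀ i → i ≤ m → D i κ t ≡ 1
  D-base S zero    _   = refl
  D-base {κ} {t} S (suc i) i<m rewrite D-base S i (<⇒≤ i<m) = aux
    where
    κ≡0 : κ (suc i) ≡ 0
    κ≡0 = n≤0⇒n≡0 (≤-trans (m≤n+m (κ (suc i)) (N κ i)) (subst (N κ (suc i) ≤_) (tot S) (N-mono κ i<m)))
    aux : 1 * φ κ t (suc i) ≡ 1
    aux with suc i ≤ᵇ t | ≤ᵇ-dec (suc i) t
    ... | _ | is h = contradiction (subst (1 ≤_) κ≡0 (pos S (suc i) (s≤s z≤n) h)) λ ()
    ... | _ | isnt _ rewrite κ≡0 = refl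

  cancel-D : ∀ {n κ t} → State n κ t → ∀ {x y z} → x * D m κ t ≡ z → y * D m κ t ≡ z → x ≡ y
  cancel-D S {x} {y} p r = *-cancelʳ-≡ x y _ {{>-nonZero (D-pos S m)}} (trans p (sym r))

  -- Letters weighted by the number of letters in the cyclic interval from b (excluded) to c.
  cyc : (ℕ → ℕ) → ℕ → ℕ → ℕ
  cyc κ c b = if b ≤ᵇ c then N κ c ∸ N κ b else (N κ m ∸ N κ b) + N κ c

  -- Iterated `⟦+⟧`: the q-integer of the total size is cut into one block per letter, each shifted
  -- by the sizes of the blocks of larger letters.
  telescope : ∀ κ s a → ∑ (from (suc a) s) (λ b → q ^ (N κ (a + s) ∸ N κ b) * ⟦ κ b ⟧) ≡ ⟦ N κ (a + s) ∸ N κ a ⟧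
  telescope κ zero a rewrite +-identityʳ a | n∸n≡0 (N κ a) = refl
  telescope κ (suc s) a rewrite +-suc a s = begin
    q ^ x * ⟦ κ (suc a) ⟧ + ∑ (from (suc (suc a)) s) (λ b → q ^ (N κ (suc (a + s)) ∸ N κ b) * ⟦ κ b ⟧)
      ≡⟨ cong (q ^ x * ⟦ κ (suc a) ⟧ +_) (telescope κ s (suc a)) ⟩
    q ^ x * ⟦ κ (suc a) ⟧ + ⟦ x ⟧ ≡⟨ +-comm _ ⟦ x ⟧ ⟩
    ⟦ x ⟧ + q ^ x * ⟦ κ (suc a) ⟧ ≡⟨ sym (⟦+⟧ x (κ (suc a))) ⟩
    ⟦ x + κ (suc a) ⟧ ≡⟨ cong ⟦_⟧ (sym split) ⟩
    ⟦ N κ (suc (a + s)) ∸ N κ a ⟧ ∎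
    where
    open ≡-Reasoning
    x : ℕ
    x = N κ (suc (a + s)) ∸ N κ (suc a)
    split : N κ (suc (a + s)) ∸ N κ a ≡ x + κ (suc a)
    split = begin
      N κ (suc (a + s)) ∸ N κ a ≡⟨ cong (_∸ N κ a) (sym (m∸n+n≡m (N-mono κ {suc a} (s≤s (m≤m+n a s))))) ⟩
      x + (N κ a + κ (suc a)) ∸ N κ a ≡⟨ cong (_∸ N κ a) (re x (N κ a) (κ (suc a))) ⟩
      x + κ (suc a) + N κ a ∸ N κ a ≡⟨ m+n∸n≡m _ (N κ a) ⟩
      x + κ (suc a) ∎
      where
      re : ∀ a b c → a + (b + c) ≡ a + c + b
      re = solve-∀

  letters-split : ∀ {t c} → t ≤ c → c ≤ m → letters t ≡ (t ∷ from (suc t) (c ∸ t)) ++ from (suc c) (m ∸ c)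
  letters-split {t} {c} t≤c c≤m = begin
    from t (suc m ∸ t) ≡⟨ cong (from t) eq ⟩
    from t (suc (c ∸ t) + (m ∸ c)) ≡⟨ from-++ t (suc (c ∸ t)) (m ∸ c) ⟩
    from t (suc (c ∸ t)) ++ from (t + suc (c ∸ t)) (m ∸ c)
      ≡⟨ cong (λ u → from t (suc (c ∸ t)) ++ from u (m ∸ c)) (trans (+-suc t (c ∸ t)) (cong suc (m+[n∸m]≡n t≤c))) ⟩
    from t (suc (c ∸ t)) ++ from (suc c) (m ∸ c) ∎
    where
    open ≡-Reasoning
    eq : suc m ∸ t ≡ suc (c ∸ t) + (m ∸ c)
    eq = begin
      suc m ∸ t ≡⟨ +-∸-assoc 1 (≤-trans t≤c c≤m) ⟩
      suc (m ∸ t) ≡⟨ cong (λ y → suc (y ∸ t)) (sym (m+[n∸m]≡n c≤m)) ⟩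
      suc (c + (m ∸ c) ∸ t) ≡⟨ cong suc (+-∸-comm (m ∸ c) t≤c) ⟩
      suc (c ∸ t + (m ∸ c)) ∎

  μ-other : ∀ κ {t b} → b ≢ t → μ κ t b ≡ κ b
  μ-other κ ne rewrite ≡ᵇ-false ne = refl

  -- The letters at most c fill [N κ c], and those above c follow after the shift `q ^ N κ c`;
  -- together they tile [N κ m]. The hypothesis `t ≤ c` keeps the merged letter on one side of the
  -- cut.
  cyc-total : ∀ κ {t c} → t ≤ c → c ≤ m → ∑ (letters t) (λ b → q ^ cyc κ c b * ⟦ μ κ t b ⟧) ≡ ⟦ N κ m ⟧
  cyc-total κ {t} {c} t≤c c≤m = begin
    ∑ (letters t) g ≡⟨ cong (λ l → ∑ l g) (letters-split t≤c c≤m) ⟩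
    ∑ ((t ∷ from (suc t) (c ∸ t)) ++ from (suc c) (m ∸ c)) g
      ≡⟨ ∑-++ (t ∷ from (suc t) (c ∸ t)) (from (suc c) (m ∸ c)) g ⟩
    g t + ∑ (from (suc t) (c ∸ t)) g + ∑ (from (suc c) (m ∸ c)) g
      ≡⟨ cong₂ (λ x y → x + y + ∑ (from (suc c) (m ∸ c)) g) g-t (∑-cong-∈ (from (suc t) (c ∸ t)) low) ⟩
    q ^ (N κ c ∸ N κ t) * ⟦ N κ t ⟧ + ∑ (from (suc t) (c ∸ t)) (λ b → q ^ (N κ (t + (c ∸ t)) ∸ N κ b) * ⟦ κ b ⟧) + ∑ (from (suc c) (m ∸ c)) g
      ≡⟨ cong₂ (λ x y → q ^ (N κ c ∸ N κ t) * ⟦ N κ t ⟧ + x + y) (trans (telescope κ (c ∸ t) t) (cong (λ y → ⟦ N κ y ∸ N κ t ⟧) (m+[n∸m]≡n t≤c)))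
           (∑-cong-∈ (from (suc c) (m ∸ c)) high) ⟩
    q ^ (N κ c ∸ N κ t) * ⟦ N κ t ⟧ + ⟦ N κ c ∸ N κ t ⟧
      + ∑ (from (suc c) (m ∸ c)) (λ b → q ^ N κ c * (q ^ (N κ (c + (m ∸ c)) ∸ N κ b) * ⟦ κ b ⟧))
      ≡⟨ cong₂ _+_ (trans (+-comm _ ⟦ N κ c ∸ N κ t ⟧) (trans (sym (⟦+⟧ (N κ c ∸ N κ t) (N κ t))) (cong ⟦_⟧ (m∸n+n≡m (N-mono κ t≤c)))))
          (trans (∑-*ˡ (from (suc c) (m ∸ c)) (q ^ N κ c) _) (cong (q ^ N κ c *_) (trans (telescope κ (m ∸ c) c) (cong (λ y → ⟦ N κ y ∸ N κ c ⟧) (m+[n∸m]≡n c≤m))))) ⟩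
    ⟦ N κ c ⟧ + q ^ N κ c * ⟦ N κ m ∸ N κ c ⟧
      ≡⟨ sym (⟦+⟧ (N κ c) (N κ m ∸ N κ c)) ⟩
    ⟦ N κ c + (N κ m ∸ N κ c) ⟧ ≡⟨ cong ⟦_⟧ (m+[n∸m]≡n (N-mono κ c≤m)) ⟩
    ⟦ N κ m ⟧ ∎
    where
    open ≡-Reasoning
    g : ℕ → ℕ
    g b = q ^ cyc κ c b * ⟦ μ κ t b ⟧
    g-t : g t ≡ q ^ (N κ c ∸ N κ t) * ⟦ N κ t ⟧
    g-t rewrite ≤ᵇ-true t≤c | ≡ᵇ-refl t = refl
    low : ∀ b → b ∈ from (suc t) (c ∸ t) → g b ≡ q ^ (N κ (t + (c ∸ t)) ∸ N κ b) * ⟦ κ b ⟧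
    low b b∈ with ∈-from⁻ (suc t) (c ∸ t) b∈
    ... | t<b , b<e rewrite m+[n∸m]≡n t≤c | ≤ᵇ-true (s≤s⁻¹ b<e) | ≡ᵇ-false (>⇒≢ t<b) = refl
    high : ∀ b → b ∈ from (suc c) (m ∸ c) → g b ≡ q ^ N κ c * (q ^ (N κ (c + (m ∸ c)) ∸ N κ b) * ⟦ κ b ⟧)
    high b b∈ with ∈-from⁻ (suc c) (m ∸ c) b∈
    ... | c<b , b<e rewrite m+[n∸m]≡n c≤m | ≤ᵇ-false c<b | ≡ᵇ-false (>⇒≢ (≤-<-trans t≤c c<b))
      | ^-distribˡ-+-* q (N κ m ∸ N κ b) (N κ c) = re (q ^ (N κ m ∸ N κ b)) (q ^ N κ c) ⟦ κ b ⟧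
      where
      re : ∀ a b c → a * b * c ≡ b * (a * c)
      re = solve-∀

-- INV, r-MAJ and MAJ_d

m∸n+n∸o : ∀ {m n o} → o ≤ n → n ≤ m → (m ∸ n) + (n ∸ o) ≡ m ∸ o
m∸n+n∸o {m} {n} {o} o≤n n≤m = trans (sym (+-∸-assoc (m ∸ n) o≤n)) (cong (_∸ o) (m∸n+n≡m n≤m))

module LastLetterStatistics (q m : ℕ) where
  open QNumbers q
  open LastLetter m
  open Hooks q m

  E-≤m : ∀ n {κ t} → State n κ t → ∀ v → v ∈ E n κ t → ∀ x → x ∈ v → x ≤ m
  E-≤m zero    S .[] (here refl) x ()
  E-≤m (suc n) S v v∈ x x∈ with ∈E⁻ S v∈
  E-≤m (suc n) S .(b ∷ v′) v∈ x (here refl) | b , v′ , A , refl , v′∈ = b≤m A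
  E-≤m (suc n) S .(b ∷ v′) v∈ x (there x∈)  | b , v′ , A , refl , v′∈ = E-≤m n (next S A) v′ v′∈ x x∈

  E-hd≤m : ∀ n {κ t} → State n κ t → ∀ v → v ∈ E n κ t → hd v ≤ m
  E-hd≤m n S []      v∈ = z≤n
  E-hd≤m n S (x ∷ v) v∈ = E-≤m n S (x ∷ v) v∈ x (here refl)

  factor : {A : Set} (xs : List A) (f g : A → ℕ) (a : ℕ) → (∀ v → v ∈ xs → f v ≡ a + g v) →
    ∑ xs (λ v → q ^ f v) ≡ q ^ a * ∑ xs (λ v → q ^ g v)
  factor xs f g a h = trans (∑-cong-∈ xs (λ v v∈ → trans (cong (q ^_) (h v v∈)) (^-distribˡ-+-* q a (g v)))) (∑-*ˡ xs (q ^ a) _)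

  inv-next : ∀ {n κ t b} (S : State (suc n) κ t) (A : Allowed κ t b) → ∀ v → v ∈ E n (κ ⊖ b) (lower t b) →
    cnt (b <ᵇ_) v ≡ suc n ∸ N κ b
  inv-next {n} {κ} {t} {b} S A v v∈ = trans (E-cnt> n (next S A) v v∈ b (b≤m A)) (cong (suc n ∸_) (sym (N-next S A b ≤-refl)))

  -- For c = m there is no wrap-around: `cyc κ m b` counts the letters above b, which are the
  -- inversions closed by a last letter b.
  inv-total : ∀ n {κ t} → State n κ t → ∑ (E n κ t) (λ v → q ^ inv v) * D m κ t ≡ ⟦ n ⟧!
  inv-total zero S = trans (*-identityˡ _) (D-base S m ≤-refl)
  inv-total (suc n) {κ} {t} S = trans (step S inv 1 (cyc κ m) each (trans (cyc-total κ (t≤m S) ≤-refl) (cong ⟦_⟧ (tot S)))) (*-identityˡ _)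
    where
    each : ∀ b → Allowed κ t b → ∑ (E n (κ ⊖ b) (lower t b)) (λ v → q ^ inv (b ∷ v)) * D m (κ ⊖ b) (lower t b) ≡ 1 * (q ^ cyc κ m b * ⟦ n ⟧!)
    each b A = begin
      ∑ (E n (κ ⊖ b) (lower t b)) (λ v → q ^ inv (b ∷ v)) * D m (κ ⊖ b) (lower t b)
        ≡⟨ cong (_* D m (κ ⊖ b) (lower t b)) (factor _ _ inv (cyc κ m b) (λ v v∈ → trans (+-comm (inv v) _) (cong (_+ inv v) (weight v v∈)))) ⟩
      q ^ cyc κ m b * ∑ (E n (κ ⊖ b) (lower t b)) (λ v → q ^ inv v) * D m (κ ⊖ b) (lower t b)
        ≡⟨ *-assoc (q ^ cyc κ m b) _ _ ⟩
      q ^ cyc κ m b * (∑ (E n (κ ⊖ b) (lower t b)) (λ v → q ^ inv v) * D m (κ ⊖ b) (lower t b))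
        ≡⟨ cong (q ^ cyc κ m b *_) (inv-total n (next S A)) ⟩
      q ^ cyc κ m b * ⟦ n ⟧! ≡⟨ sym (*-identityˡ _) ⟩
      1 * (q ^ cyc κ m b * ⟦ n ⟧!) ∎
      where
      open ≡-Reasoning
      weight : ∀ v → v ∈ E n (κ ⊖ b) (lower t b) → cnt (b <ᵇ_) v ≡ cyc κ m b
      weight v v∈ rewrite ≤ᵇ-true (b≤m A) | tot S = inv-next S A v v∈

  -- Adding n when the last letter exceeds c has the same effect on the distribution of inv as
  -- adding the number of letters exceeding c; this replaces Foata's second fundamental transformation.
  inv-jump : ∀ n {κ t c} → State n κ t → t ≤ c → c ≤ m →
    ∑ (E n κ t) (λ v → q ^ (inv v + (if c <ᵇ hd v then n else 0))) ≡ q ^ (n ∸ N κ c) * ∑ (E n κ t) (λ v → q ^ inv v)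
  inv-jump zero {κ} {c = c} S t≤c c≤m rewrite 0∸n≡0 (N κ c) = refl
  inv-jump (suc n) {κ} {t} {c} S t≤c c≤m = cancel-D S
      (step S f (q ^ (suc n ∸ N κ c)) (cyc κ c) each (trans (cyc-total κ t≤c c≤m) (cong ⟦_⟧ (tot S))))
      (trans (*-assoc (q ^ (suc n ∸ N κ c)) _ _) (cong (q ^ (suc n ∸ N κ c) *_) (inv-total (suc n) S)))
    where
    open ≡-Reasoning
    f : Word → ℕ
    f v = inv v + (if c <ᵇ hd v then suc n else 0)
    N≤ : ∀ {b} → b ≤ m → N κ b ≤ suc n
    N≤ {b} b≤m = subst (N κ b ≤_) (tot S) (N-mono κ b≤m)
    -- The jump rotates the natural order: the letters above c gain `suc n`, and once the common
    -- `suc n ∸ N κ c` is split off, the exponents are those of the cyclic order ending in c.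
    weight : ∀ b → b ≤ m → (suc n ∸ N κ b) + (if c <ᵇ b then suc n else 0) ≡ (suc n ∸ N κ c) + cyc κ c b
    weight b b≤m with b ≤ᵇ c | ≤ᵇ-dec b c
    ... | _ | is b≤c rewrite <ᵇ-false b≤c = trans (+-identityʳ _) (sym (m∸n+n∸o (N-mono κ b≤c) (N≤ c≤m)))
    ... | _ | isnt c<b rewrite <ᵇ-true c<b | tot S = sym (trans (+-exchange (suc n ∸ N κ c) (suc n ∸ N κ b) (N κ c)) (cong ((suc n ∸ N κ b) +_) (m∸n+n≡m (N≤ c≤m))))
    each : ∀ b → Allowed κ t b → ∑ (E n (κ ⊖ b) (lower t b)) (λ v → q ^ f (b ∷ v)) * D m (κ ⊖ b) (lower t b) ≡ q ^ (suc n ∸ N κ c) * (q ^ cyc κ c b * ⟦ n ⟧!)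
    each b A = begin
      ∑ (E n (κ ⊖ b) (lower t b)) (λ v → q ^ f (b ∷ v)) * D m (κ ⊖ b) (lower t b)
        ≡⟨ cong (_* D m (κ ⊖ b) (lower t b)) (factor _ _ inv ((suc n ∸ N κ c) + cyc κ c b) (λ v v∈ →
             trans (+-assoc (inv v) _ _) (trans (+-comm (inv v) _) (cong (_+ inv v)
               (trans (cong (_+ (if c <ᵇ b then suc n else 0)) (inv-next S A v v∈)) (weight b (b≤m A))))))) ⟩
      q ^ ((suc n ∸ N κ c) + cyc κ c b) * I * D m (κ ⊖ b) (lower t b)
        ≡⟨ *-assoc (q ^ ((suc n ∸ N κ c) + cyc κ c b)) I _ ⟩
      q ^ ((suc n ∸ N κ c) + cyc κ c b) * (I * D m (κ ⊖ b) (lower t b))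
        ≡⟨ cong₂ _*_ (^-distribˡ-+-* q (suc n ∸ N κ c) (cyc κ c b)) (inv-total n (next S A)) ⟩
      q ^ (suc n ∸ N κ c) * q ^ cyc κ c b * ⟦ n ⟧! ≡⟨ *-assoc (q ^ (suc n ∸ N κ c)) _ _ ⟩
      q ^ (suc n ∸ N κ c) * (q ^ cyc κ c b * ⟦ n ⟧!) ∎
      where
      I : ℕ
      I = ∑ (E n (κ ⊖ b) (lower t b)) (λ v → q ^ inv v)

  -- The jump caused by the last letter depends on the letter before it, so it is moved into the
  -- weight `θ′` before the hypothesis is applied to the shorter word. Once `rmaj` has become `inv`,
  -- `inv-jump` trades the jump for the number of letters above c; with the K letters in (b, c]
  -- these are the inversions closed by b.
  rmaj-inv : ∀ r n {κ t} → State n κ t → (θ : ℕ → ℕ) →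
    ∑ (E n κ t) (λ v → q ^ (rmaj (suc r) v + θ (hd v))) ≡ ∑ (E n κ t) (λ v → q ^ (inv v + θ (hd v)))
  rmaj-inv r zero S θ = refl
  rmaj-inv r (suc n) {κ} {t} S θ = ∑-E-cong _ _ S each
    where
    open ≡-Reasoning
    each : ∀ b → Allowed κ t b →
      ∑ (E n (κ ⊖ b) (lower t b)) (λ v → q ^ (rmaj (suc r) (b ∷ v) + θ b)) ≡ ∑ (E n (κ ⊖ b) (lower t b)) (λ v → q ^ (inv (b ∷ v) + θ b))
    each b A = begin
      ∑ E′ (λ v → q ^ (rmaj (suc r) (b ∷ v) + θ b))
        ≡⟨ ∑-cong-∈ E′ (λ v v∈ → cong (q ^_) (unfold v v∈)) ⟩
      ∑ E′ (λ v → q ^ (rmaj (suc r) v + θ′ (hd v))) ≡⟨ rmaj-inv r n S′ θ′ ⟩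
      ∑ E′ (λ v → q ^ (inv v + θ′ (hd v)))
        ≡⟨ factor E′ _ (λ v → inv v + (if c <ᵇ hd v then n else 0)) (K + θ b) (λ v _ → re (inv v) K _ (θ b)) ⟩
      q ^ (K + θ b) * ∑ E′ (λ v → q ^ (inv v + (if c <ᵇ hd v then n else 0)))
        ≡⟨ cong (q ^ (K + θ b) *_) (inv-jump n S′ t≤c c≤m) ⟩
      q ^ (K + θ b) * (q ^ (n ∸ N κ′ c) * ∑ E′ (λ v → q ^ inv v))
        ≡⟨ sym (*-assoc (q ^ (K + θ b)) _ _) ⟩
      q ^ (K + θ b) * q ^ (n ∸ N κ′ c) * ∑ E′ (λ v → q ^ inv v)
        ≡⟨ cong (_* ∑ E′ (λ v → q ^ inv v)) (trans (sym (^-distribˡ-+-* q (K + θ b) (n ∸ N κ′ c))) (cong (q ^_) exponent)) ⟩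
      q ^ ((n ∸ N κ′ b) + θ b) * ∑ E′ (λ v → q ^ inv v)
        ≡⟨ sym (factor E′ _ inv ((n ∸ N κ′ b) + θ b) (λ v v∈ → trans (cong (λ y → inv v + y + θ b) (E-cnt> n S′ v v∈ b (b≤m A))) (re2 (inv v) _ (θ b)))) ⟩
      ∑ E′ (λ v → q ^ (inv (b ∷ v) + θ b)) ∎
      where
      κ′ : ℕ → ℕ
      κ′ = κ ⊖ b
      E′ : List Word
      E′ = E n κ′ (lower t b)
      S′ : State n κ′ (lower t b)
      S′ = next S A
      -- The parameter is r + 1, so a letter strictly between b and b + r + 1 lies in (b, b + r].
      -- The cap at m provides the bound that `inv-jump` asks for and loses no letter.
      c : ℕ
      c = (b + r) ⊓ m
      b≤c : b ≤ c
      b≤c = ⊓-glb (m≤m+n b r) (b≤m A)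
      c≤m : c ≤ m
      c≤m = m⊓n≤n (b + r) m
      t≤c : lower t b ≤ c
      t≤c = ≤-trans (≤-trans (lower-≤ t b) (t≤b A)) b≤c
      K : ℕ
      K = N κ′ c ∸ N κ′ b
      θ′ : ℕ → ℕ
      θ′ h = K + (if c <ᵇ h then n else 0) + θ b
      re : ∀ a k x t → a + (k + x + t) ≡ k + t + (a + x)
      re = solve-∀
      re2 : ∀ a k t → a + k + t ≡ k + t + a
      re2 = solve-∀
      exponent : K + θ b + (n ∸ N κ′ c) ≡ (n ∸ N κ′ b) + θ b
      exponent = trans (re3 K (θ b) (n ∸ N κ′ c)) (cong (_+ θ b) (m∸n+n∸o (N-mono κ′ b≤c) (subst (N κ′ c ≤_) (tot S′) (N-mono κ′ c≤m))))
        where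
        re3 : ∀ a b c → a + b + c ≡ c + a + b
        re3 = solve-∀
      inside : ∀ a → a ≤ m → ((a <ᵇ b + suc r) ∧ (b <ᵇ a)) ≡ ((b <ᵇ a) ∧ (a ≤ᵇ c))
      inside a a≤m rewrite +-suc b r with b <ᵇ a
      ... | false = ∧-zeroʳ (a <ᵇ suc (b + r))
      ... | true with a <ᵇ suc (b + r) | <ᵇ-dec a (suc (b + r))
      ...   | _ | is h   = sym (≤ᵇ-true (⊓-glb (s≤s⁻¹ h) a≤m))
      ...   | _ | isnt h = sym (≤ᵇ-false (≤-<-trans (m⊓n≤m (b + r) m) h))
      outside : ∀ h → h ≤ m → (b + suc r ≤ᵇ h) ≡ (c <ᵇ h)
      outside h h≤m rewrite +-suc b r with b + r <ᵇ h | <ᵇ-dec (b + r) h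
      ... | _ | is p   = sym (<ᵇ-true (≤-<-trans (m⊓n≤m (b + r) m) p))
      ... | _ | isnt p = sym (<ᵇ-false (⊓-glb p h≤m))
      unfold : ∀ v → v ∈ E′ → rmaj (suc r) (b ∷ v) + θ b ≡ rmaj (suc r) v + θ′ (hd v)
      unfold v v∈ = trans (cong₂ (λ x y → rmaj (suc r) v + (x + y) + θ b)
          (trans (∑-cong-∈ v (λ a a∈ → cong ind (inside a (E-≤m n S′ v v∈ a a∈)))) (E-cnt-between n S′ v v∈ b c b≤c c≤m))
          (cong₂ (λ x y → if x then y else 0) (outside (hd v) (E-hd≤m n S′ v v∈)) (E-length n S′ v v∈)))
        (+-assoc (rmaj (suc r) v) _ (θ b))

  rmaj-total : ∀ r n {κ t} → State n κ t → ∑ (E n κ t) (λ v → q ^ rmaj (suc r) v) ≡ ∑ (E n κ t) (λ v → q ^ inv v)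
  rmaj-total r n {κ} {t} S = begin
    ∑ (E n κ t) (λ v → q ^ rmaj (suc r) v) ≡⟨ ∑-cong (E n κ t) (λ v → cong (q ^_) (sym (+-identityʳ (rmaj (suc r) v)))) ⟩
    ∑ (E n κ t) (λ v → q ^ (rmaj (suc r) v + 0)) ≡⟨ rmaj-inv r n S (λ _ → 0) ⟩
    ∑ (E n κ t) (λ v → q ^ (inv v + 0)) ≡⟨ ∑-cong (E n κ t) (λ v → cong (q ^_) (+-identityʳ (inv v))) ⟩
    ∑ (E n κ t) (λ v → q ^ inv v) ∎
    where open ≡-Reasoning

  -- `inv-jump` for the word without its last d letters. Each of these closes a number of inversions
  -- that depends only on the letter itself and the current multiplicities, so its share can be
  -- absorbed into `g`.
  inv-jump-drop : ∀ d n {κ t c} → State n κ t → t ≤ c → c ≤ m → (g : Word → ℕ) →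
    ∑ (E n κ t) (λ v → q ^ (inv v + g (take d v) + (if c <ᵇ hd (drop d v) then n ∸ d else 0)))
      ≡ ∑ (E n κ t) (λ v → q ^ (inv v + g (take d v) + cnt (c <ᵇ_) (drop d v)))
  inv-jump-drop zero n {κ} {t} {c} S t≤c c≤m g = begin
    ∑ (E n κ t) (λ v → q ^ (inv v + g [] + (if c <ᵇ hd v then n else 0)))
      ≡⟨ factor (E n κ t) _ (λ v → inv v + (if c <ᵇ hd v then n else 0)) (g []) (λ v _ → re (inv v) (g []) _) ⟩
    q ^ g [] * ∑ (E n κ t) (λ v → q ^ (inv v + (if c <ᵇ hd v then n else 0)))
      ≡⟨ cong (q ^ g [] *_) (trans (inv-jump n S t≤c c≤m) (sym (factor (E n κ t) _ inv (n ∸ N κ c) (λ v v∈ → trans (+-comm (inv v) _) (cong (_+ inv v) (E-cnt> n S v v∈ c c≤m)))))) ⟩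
    q ^ g [] * ∑ (E n κ t) (λ v → q ^ (inv v + cnt (c <ᵇ_) v))
      ≡⟨ sym (factor (E n κ t) _ (λ v → inv v + cnt (c <ᵇ_) v) (g []) (λ v _ → re (inv v) (g []) _)) ⟩
    ∑ (E n κ t) (λ v → q ^ (inv v + g [] + cnt (c <ᵇ_) v)) ∎
    where
    open ≡-Reasoning
    re : ∀ a b c → a + b + c ≡ b + (a + c)
    re = solve-∀
  inv-jump-drop (suc d) zero S t≤c c≤m g = refl
  inv-jump-drop (suc d) (suc n) {κ} {t} {c} S t≤c c≤m g = ∑-E-cong _ _ S each
    where
    open ≡-Reasoning
    re : ∀ a b x y → a + b + x + y ≡ a + (x + b) + y
    re = solve-∀
    each : ∀ b → Allowed κ t b →
      ∑ (E n (κ ⊖ b) (lower t b)) (λ v → q ^ (inv (b ∷ v) + g (b ∷ take d v) + (if c <ᵇ hd (drop d v) then n ∸ d else 0)))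
        ≡ ∑ (E n (κ ⊖ b) (lower t b)) (λ v → q ^ (inv (b ∷ v) + g (b ∷ take d v) + cnt (c <ᵇ_) (drop d v)))
    each b A = trans (absorb (λ v → if c <ᵇ hd (drop d v) then n ∸ d else 0))
      (trans (inv-jump-drop d n (next S A) (≤-trans (lower-≤ t b) t≤c) c≤m g′) (sym (absorb (λ v → cnt (c <ᵇ_) (drop d v)))))
      where
      g′ : Word → ℕ
      g′ u = g (b ∷ u) + (suc n ∸ N κ b)
      absorb : ∀ (y : Word → ℕ) → ∑ (E n (κ ⊖ b) (lower t b)) (λ v → q ^ (inv (b ∷ v) + g (b ∷ take d v) + y v))
        ≡ ∑ (E n (κ ⊖ b) (lower t b)) (λ v → q ^ (inv v + g′ (take d v) + y v))
      absorb y = ∑-cong-∈ _ (λ v v∈ → cong (q ^_) (trans (cong (λ x → inv v + x + g (b ∷ take d v) + y v) (inv-next S A v v∈))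
        (re (inv v) _ (g (b ∷ take d v)) (y v))))

  take-take : ∀ d (v : Word) → take d (take (suc d) v) ≡ take d v
  take-take zero    v       = refl
  take-take (suc d) []      = refl
  take-take (suc d) (x ∷ v) = cong (x ∷_) (take-take d v)

  hd-drop-take : ∀ d v → hd (drop d (take (suc d) v)) ≡ hd (drop d v)
  hd-drop-take zero    []      = refl
  hd-drop-take zero    (x ∷ v) = refl
  hd-drop-take (suc d) []      = refl
  hd-drop-take (suc d) (x ∷ v) = hd-drop-take d v

  -- Here the contribution of the last letter reads d + 1 letters before it, d in the window and one
  -- for the jump; this is how far `θ` has to see.
  majd-inv : ∀ d n {κ t} → State n κ t → (θ : Word → ℕ) →
    ∑ (E n κ t) (λ v → q ^ (majd d v + θ (take (suc d) v))) ≡ ∑ (E n κ t) (λ v → q ^ (inv v + θ (take (suc d) v)))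
  majd-inv d zero S θ = refl
  majd-inv d (suc n) {κ} {t} S θ = ∑-E-cong _ _ S each
    where
    open ≡-Reasoning
    each : ∀ b → Allowed κ t b →
      ∑ (E n (κ ⊖ b) (lower t b)) (λ v → q ^ (majd d (b ∷ v) + θ (b ∷ take d v))) ≡ ∑ (E n (κ ⊖ b) (lower t b)) (λ v → q ^ (inv (b ∷ v) + θ (b ∷ take d v)))
    each b A = begin
      ∑ E′ (λ v → q ^ (majd d (b ∷ v) + θ (b ∷ take d v)))
        ≡⟨ ∑-cong-∈ E′ (λ v v∈ → cong (q ^_) (unfold v v∈)) ⟩
      ∑ E′ (λ v → q ^ (majd d v + θ′ (take (suc d) v))) ≡⟨ majd-inv d n (next S A) θ′ ⟩
      ∑ E′ (λ v → q ^ (inv v + θ′ (take (suc d) v)))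
        ≡⟨ ∑-cong E′ (λ v → cong (q ^_) (trans (cong (inv v +_) (θ′-take v)) (re (inv v) (cnt (b <ᵇ_) (take d v)) _ _))) ⟩
      ∑ E′ (λ v → q ^ (inv v + g (take d v) + (if b <ᵇ hd (drop d v) then n ∸ d else 0)))
        ≡⟨ inv-jump-drop d n (next S A) (≤-trans (lower-≤ t b) (t≤b A)) (b≤m A) g ⟩
      ∑ E′ (λ v → q ^ (inv v + g (take d v) + cnt (b <ᵇ_) (drop d v)))
        ≡⟨ ∑-cong E′ (λ v → cong (q ^_) (trans (re3 (inv v) (cnt (b <ᵇ_) (take d v)) _ _) (cong (λ y → inv v + y + θ (b ∷ take d v)) (cnt-take-drop v)))) ⟩
      ∑ E′ (λ v → q ^ (inv (b ∷ v) + θ (b ∷ take d v))) ∎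
      where
      E′ : List Word
      E′ = E n (κ ⊖ b) (lower t b)
      θ′ : Word → ℕ
      θ′ u = cnt (b <ᵇ_) (take d u) + (if b <ᵇ hd (drop d u) then n ∸ d else 0) + θ (b ∷ take d u)
      g : Word → ℕ
      g u = cnt (b <ᵇ_) u + θ (b ∷ u)
      θ′-take : ∀ v → θ′ (take (suc d) v) ≡ cnt (b <ᵇ_) (take d v) + (if b <ᵇ hd (drop d v) then n ∸ d else 0) + θ (b ∷ take d v)
      θ′-take v rewrite take-take d v | hd-drop-take d v = refl
      re : ∀ a b c d → a + (b + c + d) ≡ a + (b + d) + c
      re = solve-∀
      re3 : ∀ a b c d → a + (b + d) + c ≡ a + (b + c) + d
      re3 = solve-∀
      unfold : ∀ v → v ∈ E′ → majd d (b ∷ v) + θ (b ∷ take d v) ≡ majd d v + θ′ (take (suc d) v)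
      unfold v v∈ rewrite θ′-take v | length-drop d v | E-length n (next S A) v v∈ = +-assoc (majd d v) _ _
      cnt-take-drop : ∀ v → cnt (b <ᵇ_) (take d v) + cnt (b <ᵇ_) (drop d v) ≡ cnt (b <ᵇ_) v
      cnt-take-drop v = trans (sym (∑-++ (take d v) (drop d v) _)) (cong (cnt (b <ᵇ_)) (take++drop≡id d v))

  majd-total : ∀ d n {κ t} → State n κ t → ∑ (E n κ t) (λ v → q ^ majd d v) ≡ ∑ (E n κ t) (λ v → q ^ inv v)
  majd-total d n {κ} {t} S = begin
    ∑ (E n κ t) (λ v → q ^ majd d v) ≡⟨ ∑-cong (E n κ t) (λ v → cong (q ^_) (sym (+-identityʳ (majd d v)))) ⟩
    ∑ (E n κ t) (λ v → q ^ (majd d v + 0)) ≡⟨ majd-inv d n S (λ _ → 0) ⟩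
    ∑ (E n κ t) (λ v → q ^ (inv v + 0)) ≡⟨ ∑-cong (E n κ t) (λ v → cong (q ^_) (+-identityʳ (inv v))) ⟩
    ∑ (E n κ t) (λ v → q ^ inv v) ∎
    where open ≡-Reasoning

-- The Z-statistic under changing orders of the letters

-- bef c a v: among the letters a and c, the first one to occur in v is c.
bef : ℕ → ℕ → Word → Bool
bef c a []      = false
bef c a (x ∷ v) = if x ≡ᵇ c then true else if x ≡ᵇ a then false else bef c a v

-- MAJ of the subword of the letters a and c of the reversal of v, where c counts as the larger one
-- (also when c < a).
M : ℕ → ℕ → Word → ℕ
M a c []      = 0
M a c (x ∷ v) = (if x ≡ᵇ a then (if bef c a v then cnt (_≡ᵇ a) v + cnt (_≡ᵇ c) v else 0) else 0) + M a c v

M-other : ∀ {a x} c v → x ≢ a → M a c (x ∷ v) ≡ M a c v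
M-other c v x≢a rewrite ≡ᵇ-false x≢a = refl

-- Reversing the order of the two letters changes MAJ by an amount that depends only on the last letter.
M-swap : ∀ {b c} → b ≢ c → ∀ v → M b c (b ∷ v) ≡ cnt (_≡ᵇ c) v + M c b v
M-swap {b} {c} b≢c [] rewrite ≡ᵇ-refl b = refl
M-swap {b} {c} b≢c (x ∷ v) with x ≡ᵇ b | ≡ᵇ-dec x b
... | _ | is refl rewrite ≡ᵇ-refl x | ≡ᵇ-false b≢c = trans (trans (cong (λ y → (if y then (if bef c x v then cnt (_≡ᵇ x) v + cnt (_≡ᵇ c) v else 0) else 0) + M x c v) (sym (≡ᵇ-refl x))) (M-swap b≢c v)) refl
... | _ | isnt x≢b with x ≡ᵇ c | ≡ᵇ-dec x c
...   | _ | isnt x≢c rewrite ≡ᵇ-refl b = trans (cong (λ y → (if y then (if bef c b v then cnt (_≡ᵇ b) v + cnt (_≡ᵇ c) v else 0) else 0) + M b c v) (sym (≡ᵇ-refl b))) (M-swap b≢c v)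
...   | _ | is refl rewrite ≡ᵇ-refl b = trans (re (cnt (_≡ᵇ b) v) (cnt (_≡ᵇ x) v) (M b x v))
          (cong (suc (cnt (_≡ᵇ x) v) +_) (sym (trans (cong (λ y → (if y then (if bef b x v then cnt (_≡ᵇ x) v + cnt (_≡ᵇ b) v else 0) else 0) + M x b v) (sym (≡ᵇ-refl x))) (M-swap (b≢c ∘ sym) v))))
    where
    re : ∀ a b c → a + suc b + c ≡ suc b + (a + c)
    re = solve-∀

filterᵇ-∷ʳ : ∀ (p : ℕ → Bool) w x → filterᵇ p (w ∷ʳ x) ≡ (if p x then filterᵇ p w ∷ʳ x else filterᵇ p w)
filterᵇ-∷ʳ p [] x = refl
filterᵇ-∷ʳ p (y ∷ w) x with p y
... | false = filterᵇ-∷ʳ p w x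
... | true rewrite filterᵇ-∷ʳ p w x with p x
...   | true  = refl
...   | false = refl

filterᵇ-reverse : ∀ (p : ℕ → Bool) v → filterᵇ p (reverse v) ≡ reverse (filterᵇ p v)
filterᵇ-reverse p [] = refl
filterᵇ-reverse p (x ∷ v) rewrite unfold-reverse x v | filterᵇ-∷ʳ p (reverse v) x | filterᵇ-reverse p v with p x
... | true  = sym (unfold-reverse x (filterᵇ p v))
... | false = refl

-- In the two-letter subword the larger c is never the bottom of a descent, and an a is one exactly
-- when the subword before it ends in c; the position of the descent is the number of letters a and
-- c so far.
MAJ-sub2 : ∀ {a c} → a < c → ∀ v → MAJ (sub2 a c (reverse v)) ≡ M a c v
MAJ-sub2 {a} {c} a<c v = trans (cong MAJ (filterᵇ-reverse p v)) (go v)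
  where
  p : ℕ → Bool
  p x = (x ≡ᵇ a) ∨ (x ≡ᵇ c)
  hd≤c : ∀ v → hd (filterᵇ p v) ≤ c
  hd≤c [] = z≤n
  hd≤c (x ∷ v) with x ≡ᵇ a | ≡ᵇ-dec x a
  ... | _ | is refl = <⇒≤ a<c
  ... | _ | isnt _ with x ≡ᵇ c | ≡ᵇ-dec x c
  ...   | _ | is refl = ≤-refl
  ...   | _ | isnt _  = hd≤c v
  last : ∀ v → (a <ᵇ hd (filterᵇ p v)) ≡ bef c a v
  last [] = refl
  last (x ∷ v) with x ≡ᵇ a | ≡ᵇ-dec x a
  ... | _ | is refl rewrite ≡ᵇ-false (<⇒≢ a<c) = <ᵇ-false (≤-refl {x})
  ... | _ | isnt _ with x ≡ᵇ c | ≡ᵇ-dec x c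
  ...   | _ | is refl = <ᵇ-true a<c
  ...   | _ | isnt _  = last v
  len : ∀ v → length (filterᵇ p v) ≡ cnt (_≡ᵇ a) v + cnt (_≡ᵇ c) v
  len [] = refl
  len (x ∷ v) with x ≡ᵇ a | ≡ᵇ-dec x a
  ... | _ | is refl rewrite ≡ᵇ-false (<⇒≢ a<c) = cong suc (len v)
  ... | _ | isnt _ with x ≡ᵇ c | ≡ᵇ-dec x c
  ...   | _ | is refl = trans (cong suc (len v)) (sym (+-suc _ _))
  ...   | _ | isnt _  = len v
  go : ∀ v → MAJ (reverse (filterᵇ p v)) ≡ M a c v
  go [] = refl
  go (x ∷ v) with x ≡ᵇ a | ≡ᵇ-dec x a
  ... | _ | is refl = trans (MAJ-∷ x (filterᵇ p v)) (trans (cong₂ _+_ (go v) (cong₂ (λ b l → if b then l else 0) (last v) (len v))) (+-comm (M x c v) _))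
  ... | _ | isnt _ with x ≡ᵇ c | ≡ᵇ-dec x c
  ...   | _ | is refl = trans (MAJ-∷ x (filterᵇ p v)) (trans (cong₂ _+_ (go v) (cong (λ b → if b then length (filterᵇ p v) else 0) (<ᵇ-false (hd≤c v)))) (+-identityʳ _))
  ...   | _ | isnt _  = go v

bef-skip : ∀ {a c b} → b ≢ a → b ≢ c → ∀ xs ys → bef c a (xs ++ b ∷ ys) ≡ bef c a (xs ++ ys)
bef-skip b≢a b≢c []       ys rewrite ≡ᵇ-false b≢a | ≡ᵇ-false b≢c = refl
bef-skip {a} {c} b≢a b≢c (x ∷ xs) ys with x ≡ᵇ c | x ≡ᵇ a
... | true  | _     = refl
... | false | true  = refl
... | false | false = bef-skip b≢a b≢c xs ys

bef-not : ∀ {a b} → a ≢ b → ∀ L → a ∈ L → bef a b L ≡ not (bef b a L)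
bef-not {a} {b} a≢b (x ∷ L) a∈ with x ≡ᵇ a | ≡ᵇ-dec x a
... | _ | is refl rewrite ≡ᵇ-false a≢b = refl
... | _ | isnt x≢a with x ≡ᵇ b
...   | true = refl
bef-not a≢b (x ∷ L) (here refl) | _ | isnt x≢a | false = contradiction refl x≢a
bef-not a≢b (x ∷ L) (there a∈)  | _ | isnt x≢a | false = bef-not a≢b L a∈

∑-range-δ : ∀ m b (f : ℕ → ℕ) → 1 ≤ b → b ≤ m → ∑ (range m) (λ a → if a ≡ᵇ b then f a else 0) ≡ f b
∑-range-δ zero    b f 1≤b b≤m = contradiction (≤-trans 1≤b b≤m) λ ()
∑-range-δ (suc m) b f 1≤b b≤m with m≤n⇒m<n∨m≡n b≤m
... | inj₁ (s≤s b≤) = trans (∑-range-suc m _) (trans (cong₂ _+_ (∑-range-δ m b f 1≤b b≤)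
        (cong (λ y → if y then f (suc m) else 0) (≡ᵇ-false (>⇒≢ (s≤s b≤))))) (+-identityʳ (f b)))
... | inj₂ refl = trans (∑-range-suc m _) (cong₂ _+_ (∑-range-zero m (λ i _ i≤ → cong (λ y → if y then f i else 0) (≡ᵇ-false (<⇒≢ (s≤s i≤)))))
        (cong (λ y → if y then f (suc m) else 0) (≡ᵇ-refl m)))

-- Zᴸ m L is the Z-statistic for the order on letters in which L lists the letters from the top.
Zᴸ : ℕ → List ℕ → Word → ℕ
Zᴸ m L v = ∑ (range m) (λ a → ∑ (range m) (λ c → if a <ᵇ c then (if bef c a L then M a c v else M c a v) else 0))

-- Pairs without b are unaffected. If c lies below b, a final b closes no descent of the pair. If c
-- lies above b, `M-swap` reverses the pair at the cost of the number of letters c. So b moves to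
-- the top of the order, and the price is the number of letters that were above it.
Zᴸ-∷ : ∀ m L L′ b v → 1 ≤ b → b ≤ m → (∀ a → 1 ≤ a → a ≤ m → a ∈ L) →
  (∀ a c → b ≢ a → b ≢ c → bef c a L′ ≡ bef c a L) →
  Zᴸ m L (b ∷ v) ≡ Zᴸ m (b ∷ L′) v + ∑ (range m) (λ c → if c ≡ᵇ b then 0 else (if bef c b L then cnt (_≡ᵇ c) v else 0))
Zᴸ-∷ m L L′ b v 1≤b b≤m all∈ same = begin
  Zᴸ m L (b ∷ v)
    ≡⟨ ∑-range-cong m (λ a 1≤a a≤m → ∑-range-cong m (λ c 1≤c c≤m → pointwise a c 1≤a a≤m 1≤c c≤m)) ⟩
  ∑ (range m) (λ a → ∑ (range m) (λ c → new a c + (row a c + col a c)))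
    ≡⟨ ∑-cong (range m) (λ a → trans (∑-+ (range m) (new a) _) (cong (∑ (range m) (new a) +_) (∑-+ (range m) (row a) (col a)))) ⟩
  ∑ (range m) (λ a → ∑ (range m) (new a) + (∑ (range m) (row a) + ∑ (range m) (col a)))
    ≡⟨ trans (∑-+ (range m) _ _) (cong (Zᴸ m (b ∷ L′) v +_) (∑-+ (range m) _ _)) ⟩
  Zᴸ m (b ∷ L′) v + (∑ (range m) (λ a → ∑ (range m) (row a)) + ∑ (range m) (λ a → ∑ (range m) (col a)))
    ≡⟨ cong₂ (λ x y → Zᴸ m (b ∷ L′) v + (x + y)) rows cols ⟩
  Zᴸ m (b ∷ L′) v + (∑ (range m) (λ c → if b <ᵇ c then w c else 0) + ∑ (range m) (λ a → if a <ᵇ b then w a else 0))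
    ≡⟨ cong (Zᴸ m (b ∷ L′) v +_) (trans (sym (∑-+ (range m) _ _)) (∑-cong (range m) merge)) ⟩
  Zᴸ m (b ∷ L′) v + ∑ (range m) (λ c → if c ≡ᵇ b then 0 else w c) ∎
  where
  open ≡-Reasoning
  w : ℕ → ℕ
  w c = if bef c b L then cnt (_≡ᵇ c) v else 0
  -- `row` and `col` are the corrections for the pairs whose numerically smaller, respectively
  -- larger, letter is b.
  new row col : ℕ → ℕ → ℕ
  new a c = if a <ᵇ c then (if bef c a (b ∷ L′) then M a c v else M c a v) else 0
  row a c = if a ≡ᵇ b then (if a <ᵇ c then w c else 0) else 0
  col a c = if c ≡ᵇ b then (if a <ᵇ c then w a else 0) else 0
  rows : ∑ (range m) (λ a → ∑ (range m) (row a)) ≡ ∑ (range m) (λ c → if b <ᵇ c then w c else 0)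
  rows = trans (∑-swap (range m) (range m) row) (∑-cong (range m) (λ c → ∑-range-δ m b (λ a → if a <ᵇ c then w c else 0) 1≤b b≤m))
  cols : ∑ (range m) (λ a → ∑ (range m) (col a)) ≡ ∑ (range m) (λ a → if a <ᵇ b then w a else 0)
  cols = ∑-cong (range m) (λ a → ∑-range-δ m b (λ c → if a <ᵇ c then w a else 0) 1≤b b≤m)
  merge : ∀ c → (if b <ᵇ c then w c else 0) + (if c <ᵇ b then w c else 0) ≡ (if c ≡ᵇ b then 0 else w c)
  merge c with c ≡ᵇ b | ≡ᵇ-dec c b
  ... | _ | is refl rewrite <ᵇ-false (≤-refl {c}) = refl
  ... | _ | isnt c≢b with b <ᵇ c | <ᵇ-dec b c
  ...   | _ | is b<c rewrite <ᵇ-false (<⇒≤ b<c) = +-identityʳ (w c)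
  ...   | _ | isnt c≤b rewrite <ᵇ-true (≤∧≢⇒< c≤b c≢b) = refl
  pointwise : ∀ a c → 1 ≤ a → a ≤ m → 1 ≤ c → c ≤ m →
    (if a <ᵇ c then (if bef c a L then M a c (b ∷ v) else M c a (b ∷ v)) else 0) ≡ new a c + (row a c + col a c)
  pointwise a c 1≤a a≤m 1≤c c≤m with a <ᵇ c | <ᵇ-dec a c
  ... | _ | isnt _ rewrite if-const (a ≡ᵇ b) {0} | if-const (c ≡ᵇ b) {0} = refl
  ... | _ | is a<c = cases (M a c (b ∷ v)) (M c a (b ∷ v))
      (λ { refl → M-swap a≢c v }) (λ { refl → M-other a v a≢c }) (λ { refl → M-other c v (a≢c ∘ sym) }) (λ { refl → M-swap (a≢c ∘ sym) v })
      (λ a≢b → M-other c v (a≢b ∘ sym)) (λ c≢b → M-other a v (c≢b ∘ sym))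
    where
    a≢c : a ≢ c
    a≢c = <⇒≢ a<c
    cases : ∀ X Y → (a ≡ b → X ≡ cnt (_≡ᵇ c) v + M c a v) → (a ≡ b → Y ≡ M c a v) → (c ≡ b → X ≡ M a c v) →
      (c ≡ b → Y ≡ cnt (_≡ᵇ a) v + M a c v) → (a ≢ b → X ≡ M a c v) → (c ≢ b → Y ≡ M c a v) →
      (if bef c a L then X else Y) ≡ (if bef c a (b ∷ L′) then M a c v else M c a v) + ((if a ≡ᵇ b then w c else 0) + (if c ≡ᵇ b then w a else 0))
    cases X Y X-row Y-row X-col Y-col X-off Y-off with a ≡ᵇ b | ≡ᵇ-dec a b
    cases X Y X-row Y-row X-col Y-col X-off Y-off | _ | is refl rewrite ≡ᵇ-refl a | ≡ᵇ-false a≢c | ≡ᵇ-false (a≢c ∘ sym) with bef c a L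
    ... | true  = trans (X-row refl) (trans (+-comm _ (M c a v)) (cong (M c a v +_) (sym (+-identityʳ _))))
    ... | false = trans (Y-row refl) (sym (+-identityʳ _))
    cases X Y X-row Y-row X-col Y-col X-off Y-off | _ | isnt a≢b with c ≡ᵇ b | ≡ᵇ-dec c b
    cases X Y X-row Y-row X-col Y-col X-off Y-off | _ | isnt a≢b | _ | is refl rewrite ≡ᵇ-refl c | bef-not a≢b L (all∈ a 1≤a a≤m) with bef c a L
    ... | true  = trans (X-col refl) (sym (+-identityʳ _))
    ... | false = trans (Y-col refl) (+-comm _ (M a c v))
    cases X Y X-row Y-row X-col Y-col X-off Y-off | _ | isnt a≢b | _ | isnt c≢b
      rewrite ≡ᵇ-false (a≢b ∘ sym) | ≡ᵇ-false (c≢b ∘ sym) | same a c (a≢b ∘ sym) (c≢b ∘ sym)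
      = trans (cong₂ (λ x y → if bef c a L then x else y) (X-off a≢b) (Y-off c≢b)) (sym (+-identityʳ _))

down : ℕ → List ℕ
down zero    = []
down (suc t) = suc t ∷ down t

∈-down⁻ : ∀ {x} t → x ∈ down t → 1 ≤ x × x ≤ t
∈-down⁻ (suc t) (here refl) = s≤s z≤n , ≤-refl
∈-down⁻ (suc t) (there x∈) with ∈-down⁻ t x∈
... | p , r = p , m≤n⇒m≤1+n r

∈-down⁺ : ∀ {x} t → 1 ≤ x → x ≤ t → x ∈ down t
∈-down⁺ zero    1≤x x≤t = contradiction (≤-trans 1≤x x≤t) λ ()
∈-down⁺ (suc t) 1≤x x≤t with m≤n⇒m<n∨m≡n x≤t
... | inj₁ (s≤s h) = there (∈-down⁺ t 1≤x h)
... | inj₂ refl    = here refl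

bef-down : ∀ {a c} m → a < c → c ≤ m → bef c a (down m) ≡ true
bef-down zero    a<c c≤m = contradiction (<-≤-trans a<c c≤m) λ ()
bef-down {a} {c} (suc m) a<c c≤m with suc m ≡ᵇ c | ≡ᵇ-dec (suc m) c
... | _ | is refl = refl
... | _ | isnt ne rewrite ≡ᵇ-false (>⇒≢ (<-≤-trans a<c c≤m)) = bef-down m a<c (s≤s⁻¹ (≤∧≢⇒< c≤m (ne ∘ sym)))

Z-reverse : ∀ m v → Z m (reverse v) ≡ Zᴸ m (down m) v
Z-reverse m v = ∑-range-cong m (λ a _ _ → ∑-range-cong m (λ c _ c≤m → aux a c c≤m))
  where
  aux : ∀ a c → c ≤ m → (if a <ᵇ c then MAJ (sub2 a c (reverse v)) else 0) ≡ (if a <ᵇ c then (if bef c a (down m) then M a c v else M c a v) else 0)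
  aux a c c≤m with a <ᵇ c | <ᵇ-dec a c
  ... | _ | isnt _ = refl
  ... | _ | is a<c rewrite bef-down m a<c c≤m = MAJ-sub2 a<c v

∑-down : ∀ t f → ∑ (down t) f ≡ ∑ (range t) f
∑-down zero    f = refl
∑-down (suc t) f = trans (cong (f (suc t) +_) (∑-down t f)) (trans (+-comm (f (suc t)) _) (sym (∑-range-suc t f)))

∑-from-range : ∀ t s f → ∑ (from (suc t) s) f + ∑ (range t) f ≡ ∑ (range (t + s)) f
∑-from-range t zero    f = cong (λ y → ∑ (range y) f) (sym (+-identityʳ t))
∑-from-range t (suc s) f = begin
  f (suc t) + ∑ (from (suc (suc t)) s) f + ∑ (range t) f ≡⟨ re (f (suc t)) _ _ ⟩
  ∑ (from (suc (suc t)) s) f + (∑ (range t) f + f (suc t)) ≡⟨ cong (∑ (from (suc (suc t)) s) f +_) (sym (∑-range-suc t f)) ⟩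
  ∑ (from (suc (suc t)) s) f + ∑ (range (suc t)) f ≡⟨ ∑-from-range (suc t) s f ⟩
  ∑ (range (suc t + s)) f ≡⟨ cong (λ y → ∑ (range y) f) (sym (+-suc t s)) ⟩
  ∑ (range (t + suc s)) f ∎
  where
  open ≡-Reasoning
  re : ∀ a b c → a + b + c ≡ b + (c + a)
  re = solve-∀

∑-range-N : ∀ κ m → ∑ (range m) κ ≡ N κ m
∑-range-N κ zero    = refl
∑-range-N κ (suc m) = trans (∑-range-suc m κ) (cong (_+ κ (suc m)) (∑-range-N κ m))

from-≥ : ∀ t s → All (t ≤_) (from t s)
from-≥ t zero    = []
from-≥ t (suc s) = ≤-refl ∷ All.map <⇒≤ (from-≥ (suc t) s)

from-unique : ∀ t s → Unique (from t s)
from-unique t zero    = []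
from-unique t (suc s) = All.map <⇒≢ (from-≥ (suc t) s) ∷ from-unique (suc t) s

down-unique : ∀ t → Unique (down t)
down-unique zero    = []
down-unique (suc t) = All.tabulate (λ x∈ e → <⇒≢ (s≤s (proj₂ (∈-down⁻ t x∈))) (sym e)) ∷ down-unique t

-- The number of letters above b when τ lists letters from the top. Outside τ the value is all of τ,
-- which is right for the merged letter below it.
pre : (ℕ → ℕ) → List ℕ → ℕ → ℕ
pre κ []      b = 0
pre κ (x ∷ τ) b = if x ≡ᵇ b then 0 else κ x + pre κ τ b

pre-∉ : ∀ κ τ b → b ∉ τ → pre κ τ b ≡ ∑ τ κ
pre-∉ κ []      b b∉ = refl
pre-∉ κ (x ∷ τ) b b∉ rewrite ≡ᵇ-false {x} {b} (λ e → b∉ (here (sym e))) = cong (κ x +_) (pre-∉ κ τ b (b∉ ∘ there))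

pre-++ : ∀ κ τ σ b → b ∈ τ → pre κ (τ ++ σ) b ≡ pre κ τ b
pre-++ κ (x ∷ τ) σ b b∈ with x ≡ᵇ b | ≡ᵇ-dec x b
... | _ | is _ = refl
pre-++ κ (x ∷ τ) σ b (here e)   | _ | isnt ne = contradiction (sym e) ne
pre-++ κ (x ∷ τ) σ b (there b∈) | _ | isnt _  = cong (κ x +_) (pre-++ κ τ σ b b∈)

pre-++-t : ∀ κ τ σ b → b ∉ τ → pre κ (τ ++ b ∷ σ) b ≡ pre κ τ b
pre-++-t κ []      σ b b∉ rewrite ≡ᵇ-refl b = refl
pre-++-t κ (x ∷ τ) σ b b∉ rewrite ≡ᵇ-false {x} {b} (λ e → b∉ (here (sym e))) = cong (κ x +_) (pre-++-t κ τ σ b (b∉ ∘ there))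

∑-above : ∀ κ b L → Unique L → ∑ L (λ c → if c ≡ᵇ b then 0 else (if bef c b L then κ c else 0)) ≡ pre κ L b
∑-above κ b [] _ = refl
∑-above κ b (x ∷ L) (x∉ ∷ u) with x ≡ᵇ b | ≡ᵇ-dec x b
... | _ | is refl = ∑-zero-∈ L aux
  where
  aux : ∀ c → c ∈ L → (if c ≡ᵇ x then 0 else (if (if x ≡ᵇ c then true else false) then κ c else 0)) ≡ 0
  aux c c∈ rewrite ≡ᵇ-false (All.lookup x∉ c∈) = if-const (c ≡ᵇ x)
... | _ | isnt x≢b rewrite ≡ᵇ-refl x = cong (κ x +_) (trans (∑-cong-∈ L aux) (∑-above κ b L u))
  where
  aux : ∀ c → c ∈ L → (if c ≡ᵇ b then 0 else (if (if x ≡ᵇ c then true else bef c b L) then κ c else 0)) ≡ (if c ≡ᵇ b then 0 else (if bef c b L then κ c else 0))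
  aux c c∈ rewrite ≡ᵇ-false (All.lookup x∉ c∈) = refl

module ZStatistic (q m : ℕ) where
  open QNumbers q
  open LastLetter m
  open Hooks q m
  open LastLetterStatistics q m

  pre-total : ∀ κ τ → Unique τ → ∑ τ (λ b → q ^ pre κ τ b * ⟦ κ b ⟧) ≡ ⟦ ∑ τ κ ⟧
  pre-total κ []      _        = refl
  pre-total κ (x ∷ τ) (x∉ ∷ u) = begin
    q ^ pre κ (x ∷ τ) x * ⟦ κ x ⟧ + ∑ τ (λ b → q ^ pre κ (x ∷ τ) b * ⟦ κ b ⟧)
      ≡⟨ cong₂ _+_ head (∑-cong-∈ τ tail) ⟩
    ⟦ κ x ⟧ + ∑ τ (λ b → q ^ κ x * (q ^ pre κ τ b * ⟦ κ b ⟧))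
      ≡⟨ cong (⟦ κ x ⟧ +_) (trans (∑-*ˡ τ (q ^ κ x) _) (cong (q ^ κ x *_) (pre-total κ τ u))) ⟩
    ⟦ κ x ⟧ + q ^ κ x * ⟦ ∑ τ κ ⟧ ≡⟨ sym (⟦+⟧ (κ x) (∑ τ κ)) ⟩
    ⟦ κ x + ∑ τ κ ⟧ ∎
    where
    open ≡-Reasoning
    head : q ^ pre κ (x ∷ τ) x * ⟦ κ x ⟧ ≡ ⟦ κ x ⟧
    head rewrite ≡ᵇ-refl x = *-identityˡ ⟦ κ x ⟧
    tail : ∀ b → b ∈ τ → q ^ pre κ (x ∷ τ) b * ⟦ κ b ⟧ ≡ q ^ κ x * (q ^ pre κ τ b * ⟦ κ b ⟧)
    tail b b∈ rewrite ≡ᵇ-false (All.lookup x∉ b∈) | ^-distribˡ-+-* q (κ x) (pre κ τ b) = *-assoc (q ^ κ x) _ _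

  E-cnt≡ : ∀ n {κ t} → State n κ t → ∀ v → v ∈ E n κ t → ∀ c → 1 ≤ c → c ≤ m → cnt (_≡ᵇ c) v ≡ κ c
  E-cnt≡ zero {κ} S .[] (here refl) (suc c) _ c≤m = sym (n≤0⇒n≡0 (≤-trans (m≤n+m (κ (suc c)) (N κ c)) (subst (N κ (suc c) ≤_) (tot S) (N-mono κ c≤m))))
  E-cnt≡ (suc n) {κ} S v v∈ c 1≤c c≤m with ∈E⁻ S v∈
  ... | b , v′ , A , refl , v′∈ = trans (cong (ind (b ≡ᵇ c) +_) (E-cnt≡ n (next S A) v′ v′∈ c 1≤c c≤m)) aux
    where
    aux : ind (b ≡ᵇ c) + (κ ⊖ b) c ≡ κ c
    aux with b ≡ᵇ c | ≡ᵇ-dec b c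
    ... | _ | is refl rewrite ≡ᵇ-refl b = suc-pred (κ b) {{>-nonZero (κb A)}}
    ... | _ | isnt ne rewrite ≡ᵇ-false (ne ∘ sym) = refl

  -- The orders that arise have a permutation τ of the unconstrained letters t + 1,...,m on top and
  -- t,...,1 below. A removed b > t moves to the front of τ. A removed t moves there too, and as it
  -- loses its constraint at the same moment, the shape persists with t - 1.
  Z-total : ∀ n {κ t} → State n κ t → ∀ τ → τ ↭ from (suc t) (m ∸ t) →
    ∑ (E n κ t) (λ v → q ^ Zᴸ m (τ ++ down t) v) * D m κ t ≡ ⟦ n ⟧!
  Z-total zero {κ} {t} S τ p = trans (cong₂ _*_ (cong (λ y → q ^ y + 0) zero-Z) (D-base S m ≤-refl)) refl
    where
    zero-Z : Zᴸ m (τ ++ down t) [] ≡ 0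
    zero-Z = ∑-zero-∈ (range m) (λ a _ → ∑-zero-∈ (range m) (λ c _ → trans (cong (λ y → if a <ᵇ c then y else 0) (if-const (bef c a (τ ++ down t)))) (if-const (a <ᵇ c))))
  Z-total (suc n) {κ} {t} S τ p = trans (step S (Zᴸ m L) 1 (pre κ τ) each total) (*-identityˡ _)
    where
    open ≡-Reasoning
    L : List ℕ
    L = τ ++ down t
    ∈τ⁻ : ∀ {x} → x ∈ τ → t < x × x ≤ m
    ∈τ⁻ {x} x∈ with ∈-from⁻ (suc t) (m ∸ t) (↭.∈-resp-↭ p x∈)
    ... | t<x , x<e = t<x , s≤s⁻¹ (subst (λ y → x < suc y) (m+[n∸m]≡n (t≤m S)) x<e)
    ∈τ⁺ : ∀ {x} → t < x → x ≤ m → x ∈ τ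
    ∈τ⁺ {x} t<x x≤m = ↭.∈-resp-↭ (↭-sym p) (∈-from⁺ (suc t) (m ∸ t) t<x (subst (λ y → x < suc y) (sym (m+[n∸m]≡n (t≤m S))) (s≤s x≤m)))
    t∉τ : t ∉ τ
    t∉τ t∈ = <⇒≢ (proj₁ (∈τ⁻ t∈)) refl
    unique-τ : Unique τ
    unique-τ = Unique-resp-↭ (setoid ℕ) (↭⇒↭ₛ (↭-sym p)) (from-unique (suc t) (m ∸ t))
    ++-unique : ∀ σ → Unique σ → All (t <_) σ → Unique (σ ++ down t)
    ++-unique []      _       _        = down-unique t
    ++-unique (x ∷ σ) (x∉ ∷ u) (t<x ∷ a) = All.tabulate aux ∷ ++-unique σ u a
      where
      aux : ∀ {y} → y ∈ σ ++ down t → x ≢ y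
      aux y∈ refl with ∈-++⁻ σ y∈
      ... | inj₁ y∈σ = All.lookup x∉ y∈σ refl
      ... | inj₂ y∈d = <⇒≱ t<x (proj₂ (∈-down⁻ t y∈d))
    unique-L : Unique L
    unique-L = ++-unique τ unique-τ (All.tabulate (λ x∈ → proj₁ (∈τ⁻ x∈)))
    all∈ : ∀ a → 1 ≤ a → a ≤ m → a ∈ L
    all∈ a 1≤a a≤m with a ≤ᵇ t | ≤ᵇ-dec a t
    ... | _ | is a≤t   = ∈-++⁺ʳ τ (∈-down⁺ t 1≤a a≤t)
    ... | _ | isnt t<a = ∈-++⁺ˡ (∈τ⁺ t<a a≤m)
    ∑-range-L : ∀ f → ∑ (range m) f ≡ ∑ L f
    ∑-range-L f = sym (begin
      ∑ (τ ++ down t) f ≡⟨ ∑-++ τ (down t) f ⟩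
      ∑ τ f + ∑ (down t) f ≡⟨ cong₂ _+_ (∑-↭ f p) (∑-down t f) ⟩
      ∑ (from (suc t) (m ∸ t)) f + ∑ (range t) f ≡⟨ ∑-from-range t (m ∸ t) f ⟩
      ∑ (range (t + (m ∸ t))) f ≡⟨ cong (λ y → ∑ (range y) f) (m+[n∸m]≡n (t≤m S)) ⟩
      ∑ (range m) f ∎)
    total : ∑ (letters t) (λ b → q ^ pre κ τ b * ⟦ μ κ t b ⟧) ≡ ⟦ suc n ⟧
    total = begin
      ∑ (letters t) g ≡⟨ cong (λ l → ∑ (from t l) g) (+-∸-assoc 1 (t≤m S)) ⟩
      g t + ∑ (from (suc t) (m ∸ t)) g ≡⟨ cong₂ _+_ g-t (sym (∑-↭ g p)) ⟩
      q ^ ∑ τ κ * ⟦ N κ t ⟧ + ∑ τ g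
        ≡⟨ cong (q ^ ∑ τ κ * ⟦ N κ t ⟧ +_) (trans (∑-cong-∈ τ (λ b b∈ → cong (λ y → q ^ pre κ τ b * ⟦ y ⟧) (μ-other κ (λ e → t∉τ (subst (_∈ τ) e b∈))))) (pre-total κ τ unique-τ)) ⟩
      q ^ ∑ τ κ * ⟦ N κ t ⟧ + ⟦ ∑ τ κ ⟧ ≡⟨ trans (+-comm _ ⟦ ∑ τ κ ⟧) (sym (⟦+⟧ (∑ τ κ) (N κ t))) ⟩
      ⟦ ∑ τ κ + N κ t ⟧ ≡⟨ cong ⟦_⟧ (trans (cong₂ _+_ refl (sym (trans (∑-down t κ) (∑-range-N κ t)))) (trans (sym (∑-++ τ (down t) κ)) (trans (sym (∑-range-L κ)) (trans (∑-range-N κ m) (tot S))))) ⟩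
      ⟦ suc n ⟧ ∎
      where
      g : ℕ → ℕ
      g b = q ^ pre κ τ b * ⟦ μ κ t b ⟧
      g-t : g t ≡ q ^ ∑ τ κ * ⟦ N κ t ⟧
      g-t rewrite ≡ᵇ-refl t | pre-∉ κ τ t t∉τ = refl
    weight : ∀ b → Allowed κ t b → ∀ v → v ∈ E n (κ ⊖ b) (lower t b) →
      ∑ (range m) (λ c → if c ≡ᵇ b then 0 else (if bef c b L then cnt (_≡ᵇ c) v else 0)) ≡ pre κ τ b
    weight b A v v∈ = begin
      ∑ (range m) (λ c → if c ≡ᵇ b then 0 else (if bef c b L then cnt (_≡ᵇ c) v else 0))
        ≡⟨ ∑-range-cong m count ⟩
      ∑ (range m) (λ c → if c ≡ᵇ b then 0 else (if bef c b L then κ c else 0)) ≡⟨ ∑-range-L _ ⟩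
      ∑ L (λ c → if c ≡ᵇ b then 0 else (if bef c b L then κ c else 0)) ≡⟨ ∑-above κ b L unique-L ⟩
      pre κ L b ≡⟨ prefix b (t≤b A) (b≤m A) (1≤b S A) ⟩
      pre κ τ b ∎
      where
      count : ∀ c → 1 ≤ c → c ≤ m → (if c ≡ᵇ b then 0 else (if bef c b L then cnt (_≡ᵇ c) v else 0)) ≡ (if c ≡ᵇ b then 0 else (if bef c b L then κ c else 0))
      count c 1≤c c≤m with c ≡ᵇ b | ≡ᵇ-dec c b
      ... | _ | is _ = refl
      ... | _ | isnt ne = cong (λ y → if bef c b L then y else 0) (trans (E-cnt≡ n (next S A) v v∈ c 1≤c c≤m) (⊖-other κ ne))
      prefix : ∀ b → t ≤ b → b ≤ m → 1 ≤ b → pre κ L b ≡ pre κ τ b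
      prefix b t≤b b≤m 1≤b with m≤n⇒m<n∨m≡n t≤b
      ... | inj₁ t<b = pre-++ κ τ (down t) b (∈τ⁺ t<b b≤m)
      prefix (suc b) t≤b b≤m 1≤b | inj₂ refl = pre-++-t κ τ (down b) (suc b) t∉τ
    each : ∀ b → Allowed κ t b → ∑ (E n (κ ⊖ b) (lower t b)) (λ v → q ^ Zᴸ m L (b ∷ v)) * D m (κ ⊖ b) (lower t b) ≡ 1 * (q ^ pre κ τ b * ⟦ n ⟧!)
    each b A = finish (moved b A)
      where
      Moved : ℕ → Set
      Moved b = ∃ λ τ′ → ∃ λ L′ → τ′ ↭ from (suc (lower t b)) (m ∸ lower t b) × b ∷ L′ ≡ τ′ ++ down (lower t b)
                × (∀ a c → b ≢ a → b ≢ c → bef c a L′ ≡ bef c a L)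
      moved : ∀ b → Allowed κ t b → Moved b
      moved b A with b ≡ᵇ t | ≡ᵇ-dec b t
      moved zero    A | _ | is refl = contradiction (1≤b S A) λ ()
      moved (suc b) A | _ | is refl = suc b ∷ τ , τ ++ down b , subst (λ l → suc b ∷ τ ↭ from (suc b) l) (sym (+-∸-assoc 1 (b≤m A))) (prep (suc b) p) , refl
        , (λ a c ne ne′ → sym (bef-skip ne ne′ τ (down b)))
      moved b A | _ | isnt ne with ∈-∃++ (∈τ⁺ (≤∧≢⇒< (t≤b A) (ne ∘ sym)) (b≤m A))
      ... | xs , ys , refl = b ∷ xs ++ ys , (xs ++ ys) ++ down t , ↭-trans (↭-sym (↭.shift b xs ys)) p , refl
        , (λ a c ne ne′ → trans (cong (bef c a) (++-assoc xs ys (down t))) (trans (sym (bef-skip ne ne′ xs (ys ++ down t)))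
                 (sym (cong (bef c a) (++-assoc xs (b ∷ ys) (down t))))))
      finish : Moved b → _
      finish (τ′ , L′ , p′ , eq , same) = begin
        ∑ E′ (λ v → q ^ Zᴸ m L (b ∷ v)) * D′
          ≡⟨ cong (_* D′) (factor E′ _ (Zᴸ m (τ′ ++ down (lower t b))) (pre κ τ b) (λ v v∈ →
               trans (Zᴸ-∷ m L L′ b v (1≤b S A) (b≤m A) all∈ same) (trans (+-comm (Zᴸ m (b ∷ L′) v) _) (cong₂ _+_ (weight b A v v∈) (cong (λ l → Zᴸ m l v) eq))))) ⟩
        q ^ pre κ τ b * ∑ E′ (λ v → q ^ Zᴸ m (τ′ ++ down (lower t b)) v) * D′ ≡⟨ *-assoc (q ^ pre κ τ b) _ _ ⟩
        q ^ pre κ τ b * (∑ E′ (λ v → q ^ Zᴸ m (τ′ ++ down (lower t b)) v) * D′) ≡⟨ cong (q ^ pre κ τ b *_) (Z-total n (next S A) τ′ p′) ⟩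
        q ^ pre κ τ b * ⟦ n ⟧! ≡⟨ sym (*-identityˡ _) ⟩
        1 * (q ^ pre κ τ b * ⟦ n ⟧!) ∎
        where
        E′ : List Word
        E′ = E n (κ ⊖ b) (lower t b)
        D′ : ℕ
        D′ = D m (κ ⊖ b) (lower t b)

-- DEN as a sum over pairs, and its distribution

Sorted : List ℕ → Set
Sorted = AllPairs _≤_

insertN-All : ∀ {P : ℕ → Set} x l → P x → All P l → All P (insertN x l)
insertN-All x []      px []       = px ∷ []
insertN-All x (y ∷ l) px (py ∷ a) with x ≤ᵇ y
... | true  = px ∷ py ∷ a
... | false = py ∷ insertN-All x l px a

insertN-sorted : ∀ x l → Sorted l → Sorted (insertN x l)
insertN-sorted x []      []      = [] ∷ []
insertN-sorted x (y ∷ l) (a ∷ s) with x ≤ᵇ y | ≤ᵇ-dec x y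
... | _ | is x≤y   = (x≤y ∷ All.map (≤-trans x≤y) a) ∷ a ∷ s
... | _ | isnt y<x = insertN-All x l (<⇒≤ y<x) a ∷ insertN-sorted x l s

sortN-sorted : ∀ w → Sorted (sortN w)
sortN-sorted []      = []
sortN-sorted (x ∷ w) = insertN-sorted x (sortN w) (sortN-sorted w)

∑-insertN : ∀ x l f → ∑ (insertN x l) f ≡ f x + ∑ l f
∑-insertN x []      f = refl
∑-insertN x (y ∷ l) f with x ≤ᵇ y
... | true  = refl
... | false = trans (cong (f y +_) (∑-insertN x l f)) (+-exchange (f y) (f x) _)

∑-sortN : ∀ w f → ∑ (sortN w) f ≡ ∑ w f
∑-sortN []      f = refl
∑-sortN (x ∷ w) f = trans (∑-insertN x (sortN w) f) (cong (f x +_) (∑-sortN w f))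

none-below : ∀ v l → All (v ≤_) l → cnt (_<ᵇ v) l ≡ 0
none-below v []      []      = refl
none-below v (x ∷ l) (p ∷ a) rewrite <ᵇ-false p = none-below v l a

at-sorted : ∀ l → Sorted l → ∀ v j → 1 ≤ j → j ≤ length l → (at l j <ᵇ v) ≡ (j ≤ᵇ cnt (_<ᵇ v) l)
at-sorted [] _ v (suc j) _ ()
at-sorted (x ∷ l) (a ∷ s) v (suc zero) _ _ with x <ᵇ v | <ᵇ-dec x v
... | _ | is _     = refl
... | _ | isnt v≤x rewrite none-below v l (All.map (≤-trans v≤x) a) = refl
at-sorted (x ∷ l) (a ∷ s) v (suc (suc i)) _ (s≤s h) with x <ᵇ v | <ᵇ-dec x v
... | _ | is _     = at-sorted l s v (suc i) (s≤s z≤n) h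
... | _ | isnt v≤x = trans (at-sorted l s v (suc i) (s≤s z≤n) h)
        (trans (≤ᵇ-false (subst (_< suc i) (sym none) (s≤s z≤n))) (sym (≤ᵇ-false (subst (_< suc (suc i)) (sym none) (s≤s z≤n)))))
  where
  none : cnt (_<ᵇ v) l ≡ 0
  none = none-below v l (All.map (≤-trans v≤x) a)

at-sortN : ∀ w v j → 1 ≤ j → j ≤ length w → (at (sortN w) j <ᵇ v) ≡ (j ≤ᵇ cnt (_<ᵇ v) w)
at-sortN w v j 1≤j j≤n = trans
  (at-sorted (sortN w) (sortN-sorted w) v j 1≤j (subst (j ≤_) (sym (trans (length-∑ (sortN w)) (trans (∑-sortN w (λ _ → 1)) (sym (length-∑ w))))) j≤n))
  (cong (j ≤ᵇ_) (∑-sortN w (λ x → ind (x <ᵇ v))))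

∑∑-split : ∀ n (G : ℕ → ℕ → ℕ) →
  ∑ (range n) (λ i → ∑ (range n) (G i)) ≡ ∑ (range n) (λ i → G i i) + ∑< n (λ i j → G i j + G j i)
∑∑-split zero    G = refl
∑∑-split (suc n) G = begin
  ∑ (range (suc n)) (λ i → ∑ (range (suc n)) (G i))
    ≡⟨ trans (∑-range-suc n _) (cong₂ _+_ (trans (∑-cong (range n) (λ i → ∑-range-suc n (G i))) (∑-+ (range n) _ _)) (∑-range-suc n (G (suc n)))) ⟩
  ∑ (range n) (λ i → ∑ (range n) (G i)) + ∑ (range n) (λ i → G i (suc n)) + (∑ (range n) (G (suc n)) + G (suc n) (suc n))
    ≡⟨ cong (λ y → y + ∑ (range n) (λ i → G i (suc n)) + (∑ (range n) (G (suc n)) + G (suc n) (suc n))) (∑∑-split n G) ⟩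
  d + p + ∑ (range n) (λ i → G i (suc n)) + (∑ (range n) (G (suc n)) + G (suc n) (suc n))
    ≡⟨ re d p _ _ (G (suc n) (suc n)) ⟩
  d + G (suc n) (suc n) + (p + (∑ (range n) (λ i → G i (suc n)) + ∑ (range n) (G (suc n))))
    ≡⟨ cong₂ _+_ (sym (∑-range-suc n _)) (trans (cong (p +_) (sym (∑-+ (range n) _ _))) (sym (∑<-suc n _))) ⟩
  ∑ (range (suc n)) (λ i → G i i) + ∑< (suc n) (λ i j → G i j + G j i) ∎
  where
  open ≡-Reasoning
  d p : ℕ
  d = ∑ (range n) (λ i → G i i)
  p = ∑< n (λ i j → G i j + G j i)
  re : ∀ d p a b g → d + p + a + (b + g) ≡ d + g + (p + (a + b))
  re = solve-∀

∑<-+ : ∀ n F G → ∑< n (λ i j → F i j + G i j) ≡ ∑< n F + ∑< n G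
∑<-+ n F G = trans (∑-cong (range n) (λ i → trans (∑-cong (range n) (λ j → aux (i <ᵇ j) (F i j) (G i j))) (∑-+ (range n) _ _))) (∑-+ (range n) _ _)
  where
  aux : ∀ b x y → (if b then x + y else 0) ≡ (if b then x else 0) + (if b then y else 0)
  aux true  x y = refl
  aux false x y = refl

pairsOf : (ℕ → ℕ → Bool) → Word → ℕ
pairsOf R u = pairs (length u) (λ i j → (i <ᵇ j) ∧ R (at u i) (at u j))

pairsOf-∷ʳ : ∀ R u x → pairsOf R (u ∷ʳ x) ≡ pairsOf R u + ∑ u (λ a → ind (R a x))
pairsOf-∷ʳ R u x = begin
  pairsOf R (u ∷ʳ x) ≡⟨ cong (pairsOf R) (trans (cong (_∷ʳ x) (sym (reverse-involutive u))) (sym (unfold-reverse x (reverse u)))) ⟩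
  pairsOf R (reverse (x ∷ reverse u)) ≡⟨ pairs-reverse (λ _ _ → R) (x ∷ reverse u) ⟩
  pairsʳ F (x ∷ reverse u) ≡⟨ pairsʳ-∷ F x (reverse u) ⟩
  pairsʳ F (reverse u) + ∑ (range (length (reverse u))) (λ i → ind (R (atʳ (reverse u) i) x))
    ≡⟨ cong₂ _+_ (sym (pairs-reverse (λ _ _ → R) (reverse u))) (∑-atʳ (reverse u) (λ a → ind (R a x))) ⟩
  pairsOf R (reverse (reverse u)) + ∑ (reverse u) (λ a → ind (R a x))
    ≡⟨ cong₂ _+_ (cong (pairsOf R) (reverse-involutive u)) (∑-reverse u _) ⟩
  pairsOf R u + ∑ u (λ a → ind (R a x)) ∎
  where
  open ≡-Reasoning
  F : ℕ → ℕ → ℕ → ℕ → ℕ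
  F _ _ a b = ind (R a b)

pairsOf-select : ∀ R (f : ℕ → ℕ) (p : ℕ → Bool) n →
  pairsOf R (map f (filterᵇ p (range n))) ≡ ∑< n (λ i j → if p j then (if p i then ind (R (f i) (f j)) else 0) else 0)
pairsOf-select R f p zero    = refl
pairsOf-select R f p (suc n) = trans (cong (λ l → pairsOf R (map f l)) (trans (cong (filterᵇ p) (range-suc n)) (filterᵇ-∷ʳ p (range n) (suc n))))
  (trans aux (sym (∑<-suc n G)))
  where
  G : ℕ → ℕ → ℕ
  G i j = if p j then (if p i then ind (R (f i) (f j)) else 0) else 0
  aux : pairsOf R (map f (if p (suc n) then filterᵇ p (range n) ∷ʳ suc n else filterᵇ p (range n))) ≡ ∑< n G + ∑ (range n) (λ i → G i (suc n))
  aux with p (suc n)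
  ... | false = trans (pairsOf-select R f p n) (trans (sym (+-identityʳ _)) (cong (∑< n G +_) (sym (∑-zero (range n)))))
  ... | true  = trans (cong (pairsOf R) (map-++ f (filterᵇ p (range n)) [ suc n ]))
      (trans (pairsOf-∷ʳ R (map f (filterᵇ p (range n))) (f (suc n)))
        (cong₂ _+_ (pairsOf-select R f p n) (trans (∑-map f (filterᵇ p (range n)) _) (∑-filterᵇ p (range n) _))))

count-≤ : ∀ n k → k ≤ n → ∑ (range n) (λ j → ind (j ≤ᵇ k)) ≡ k
count-≤ zero    zero z≤n = refl
count-≤ (suc n) k k≤ with m≤n⇒m<n∨m≡n k≤
... | inj₁ (s≤s k≤n) = trans (∑-range-suc n _) (trans (cong₂ _+_ (count-≤ n k k≤n) (cong ind (≤ᵇ-false (s≤s k≤n)))) (+-identityʳ k))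
... | inj₂ refl = trans (∑-range-suc n _) (trans (cong₂ _+_ (trans (∑-range-cong n (λ j _ j≤n → cong ind (trans (≤ᵇ-true (m≤n⇒m≤1+n j≤n)) (sym (≤ᵇ-true j≤n))))) (count-≤ n n ≤-refl)) (cong ind (≤ᵇ-true (≤-refl {suc n})))) (+-comm n 1))

cnt-≤-length : ∀ p (w : Word) → cnt p w ≤ length w
cnt-≤-length p []      = z≤n
cnt-≤-length p (x ∷ w) with p x
... | true  = s≤s (cnt-≤-length p w)
... | false = m≤n⇒m≤1+n (cnt-≤-length p w)

-- With K x the number of letters smaller than x, the j-th letter of the sorted word is smaller
-- than x iff j ≤ K x.  cycle K j a b says that a lies in the cyclic interval from b (excluded) to
-- the j-th letter of the sorted word.
cycle : (ℕ → ℕ) → ℕ → ℕ → ℕ → ℕ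
cycle K j a b = if j ≤ᵇ K b then ind (not (j ≤ᵇ K a) ∨ (b <ᵇ a)) else ind ((b <ᵇ a) ∧ not (j ≤ᵇ K a))

-- An excedance place j contributes j, that is 1 and another 1 for each i < j; this turns DEN into
-- the number of excedances plus the pair sum of `X`. That sum does not match `C` pair by pair, only
-- in total: `balance`, summed over the excedance places i with v = `w_i`, makes the pair sum of `L`
-- equal to the number of excedances plus that of `R`, while L + X = C + R holds for every pair.
DEN-cycle : ∀ w → DEN w ≡ ∑< (length w) (λ i j → cycle (λ x → cnt (_<ᵇ x) w) j (at w i) (at w j))
DEN-cycle w = begin
  sum (excPlaces w) + imv (Exc w) + INV (Nexc w)
    ≡⟨ cong₂ _+_ (cong₂ _+_ places (trans (pairsOf-select (λ a b → b ≤ᵇ a) (at w) (isExc w) n) (∑<-cong n toX₁)))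
                 (trans (pairsOf-select (λ a b → b <ᵇ a) (at w) (not ∘ isExc w) n) (∑<-cong n toX₂)) ⟩
  ∑ (range n) (λ j → ind (e j)) + ∑< n (λ i j → ind (e j)) + ∑< n X₁ + ∑< n X₂
    ≡⟨ trans (re (∑ (range n) (λ j → ind (e j))) _ _ _) (cong (∑ (range n) (λ j → ind (e j)) +_) (sym (trans (∑<-+ n _ X₂) (cong (_+ ∑< n X₂) (∑<-+ n _ X₁))))) ⟩
  ∑ (range n) (λ j → ind (e j)) + ∑< n X
    ≡⟨ +-cancelʳ-≡ (∑< n R) _ _ cancelled ⟩
  ∑< n C ∎
  where
  open ≡-Reasoning
  n : ℕ
  n = length w
  K : ℕ → ℕ
  K x = cnt (_<ᵇ x) w
  A : ℕ → ℕ → Bool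
  A j v = j ≤ᵇ K v
  e : ℕ → Bool
  e i = A i (at w i)
  X₁ X₂ X L R C : ℕ → ℕ → ℕ
  X₁ i j = if e j then (if e i then ind (at w j ≤ᵇ at w i) else 0) else 0
  X₂ i j = if not (e j) then (if not (e i) then ind (at w j <ᵇ at w i) else 0) else 0
  X i j = ind (e j) + X₁ i j + X₂ i j
  L i j = if e i then (if at w j <ᵇ at w i then ind (not (A j (at w i))) else 0) else 0
  R i j = (if e i then (if A j (at w i) then ind (not (at w j <ᵇ at w i)) else 0) else 0) + (if e j then ind (at w j ≤ᵇ at w i) else 0)
  C i j = cycle K j (at w i) (at w j)
  re : ∀ a b c d → a + b + c + d ≡ a + (b + c + d)
  re = solve-∀
  exc : ∀ i → 1 ≤ i → i ≤ n → isExc w i ≡ e i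
  exc i = at-sortN w (at w i) i
  toX₁ : ∀ i j → 1 ≤ i → i < j → j ≤ n → (if isExc w j then (if isExc w i then ind (at w j ≤ᵇ at w i) else 0) else 0) ≡ X₁ i j
  toX₁ i j 1≤i i<j j≤n = cong₂ (λ x y → if x then (if y then ind (at w j ≤ᵇ at w i) else 0) else 0)
    (exc j (≤-trans 1≤i (<⇒≤ i<j)) j≤n) (exc i 1≤i (≤-trans (<⇒≤ i<j) j≤n))
  toX₂ : ∀ i j → 1 ≤ i → i < j → j ≤ n → (if not (isExc w j) then (if not (isExc w i) then ind (at w j <ᵇ at w i) else 0) else 0) ≡ X₂ i j
  toX₂ i j 1≤i i<j j≤n = cong₂ (λ x y → if not x then (if not y then ind (at w j <ᵇ at w i) else 0) else 0)
    (exc j (≤-trans 1≤i (<⇒≤ i<j)) j≤n) (exc i 1≤i (≤-trans (<⇒≤ i<j) j≤n))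
  positions : ∀ k (p : ℕ → Bool) → ∑ (range k) (λ j → if p j then j else 0) ≡ ∑ (range k) (λ j → ind (p j)) + ∑< k (λ i j → ind (p j))
  positions zero    p = refl
  positions (suc k) p = trans (∑-range-suc k _) (trans (cong₂ _+_ (positions k p) here′)
    (trans (+-interchange (∑ (range k) (λ j → ind (p j))) _ _ _) (cong₂ _+_ (sym (∑-range-suc k _)) (sym (∑<-suc k _)))))
    where
    ones : ∀ k → ∑ (range k) (λ _ → 1) ≡ k
    ones zero    = refl
    ones (suc k) = trans (∑-range-suc k _) (trans (cong (_+ 1) (ones k)) (+-comm k 1))
    here′ : (if p (suc k) then suc k else 0) ≡ ind (p (suc k)) + ∑ (range k) (λ _ → ind (p (suc k)))
    here′ with p (suc k)
    ... | true  = cong suc (sym (ones k))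
    ... | false = sym (∑-zero (range k))
  places : sum (excPlaces w) ≡ ∑ (range n) (λ j → ind (e j)) + ∑< n (λ i j → ind (e j))
  places = trans (cong sum (sym (map-id (excPlaces w)))) (trans (∑-filterᵇ (isExc w) (range n) id)
    (trans (∑-range-cong n (λ i 1≤i i≤n → cong (λ b → if b then i else 0) (exc i 1≤i i≤n))) (positions n e)))
  A-anti : ∀ {i j} v → i ≤ j → A j v ≡ true → A i v ≡ true
  A-anti {i} {j} v i≤j h with A j v | ≤ᵇ-dec j (K v)
  A-anti {i} {j} v i≤j refl | _ | is j≤ = ≤ᵇ-true (≤-trans i≤j j≤)
  K-mono : ∀ {x y} → x ≤ y → K x ≤ K y
  K-mono {x} {y} x≤y = go w
    where
    go : ∀ u → cnt (_<ᵇ x) u ≤ cnt (_<ᵇ y) u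
    go [] = z≤n
    go (a ∷ u) with a <ᵇ x | <ᵇ-dec a x
    ... | _ | is a<x rewrite <ᵇ-true (<-≤-trans a<x x≤y) = s≤s (go u)
    ... | _ | isnt _ = ≤-trans (go u) (m≤n+m _ (ind (a <ᵇ y)))
  A-mono : ∀ j {x y} → x ≤ y → A j x ≡ true → A j y ≡ true
  A-mono j {x} x≤y h with A j x | ≤ᵇ-dec j (K x)
  A-mono j x≤y refl | _ | is j≤ = ≤ᵇ-true (≤-trans j≤ (K-mono x≤y))
  -- With a the sorted word: as many j have w_j < v ≤ a_j as have a_j < v ≤ w_j.
  balance : ∀ v → ∑ (range n) (λ j → if at w j <ᵇ v then ind (not (A j v)) else 0) ≡ ∑ (range n) (λ j → if A j v then ind (not (at w j <ᵇ v)) else 0)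
  balance v = +-cancelʳ-≡ (∑ (range n) (λ j → ind (A j v ∧ (at w j <ᵇ v)))) _ _ (begin
    ∑ (range n) (λ j → if at w j <ᵇ v then ind (not (A j v)) else 0) + ∑ (range n) (λ j → ind (A j v ∧ (at w j <ᵇ v)))
      ≡⟨ trans (sym (∑-+ (range n) _ _)) (∑-cong (range n) (λ j → left (at w j <ᵇ v) (A j v))) ⟩
    ∑ (range n) (λ j → ind (at w j <ᵇ v))
      ≡⟨ trans (cong₂ (λ m u → ∑ (range m) (λ j → ind (at u j <ᵇ v))) (sym (length-reverse w)) (sym (reverse-involutive w)))
           (trans (∑-atʳ (reverse w) (λ a → ind (a <ᵇ v))) (∑-reverse w _)) ⟩
    K v ≡⟨ sym (count-≤ n (K v) (cnt-≤-length (_<ᵇ v) w)) ⟩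
    ∑ (range n) (λ j → ind (A j v))
      ≡⟨ sym (trans (sym (∑-+ (range n) _ _)) (∑-cong (range n) (λ j → right (at w j <ᵇ v) (A j v)))) ⟩
    ∑ (range n) (λ j → if A j v then ind (not (at w j <ᵇ v)) else 0) + ∑ (range n) (λ j → ind (A j v ∧ (at w j <ᵇ v))) ∎)
    where
    left : ∀ x y → (if x then ind (not y) else 0) + ind (y ∧ x) ≡ ind x
    left true  true  = refl
    left true  false = refl
    left false true  = refl
    left false false = refl
    right : ∀ x y → (if y then ind (not x) else 0) + ind (y ∧ x) ≡ ind y
    right true  true  = refl
    right true  false = refl
    right false true  = refl
    right false false = refl
  -- Let a be the sorted word. At an excedance place i every j ≤ i has a_j ≤ a_i < w_i. This empties
  -- `L` on and below the diagonal; in `G` it leaves 1 on the diagonal and a mere comparison of two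
  -- letters of w below it.
  exchange : ∑< n L ≡ ∑ (range n) (λ j → ind (e j)) + ∑< n R
  exchange = begin
    ∑< n L ≡⟨ sym (trans (∑∑-split n L) (cong₂ _+_ (∑-range-zero n (λ i _ _ → L-diag i)) (∑<-cong n (λ i j _ i<j _ → trans (cong (L i j +_) (L-low i<j)) (+-identityʳ _))))) ⟩
    ∑ (range n) (λ i → ∑ (range n) (L i)) ≡⟨ ∑-cong (range n) row ⟩
    ∑ (range n) (λ i → ∑ (range n) (G i)) ≡⟨ ∑∑-split n G ⟩
    ∑ (range n) (λ i → G i i) + ∑< n (λ i j → G i j + G j i)
      ≡⟨ cong₂ _+_ (∑-cong (range n) G-diag) (∑<-cong n (λ i j _ i<j _ → cong (G i j +_) (G-low i<j))) ⟩
    ∑ (range n) (λ j → ind (e j)) + ∑< n R ∎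
    where
    G : ℕ → ℕ → ℕ
    G i j = if e i then (if A j (at w i) then ind (not (at w j <ᵇ at w i)) else 0) else 0
    row : ∀ i → ∑ (range n) (L i) ≡ ∑ (range n) (G i)
    row i with e i
    ... | true  = balance (at w i)
    ... | false = refl
    L-diag : ∀ i → L i i ≡ 0
    L-diag i rewrite <ᵇ-false (≤-refl {at w i}) = if-const (e i)
    L-low : ∀ {i j} → i < j → L j i ≡ 0
    L-low {i} {j} i<j with e j in eq
    ... | false = refl
    ... | true rewrite A-anti (at w j) (<⇒≤ i<j) eq = if-const (at w i <ᵇ at w j)
    G-diag : ∀ i → G i i ≡ ind (e i)
    G-diag i rewrite <ᵇ-false (≤-refl {at w i}) with e i
    ... | true  = refl
    ... | false = refl
    G-low : ∀ {i j} → i < j → G j i ≡ (if e j then ind (at w j ≤ᵇ at w i) else 0)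
    G-low {i} {j} i<j with e j in eq
    ... | false = refl
    ... | true rewrite A-anti (at w j) (<⇒≤ i<j) eq = cong ind flip
      where
      flip : not (at w i <ᵇ at w j) ≡ (at w j ≤ᵇ at w i)
      flip with at w i <ᵇ at w j | <ᵇ-dec (at w i) (at w j)
      ... | _ | is h   = sym (≤ᵇ-false h)
      ... | _ | isnt h = sym (≤ᵇ-true h)
  -- `α` says that the j-th sorted letter is less than w_i; `lt` and `le` compare w_j with w_i. The
  -- hypotheses exclude the rows of the truth table that contradict transitivity or the sortedness
  -- of a.
  logic : ∀ ei ej α lt le →
    (ej ≡ true → le ≡ true → α ≡ true) → (α ≡ true → ei ≡ true) → (α ≡ true → lt ≡ false → ej ≡ true) → (lt ≡ true → le ≡ true) →
    (if ei then (if lt then ind (not α) else 0) else 0)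
      + (ind ej + (if ej then (if ei then ind le else 0) else 0) + (if not ej then (if not ei then ind lt else 0) else 0))
    ≡ (if ej then ind (not α ∨ lt) else ind (lt ∧ not α))
      + ((if ei then (if α then ind (not lt) else 0) else 0) + (if ej then ind le else 0))
  logic true  true  true  true  true  h₁ h₂ h₃ h₄ = refl
  logic true  true  true  true  false h₁ h₂ h₃ h₄ = contradiction (h₄ refl) λ ()
  logic true  true  true  false true  h₁ h₂ h₃ h₄ = refl
  logic true  true  true  false false h₁ h₂ h₃ h₄ = refl
  logic true  true  false true  true  h₁ h₂ h₃ h₄ = contradiction (h₁ refl refl) λ ()
  logic true  true  false true  false h₁ h₂ h₃ h₄ = contradiction (h₄ refl) λ ()
  logic true  true  false false true  h₁ h₂ h₃ h₄ = contradiction (h₁ refl refl) λ ()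
  logic true  true  false false false h₁ h₂ h₃ h₄ = refl
  logic true  false true  true  le    h₁ h₂ h₃ h₄ = refl
  logic true  false true  false le    h₁ h₂ h₃ h₄ = contradiction (h₃ refl refl) λ ()
  logic true  false false true  le    h₁ h₂ h₃ h₄ = refl
  logic true  false false false le    h₁ h₂ h₃ h₄ = refl
  logic false ej    true  lt    le    h₁ h₂ h₃ h₄ = contradiction (h₂ refl) λ ()
  logic false true  false true  true  h₁ h₂ h₃ h₄ = contradiction (h₁ refl refl) λ ()
  logic false true  false true  false h₁ h₂ h₃ h₄ = contradiction (h₄ refl) λ ()
  logic false true  false false true  h₁ h₂ h₃ h₄ = contradiction (h₁ refl refl) λ ()
  logic false true  false false false h₁ h₂ h₃ h₄ = refl
  logic false false false true  le    h₁ h₂ h₃ h₄ = refl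
  logic false false false false le    h₁ h₂ h₃ h₄ = refl
  pointwise : ∀ i j → 1 ≤ i → i < j → j ≤ n → L i j + X i j ≡ C i j + R i j
  pointwise i j _ i<j _ = logic (e i) (e j) (A j (at w i)) (at w j <ᵇ at w i) (at w j ≤ᵇ at w i) imp₁ (A-anti (at w i) (<⇒≤ i<j)) imp₃ imp₄
    where
    imp₁ : e j ≡ true → (at w j ≤ᵇ at w i) ≡ true → A j (at w i) ≡ true
    imp₁ ej le with at w j ≤ᵇ at w i | ≤ᵇ-dec (at w j) (at w i)
    imp₁ ej refl | _ | is h = A-mono j h ej
    imp₃ : A j (at w i) ≡ true → (at w j <ᵇ at w i) ≡ false → e j ≡ true
    imp₃ α lt with at w j <ᵇ at w i | <ᵇ-dec (at w j) (at w i)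
    imp₃ α refl | _ | isnt h = A-mono j h α
    imp₄ : (at w j <ᵇ at w i) ≡ true → (at w j ≤ᵇ at w i) ≡ true
    imp₄ lt with at w j <ᵇ at w i | <ᵇ-dec (at w j) (at w i)
    imp₄ refl | _ | is h = ≤ᵇ-true (<⇒≤ h)
  cancelled : ∑ (range n) (λ j → ind (e j)) + ∑< n X + ∑< n R ≡ ∑< n C + ∑< n R
  cancelled = begin
    ∑ (range n) (λ j → ind (e j)) + ∑< n X + ∑< n R ≡⟨ re₂ (∑ (range n) (λ j → ind (e j))) _ _ ⟩
    ∑ (range n) (λ j → ind (e j)) + ∑< n R + ∑< n X ≡⟨ cong (_+ ∑< n X) (sym exchange) ⟩
    ∑< n L + ∑< n X ≡⟨ sym (∑<-+ n L X) ⟩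
    ∑< n (λ i j → L i j + X i j) ≡⟨ ∑<-cong n pointwise ⟩
    ∑< n (λ i j → C i j + R i j) ≡⟨ ∑<-+ n C R ⟩
    ∑< n C + ∑< n R ∎
    where
    re₂ : ∀ a b c → a + b + c ≡ a + c + b
    re₂ = solve-∀

-- `K` is not recomputed when letters are removed: the position `suc (length v)` always refers to
-- the sorted version of the full word.
den : (ℕ → ℕ) → Word → ℕ
den K []      = 0
den K (b ∷ v) = den K v + ∑ v (λ a → cycle K (suc (length v)) a b)

den-pairsʳ : ∀ K v → pairsʳ (λ _ → cycle K) v ≡ den K v
den-pairsʳ K []      = refl
den-pairsʳ K (b ∷ v) = trans (pairsʳ-∷ (λ _ → cycle K) b v) (cong₂ _+_ (den-pairsʳ K v) (∑-atʳ v (λ a → cycle K (suc (length v)) a b)))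

den-cong-∈ : ∀ {K K′} u → (∀ x → x ∈ u → K x ≡ K′ x) → den K u ≡ den K′ u
den-cong-∈ []      h = refl
den-cong-∈ {K} {K′} (b ∷ u) h = cong₂ _+_ (den-cong-∈ u (λ x → h x ∘ there)) (∑-cong-∈ u (λ a a∈ → cong₂ (λ x y →
    if suc (length u) ≤ᵇ x then ind (not (suc (length u) ≤ᵇ y) ∨ (b <ᵇ a)) else ind ((b <ᵇ a) ∧ not (suc (length u) ≤ᵇ y))) (h b (here refl)) (h a (there a∈))))

DEN-reverse : ∀ v → DEN (reverse v) ≡ den (λ x → cnt (_<ᵇ x) v) v
DEN-reverse v = trans (DEN-cycle (reverse v))
  (trans (cong (λ n → ∑< n (λ i j → cycle (λ x → cnt (_<ᵇ x) (reverse v)) j (atʳ v i) (atʳ v j))) (length-reverse v))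
  (trans (den-pairsʳ (λ x → cnt (_<ᵇ x) (reverse v)) v) (den-cong-∈ v (λ x _ → cnt-reverse (_<ᵇ x) v))))

-- For s ≥ 1 this c is the s-th letter of the sorted word with multiplicities κ.
least-N : ∀ κ m s → s ≤ N κ m → ∃ λ c → c ≤ m × s ≤ N κ c × (∀ x → x < c → N κ x < s)
least-N κ zero    s s≤ = 0 , z≤n , s≤ , λ _ ()
least-N κ (suc m) s s≤ with s ≤ᵇ N κ m | ≤ᵇ-dec s (N κ m)
... | _ | is h with least-N κ m s h
...   | c , c≤m , p , r = c , m≤n⇒m≤1+n c≤m , p , r
least-N κ (suc m) s s≤ | _ | isnt h = suc m , ≤-refl , s≤ , λ { x (s≤s x≤m) → ≤-<-trans (N-mono κ x≤m) h }

module DenStatistic (q m : ℕ) where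
  open QNumbers q
  open LastLetter m
  open Hooks q m
  open LastLetterStatistics q m

  E-≥1 : ∀ n {κ t} → State n κ t → ∀ v → v ∈ E n κ t → ∀ x → x ∈ v → 1 ≤ x
  E-≥1 zero    S .[] (here refl) x ()
  E-≥1 (suc n) S v v∈ x x∈ with ∈E⁻ S v∈
  E-≥1 (suc n) S .(b ∷ v′) v∈ x (here refl) | b , v′ , A , refl , v′∈ = 1≤b S A
  E-≥1 (suc n) S .(b ∷ v′) v∈ x (there x∈)  | b , v′ , A , refl , v′∈ = E-≥1 n (next S A) v′ v′∈ x x∈

  -- A last letter b at position n + 1 contributes `cyc κ c b`, where c is the (n + 1)-st letter of
  -- the sorted full word. To apply `cyc-total` one needs t ≤ c; this is why the induction records
  -- that the letters at most t are still complete. The invariant survives, since the letters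
  -- constrained after the removal of b are all below b.
  den-total : ∀ κ₀ n {κ t} → State n κ t → (∀ i → i ≤ t → κ i ≡ κ₀ i) → n ≤ N κ₀ m →
    ∑ (E n κ t) (λ v → q ^ den (λ x → N κ₀ (pred x)) v) * D m κ t ≡ ⟦ n ⟧!
  den-total κ₀ zero S same n≤ = trans (*-identityˡ _) (D-base S m ≤-refl)
  den-total κ₀ (suc n) {κ} {t} S same n≤ with least-N κ₀ m (suc n) n≤
  ... | c , c≤m , reach , below = trans (step S (den K) 1 (cyc κ c) each (trans (cyc-total κ t≤c c≤m) (cong ⟦_⟧ (tot S)))) (*-identityˡ _)
    where
    open ≡-Reasoning
    K : ℕ → ℕ
    K x = N κ₀ (pred x)
    N-same : ∀ i → i ≤ t → N κ i ≡ N κ₀ i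
    N-same zero    _   = refl
    N-same (suc i) i<t = cong₂ _+_ (N-same i (<⇒≤ i<t)) (same (suc i) i<t)
    -- Otherwise n + 1 ≤ N κ₀ c < N κ₀ t = N κ t ≤ n + 1, because all letters at most t are still
    -- present.
    t≤c : t ≤ c
    t≤c = ≮⇒≥ (λ c<t → bad t ≤-refl c<t)
      where
      bad : ∀ t′ → t′ ≤ t → c < t′ → ⊥
      bad (suc t′) t′≤t (s≤s c≤t′) = <⇒≱ (≤-<-trans reach (≤-<-trans (N-mono κ₀ c≤t′)
          (subst (N κ₀ t′ <_) (cong (N κ₀ t′ +_) (same (suc t′) t′≤t)) (m<m+n (N κ₀ t′) (pos S (suc t′) (s≤s z≤n) t′≤t)))))
        (subst₂ _≤_ (N-same (suc t′) t′≤t) (tot S) (N-mono κ (≤-trans t′≤t (t≤m S))))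
    threshold : ∀ x → 1 ≤ x → (suc n ≤ᵇ K x) ≡ (c <ᵇ x)
    threshold (suc x) _ with c <ᵇ suc x | <ᵇ-dec c (suc x)
    ... | _ | is (s≤s c≤x) = ≤ᵇ-true (≤-trans reach (N-mono κ₀ c≤x))
    ... | _ | isnt x<c     = ≤ᵇ-false (below x x<c)
    weight : ∀ b (A : Allowed κ t b) → ∀ v → v ∈ E n (κ ⊖ b) (lower t b) → ∑ v (λ a → cycle K (suc (length v)) a b) ≡ cyc κ c b
    weight b A v v∈ = trans (∑-cong-∈ v norm) (count b A v v∈)
      where
      norm : ∀ a → a ∈ v → cycle K (suc (length v)) a b ≡ (if c <ᵇ b then ind (not (c <ᵇ a) ∨ (b <ᵇ a)) else ind ((b <ᵇ a) ∧ not (c <ᵇ a)))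
      norm a a∈ rewrite E-length n (next S A) v v∈ | threshold b (1≤b S A) | threshold a (E-≥1 n (next S A) v v∈ a a∈) = refl
      count : ∀ b (A : Allowed κ t b) → ∀ v → v ∈ E n (κ ⊖ b) (lower t b) →
        ∑ v (λ a → if c <ᵇ b then ind (not (c <ᵇ a) ∨ (b <ᵇ a)) else ind ((b <ᵇ a) ∧ not (c <ᵇ a))) ≡ cyc κ c b
      count b A v v∈ with b ≤ᵇ c | ≤ᵇ-dec b c
      ... | _ | is b≤c rewrite <ᵇ-false b≤c = begin
          ∑ v (λ a → ind ((b <ᵇ a) ∧ not (c <ᵇ a))) ≡⟨ ∑-cong v (λ a → cong (λ y → ind ((b <ᵇ a) ∧ y)) (flip a)) ⟩
          cnt (λ a → (b <ᵇ a) ∧ (a ≤ᵇ c)) v ≡⟨ E-cnt-between n (next S A) v v∈ b c b≤c c≤m ⟩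
          N (κ ⊖ b) c ∸ N (κ ⊖ b) b ≡⟨ sym (cong₂ _∸_ (N-next S A c b≤c) (N-next S A b ≤-refl)) ⟩
          N κ c ∸ N κ b ∎
        where
        flip : ∀ a → not (c <ᵇ a) ≡ (a ≤ᵇ c)
        flip a with c <ᵇ a | <ᵇ-dec c a
        ... | _ | is h   = sym (≤ᵇ-false h)
        ... | _ | isnt h = sym (≤ᵇ-true h)
      ... | _ | isnt c<b rewrite <ᵇ-true c<b = begin
          ∑ v (λ a → ind (not (c <ᵇ a) ∨ (b <ᵇ a))) ≡⟨ ∑-cong v apart ⟩
          ∑ v (λ a → ind (b <ᵇ a) + ind (a ≤ᵇ c)) ≡⟨ ∑-+ v _ _ ⟩
          cnt (b <ᵇ_) v + cnt (_≤ᵇ c) v ≡⟨ cong₂ _+_ (inv-next S A v v∈) (trans (E-cnt≤ n (next S A) v v∈ c c≤m) (N-⊖-below κ c c<b)) ⟩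
          (suc n ∸ N κ b) + N κ c ≡⟨ cong (λ y → (y ∸ N κ b) + N κ c) (sym (tot S)) ⟩
          (N κ m ∸ N κ b) + N κ c ∎
        where
        apart : ∀ a → ind (not (c <ᵇ a) ∨ (b <ᵇ a)) ≡ ind (b <ᵇ a) + ind (a ≤ᵇ c)
        apart a with c <ᵇ a | <ᵇ-dec c a
        ... | _ | is h rewrite ≤ᵇ-false h = sym (+-identityʳ _)
        ... | _ | isnt h rewrite ≤ᵇ-true h | <ᵇ-false (≤-trans h (<⇒≤ c<b)) = refl
    each : ∀ b → Allowed κ t b → ∑ (E n (κ ⊖ b) (lower t b)) (λ v → q ^ den K (b ∷ v)) * D m (κ ⊖ b) (lower t b) ≡ 1 * (q ^ cyc κ c b * ⟦ n ⟧!)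
    each b A = begin
      ∑ E′ (λ v → q ^ den K (b ∷ v)) * D′
        ≡⟨ cong (_* D′) (factor E′ _ (den K) (cyc κ c b) (λ v v∈ → trans (+-comm (den K v) _) (cong (_+ den K v) (weight b A v v∈)))) ⟩
      q ^ cyc κ c b * ∑ E′ (λ v → q ^ den K v) * D′ ≡⟨ *-assoc (q ^ cyc κ c b) _ _ ⟩
      q ^ cyc κ c b * (∑ E′ (λ v → q ^ den K v) * D′) ≡⟨ cong (q ^ cyc κ c b *_) (den-total κ₀ n (next S A) same′ (<⇒≤ n≤)) ⟩
      q ^ cyc κ c b * ⟦ n ⟧! ≡⟨ sym (*-identityˡ _) ⟩
      1 * (q ^ cyc κ c b * ⟦ n ⟧!) ∎
      where
      E′ : List Word
      E′ = E n (κ ⊖ b) (lower t b)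
      D′ : ℕ
      D′ = D m (κ ⊖ b) (lower t b)
      same′ : ∀ i → i ≤ lower t b → (κ ⊖ b) i ≡ κ₀ i
      same′ i i≤ = trans (⊖-other κ (<⇒≢ i<b)) (same i (≤-trans i≤ (lower-≤ t b)))
        where
        i<b : i < b
        i<b with b ≡ᵇ t | ≡ᵇ-dec b t
        ... | _ | is refl = subst (i <_) (suc-pred b {{>-nonZero (1≤b S A)}}) (s≤s i≤)
        ... | _ | isnt ne = ≤-<-trans i≤ (≤∧≢⇒< (t≤b A) (ne ∘ sym))

  DEN-den : ∀ n {κ t} → State n κ t → ∀ v → v ∈ E n κ t → DEN (reverse v) ≡ den (λ x → N κ (pred x)) v
  DEN-den n {κ} S v v∈ = trans (DEN-reverse v) (den-cong-∈ v (λ x x∈ → K-eq x (E-≥1 n S v v∈ x x∈) (E-≤m n S v v∈ x x∈)))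
    where
    K-eq : ∀ x → 1 ≤ x → x ≤ m → cnt (_<ᵇ x) v ≡ N κ (pred x)
    K-eq (suc x) _ x<m = trans (∑-cong v (λ a → cong ind (aux a))) (E-cnt≤ n S v v∈ x (<⇒≤ x<m))
      where
      aux : ∀ a → (a <ᵇ suc x) ≡ (a ≤ᵇ x)
      aux zero    = refl
      aux (suc a) = refl

-- Label polynomials and the insertion operator

module Elementary (q : ℕ) where
  open QNumbers q

  -- elem ls is the linear functional z^l ↦ c l evaluated at the polynomial ∏ (1 + q^ℓ z), ℓ ∈ ls.
  elem : List ℕ → (ℕ → ℕ) → ℕ
  elem []       c = c 0
  elem (ℓ ∷ ls) c = elem ls c + q ^ ℓ * elem ls (c ∘ suc)

  elem-cong : ∀ ls {c d} → (∀ l → c l ≡ d l) → elem ls c ≡ elem ls d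
  elem-cong []       h = h 0
  elem-cong (ℓ ∷ ls) h = cong₂ (λ x y → x + q ^ ℓ * y) (elem-cong ls h) (elem-cong ls (h ∘ suc))

  elem-+ : ∀ ls c d → elem ls (λ l → c l + d l) ≡ elem ls c + elem ls d
  elem-+ []       c d = refl
  elem-+ (ℓ ∷ ls) c d = trans (cong₂ (λ x y → x + q ^ ℓ * y) (elem-+ ls c d) (elem-+ ls (c ∘ suc) (d ∘ suc)))
    (re (elem ls c) (elem ls d) (q ^ ℓ) _ _)
    where
    re : ∀ a b x c d → a + b + x * (c + d) ≡ a + x * c + (b + x * d)
    re = solve-∀

  elem-* : ∀ ls k c → elem ls (λ l → k * c l) ≡ k * elem ls c
  elem-* []       k c = refl
  elem-* (ℓ ∷ ls) k c = trans (cong₂ (λ x y → x + q ^ ℓ * y) (elem-* ls k c) (elem-* ls k (c ∘ suc))) (re k (elem ls c) (q ^ ℓ) _)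
    where
    re : ∀ k a x b → k * a + x * (k * b) ≡ k * (a + x * b)
    re = solve-∀

  infixl 6 _⊕_

  -- The dual of multiplication by 1 + q^ℓ z.
  _⊕_ : (ℕ → ℕ) → ℕ → ℕ → ℕ
  (c ⊕ ℓ) l = c l + q ^ ℓ * c (suc l)

  elem-∷ : ∀ ℓ ls c → elem (ℓ ∷ ls) c ≡ elem ls (c ⊕ ℓ)
  elem-∷ ℓ ls c = sym (trans (elem-+ ls c _) (cong (elem ls c +_) (elem-* ls (q ^ ℓ) (c ∘ suc))))

  elem-↭ : ∀ {ls ls′} → ls ↭ ls′ → ∀ c → elem ls c ≡ elem ls′ c
  elem-↭ Perm.refl         c = refl
  elem-↭ (Perm.prep x p)   c = cong₂ (λ a b → a + q ^ x * b) (elem-↭ p c) (elem-↭ p (c ∘ suc))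
  elem-↭ (Perm.swap {xs} {ys} x y p) c = trans (re (elem xs c) (elem xs (c ∘ suc)) (q ^ x) (q ^ y) _)
      (cong₂ _+_ (cong₂ (λ a b → a + q ^ x * b) (elem-↭ p c) (elem-↭ p (c ∘ suc)))
                 (cong (q ^ y *_) (cong₂ (λ a b → a + q ^ x * b) (elem-↭ p (c ∘ suc)) (elem-↭ p (c ∘ suc ∘ suc)))))
    where
    re : ∀ a b x y d → a + y * b + x * (b + y * d) ≡ a + x * b + y * (b + x * d)
    re = solve-∀
  elem-↭ (Perm.trans p r)  c = trans (elem-↭ p c) (elem-↭ r c)

  Series : Set
  Series = ℕ → (ℕ → ℕ) → ℕ

  -- A series V stands for Σ V_r y^r with coefficients polynomials in z (seen through c), and
  -- Op is V(y) ↦ (z + y) / (1 - q y) · V(q y).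
  Op : Series → Series
  Op V zero    c = V 0 (c ∘ suc)
  Op V (suc r) c = q * Op V r c + q ^ suc r * V (suc r) (c ∘ suc) + q ^ r * V r c

  one : Series
  one zero    c = c 0
  one (suc r) c = 0

  -- For the labels ls of a word u, the coefficient of y^r in F ls collects the words obtained from u
  -- by inserting r copies of a new largest letter, none of them at the end.
  F : List ℕ → Series
  F []       = one
  F (ℓ ∷ ls) r c = F ls r c + q ^ ℓ * Op (F ls) r c

  Op-cong : ∀ {V W : Series} → (∀ r c → V r c ≡ W r c) → ∀ r c → Op V r c ≡ Op W r c
  Op-cong h zero    c = h 0 (c ∘ suc)
  Op-cong h (suc r) c = cong₂ _+_ (cong₂ (λ a b → q * a + q ^ suc r * b) (Op-cong h r c) (h (suc r) (c ∘ suc))) (cong (q ^ r *_) (h r c))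

  power : ℕ → Series
  power zero    = one
  power (suc l) = Op (power l)

  Op-elem : ∀ ls (V : ℕ → Series) r c → Op (λ r c → elem ls (λ l → V l r c)) r c ≡ elem ls (λ l → Op (V l) r c)
  Op-elem ls V zero    c = refl
  Op-elem ls V (suc r) c = sym (begin
    elem ls (λ l → q * Op (V l) r c + q ^ suc r * V l (suc r) (c ∘ suc) + q ^ r * V l r c)
      ≡⟨ trans (elem-+ ls _ _) (cong₂ _+_ (elem-+ ls _ _) (elem-* ls (q ^ r) _)) ⟩
    elem ls (λ l → q * Op (V l) r c) + elem ls (λ l → q ^ suc r * V l (suc r) (c ∘ suc)) + q ^ r * elem ls (λ l → V l r c)
      ≡⟨ cong (_+ q ^ r * elem ls (λ l → V l r c)) (cong₂ _+_ (trans (elem-* ls q _) (cong (q *_) (sym (Op-elem ls V r c)))) (elem-* ls (q ^ suc r) _)) ⟩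
    Op (λ r c → elem ls (λ l → V l r c)) (suc r) c ∎)
    where open ≡-Reasoning

  -- `F ls` is ∏ (1 + q^ℓ Op) applied to 1, the label polynomial with z replaced by `Op`. Hence a
  -- weighted sum of such series over many words is determined by the same sum of their label
  -- polynomials.
  F-elem : ∀ ls r c → F ls r c ≡ elem ls (λ l → power l r c)
  F-elem []       r c = refl
  F-elem (ℓ ∷ ls) r c = cong₂ (λ x y → x + q ^ ℓ * y) (F-elem ls r c)
    (trans (Op-cong (F-elem ls) r c) (Op-elem ls power r c))

  F-cong : ∀ ls r {c d} → (∀ l → c l ≡ d l) → F ls r c ≡ F ls r d
  Op-cong′ : ∀ ls r {c d} → (∀ l → c l ≡ d l) → Op (F ls) r c ≡ Op (F ls) r d
  F-cong []       zero    h = h 0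
  F-cong []       (suc r) h = refl
  F-cong (ℓ ∷ ls) r h = cong₂ (λ x y → x + q ^ ℓ * y) (F-cong ls r h) (Op-cong′ ls r h)
  Op-cong′ ls zero    h = F-cong ls 0 (h ∘ suc)
  Op-cong′ ls (suc r) h = cong₂ _+_ (cong₂ (λ a b → q * a + q ^ suc r * b) (Op-cong′ ls r h) (F-cong ls (suc r) (h ∘ suc))) (cong (q ^ r *_) (F-cong ls r h))

  F-* : ∀ ls r k c → F ls r (λ l → k * c l) ≡ k * F ls r c
  Op-* : ∀ ls r k c → Op (F ls) r (λ l → k * c l) ≡ k * Op (F ls) r c
  F-* []       zero    k c = refl
  F-* []       (suc r) k c = sym (*-zeroʳ k)
  F-* (ℓ ∷ ls) r k c = trans (cong₂ (λ x y → x + q ^ ℓ * y) (F-* ls r k c) (Op-* ls r k c)) (re k (F ls r c) (q ^ ℓ) _)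
    where
    re : ∀ k a x b → k * a + x * (k * b) ≡ k * (a + x * b)
    re = solve-∀
  Op-* ls zero    k c = F-* ls 0 k (c ∘ suc)
  Op-* ls (suc r) k c = trans (cong₂ _+_ (cong₂ (λ a b → q * a + q ^ suc r * b) (Op-* ls r k c) (F-* ls (suc r) k (c ∘ suc))) (cong (q ^ r *_) (F-* ls r k c)))
      (re q k _ (q ^ suc r) _ (q ^ r) _)
    where
    re : ∀ q k a x b y d → q * (k * a) + x * (k * b) + y * (k * d) ≡ k * (q * a + x * b + y * d)
    re = solve-∀

  -- The coefficients of V(y)/(1 - y): the factor stands for copies of the largest letter at the end
  -- of the word, where they cost nothing.
  partial : Series → Series
  partial V zero    c = V 0 c
  partial V (suc r) c = partial V r c + V (suc r) c

  partial-cong : ∀ ls r {c d} → (∀ l → c l ≡ d l) → partial (F ls) r c ≡ partial (F ls) r d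
  partial-cong ls zero    h = F-cong ls 0 h
  partial-cong ls (suc r) h = cong₂ _+_ (partial-cong ls r h) (F-cong ls (suc r) h)

  partial-* : ∀ ls r k c → partial (F ls) r (λ l → k * c l) ≡ k * partial (F ls) r c
  partial-* ls zero    k c = F-* ls 0 k c
  partial-* ls (suc r) k c = trans (cong₂ _+_ (partial-* ls r k c) (F-* ls (suc r) k c)) (sym (*-distribˡ-+ k _ _))

  partial-elem : ∀ ls r c → partial (F ls) r c ≡ elem ls (λ l → partial (power l) r c)
  partial-elem ls zero    c = F-elem ls 0 c
  partial-elem ls (suc r) c = trans (cong₂ _+_ (partial-elem ls r c) (F-elem ls (suc r) c)) (sym (elem-+ ls _ _))

  -- V(qy)/(1 - qy) has the coefficients q^r (V_0 + ⋯ + V_r), and the factor z + y combines two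
  -- consecutive ones. In this form the operator appears in the insertion argument.
  Op-suc : ∀ (V : Series) r c → Op V (suc r) c ≡ q ^ suc r * V (suc r) (c ∘ suc) + q ^ r * (partial V r c + q * partial V r (c ∘ suc))
  Op-suc V zero    c = re q (V 0 (c ∘ suc)) (V 1 (c ∘ suc)) (V 0 c)
    where
    re : ∀ q a b d → q * a + q * 1 * b + 1 * d ≡ q * 1 * b + 1 * (d + q * a)
    re = solve-∀
  Op-suc V (suc r) c = trans (cong (λ y → q * y + q ^ suc (suc r) * V (suc (suc r)) (c ∘ suc) + q ^ suc r * V (suc r) c) (Op-suc V r c))
      (re q (q ^ r) (V (suc r) (c ∘ suc)) (partial V r c) (partial V r (c ∘ suc)) (V (suc (suc r)) (c ∘ suc)) (V (suc r) c))
    where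
    re : ∀ q x a b d e g → q * (q * x * a + x * (b + q * d)) + q * (q * x) * e + q * x * g
                         ≡ q * (q * x) * e + q * x * (b + g + q * (d + a))
    re = solve-∀

  -- h n r is the coefficient of y^r in 1 / ∏_{i=1}^n (1 - q^i y); its two recurrences come from
  -- splitting off the last and the first factor.
  h : ℕ → ℕ → ℕ
  h zero    zero    = 1
  h zero    (suc r) = 0
  h (suc n) zero    = 1
  h (suc n) (suc r) = h n (suc r) + q ^ suc n * h (suc n) r

  h-0 : ∀ n → h n 0 ≡ 1
  h-0 zero    = refl
  h-0 (suc n) = refl

  h-first : ∀ n r → h (suc n) (suc r) ≡ q * h (suc n) r + q ^ suc r * h n (suc r)
  h-first zero    r = re q (h 1 r) (q ^ suc r)
    where
    re : ∀ q a x → 0 + q * 1 * a ≡ q * a + x * 0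
    re = solve-∀
  h-first (suc n) zero = trans (cong (_+ q ^ suc (suc n) * 1) (h-first n 0)) (trans (cong (λ y → q * 1 + q * 1 * h n 1 + q * y * 1) refl) (re q (h n 1) (q ^ suc n)))
    where
    re : ∀ q a x → q * 1 + q * 1 * a + q * x * 1 ≡ q * 1 + q * 1 * (a + x * 1)
    re = solve-∀
  h-first (suc n) (suc r) = trans (cong₂ (λ x y → x + q ^ suc (suc n) * y) (h-first n (suc r)) (h-first (suc n) r))
      (re q (q ^ n) (q ^ r) (h n (suc r)) (h (suc n) r) (h (suc (suc n)) r) (h n (suc (suc r))))
    where
    re : ∀ q x y a b d e → q * (a + q * x * b) + q * (q * y) * e + q * (q * x) * (q * d + q * y * (a + q * x * b))
       ≡ q * ((a + q * x * b) + q * (q * x) * d) + q * (q * y) * (e + q * x * (a + q * x * b))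
    re = solve-∀

  h⁻ : ℕ → ℕ → ℕ
  h⁻ n zero    = 0
  h⁻ n (suc r) = h n r

  h-last : ∀ n r → h (suc n) r ≡ h n r + q ^ suc n * h⁻ (suc n) r
  h-last n zero    = trans (sym (h-0 n)) (trans (sym (+-identityʳ _)) (cong (h n 0 +_) (sym (*-zeroʳ (q ^ suc n)))))
  h-last n (suc r) = refl

  h⁻-first : ∀ n r → h (suc n) r ≡ q * h⁻ (suc n) r + q ^ r * h n r
  h⁻-first n zero rewrite h-0 n | *-zeroʳ q = refl
  h⁻-first n (suc r) = h-first n r

  -- If V = e / ∏_{i=1}^n (1 - q^i y), then V(qy)/(1 - qy) = e / ∏_{i=1}^{n+1} (1 - q^i y); the
  -- factor z + y gives the two terms.
  Op-h : ∀ n (V : Series) (e : (ℕ → ℕ) → ℕ) → (∀ r c → V r c ≡ h n r * e c) →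
    ∀ r c → Op V r c ≡ h (suc n) r * e (c ∘ suc) + h⁻ (suc n) r * e c
  Op-h n V e eq zero    c = trans (eq 0 (c ∘ suc)) (trans (cong (_* e (c ∘ suc)) (h-0 n)) (sym (+-identityʳ _)))
  Op-h n V e eq (suc r) c = begin
    q * Op V r c + q ^ suc r * V (suc r) (c ∘ suc) + q ^ r * V r c
      ≡⟨ cong₂ _+_ (cong₂ (λ x y → q * x + q ^ suc r * y) (Op-h n V e eq r c) (eq (suc r) (c ∘ suc))) (cong (q ^ r *_) (eq r c)) ⟩
    q * (h (suc n) r * e (c ∘ suc) + h⁻ (suc n) r * e c) + q ^ suc r * (h n (suc r) * e (c ∘ suc)) + q ^ r * (h n r * e c)
      ≡⟨ re q (h (suc n) r) (e (c ∘ suc)) (h⁻ (suc n) r) (e c) (q ^ suc r) (h n (suc r)) (q ^ r) (h n r) ⟩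
    (q * h (suc n) r + q ^ suc r * h n (suc r)) * e (c ∘ suc) + (q * h⁻ (suc n) r + q ^ r * h n r) * e c
      ≡⟨ cong₂ (λ x y → x * e (c ∘ suc) + y * e c) (sym (h-first n r)) (sym (h⁻-first n r)) ⟩
    h (suc n) (suc r) * e (c ∘ suc) + h (suc n) r * e c ∎
    where
    open ≡-Reasoning
    re : ∀ q a e′ b e x d y f → q * (a * e′ + b * e) + x * (d * e′) + y * (f * e) ≡ (q * a + x * d) * e′ + (q * b + y * f) * e
    re = solve-∀

  -- The label n + 1 multiplies the series by 1 + q^(n+1) (z + y)/(1 - q^(n+1) y) = (1 + q^(n+1)
  -- z)/(1 - q^(n+1) y). So for the labels 1,...,n the variables separate: F is ∏ (1 + q^i z) / ∏ (1
  -- - q^i y).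
  F-down : ∀ n r c → F (down n) r c ≡ h n r * elem (down n) c
  F-down zero    zero    c = sym (*-identityˡ (c 0))
  F-down zero    (suc r) c = refl
  F-down (suc n) r c = begin
    F (down n) r c + q ^ suc n * Op (F (down n)) r c
      ≡⟨ cong₂ (λ x y → x + q ^ suc n * y) (F-down n r c) (Op-h n (F (down n)) (elem (down n)) (F-down n) r c) ⟩
    h n r * elem (down n) c + q ^ suc n * (h (suc n) r * elem (down n) (c ∘ suc) + h⁻ (suc n) r * elem (down n) c)
      ≡⟨ re (h n r) (elem (down n) c) (q ^ suc n) (h (suc n) r) (elem (down n) (c ∘ suc)) (h⁻ (suc n) r) ⟩
    (h n r + q ^ suc n * h⁻ (suc n) r) * elem (down n) c + h (suc n) r * (q ^ suc n * elem (down n) (c ∘ suc))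
      ≡⟨ cong (λ x → x * elem (down n) c + h (suc n) r * (q ^ suc n * elem (down n) (c ∘ suc))) (sym (h-last n r)) ⟩
    h (suc n) r * elem (down n) c + h (suc n) r * (q ^ suc n * elem (down n) (c ∘ suc))
      ≡⟨ sym (*-distribˡ-+ (h (suc n) r) _ _) ⟩
    h (suc n) r * elem (down (suc n)) c ∎
    where
    open ≡-Reasoning
    re : ∀ a e x b e′ d → a * e + x * (b * e′ + d * e) ≡ (a + x * d) * e + b * (x * e′)
    re = solve-∀

  -- The q-binomial coefficient of n + r over r, by `H-factorial`.
  H : ℕ → ℕ → ℕ
  H n zero    = h n 0
  H n (suc r) = H n r + h n (suc r)

  partial-down : ∀ n r c → partial (F (down n)) r c ≡ H n r * elem (down n) c
  partial-down n zero    c = F-down n 0 c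
  partial-down n (suc r) c = trans (cong₂ _+_ (partial-down n r c) (F-down n (suc r) c)) (sym (*-distribʳ-+ (elem (down n) c) (H n r) (h n (suc r))))

  H-last : ∀ n r → H (suc n) (suc r) ≡ H n (suc r) + q ^ suc n * H (suc n) r
  H-last n zero    rewrite h-0 n = refl
  H-last n (suc r) = trans (cong (_+ h (suc n) (suc (suc r))) (H-last n r)) (re (H n (suc r)) (q ^ suc n) (H (suc n) r) _ _)
    where
    re : ∀ a x b d e → a + x * b + (d + x * e) ≡ a + d + x * (b + e)
    re = solve-∀

  H-zero : ∀ r → H 0 r ≡ 1
  H-zero zero    = refl
  H-zero (suc r) = trans (+-identityʳ (H 0 r)) (H-zero r)

  H-factorial : ∀ n r → H n r * (⟦ n ⟧! * ⟦ r ⟧!) ≡ ⟦ n + r ⟧!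
  H-factorial zero    r = trans (cong (_* (1 * ⟦ r ⟧!)) (H-zero r)) (trans (*-identityˡ _) (*-identityˡ _))
  H-factorial (suc n) zero = trans (*-identityˡ _) (trans (*-identityʳ _) (cong ⟦_⟧! (cong suc (sym (+-identityʳ n)))))
  H-factorial (suc n) (suc r) = begin
    H (suc n) (suc r) * (⟦ suc n ⟧! * ⟦ suc r ⟧!) ≡⟨ cong (_* (⟦ suc n ⟧! * ⟦ suc r ⟧!)) (H-last n r) ⟩
    (H n (suc r) + q ^ suc n * H (suc n) r) * (⟦ suc n ⟧! * ⟦ suc r ⟧!)
      ≡⟨ re (H n (suc r)) (q ^ suc n) (H (suc n) r) ⟦ suc n ⟧ ⟦ n ⟧! ⟦ suc r ⟧ ⟦ r ⟧! ⟩
    ⟦ suc n ⟧ * (H n (suc r) * (⟦ n ⟧! * ⟦ suc r ⟧!)) + q ^ suc n * ⟦ suc r ⟧ * (H (suc n) r * (⟦ suc n ⟧! * ⟦ r ⟧!))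
      ≡⟨ cong₂ (λ x y → ⟦ suc n ⟧ * x + q ^ suc n * ⟦ suc r ⟧ * y) (trans (H-factorial n (suc r)) (cong ⟦_⟧! (+-suc n r))) (H-factorial (suc n) r) ⟩
    ⟦ suc n ⟧ * ⟦ suc (n + r) ⟧! + q ^ suc n * ⟦ suc r ⟧ * ⟦ suc n + r ⟧!
      ≡⟨ sym (*-distribʳ-+ ⟦ suc (n + r) ⟧! ⟦ suc n ⟧ _) ⟩
    (⟦ suc n ⟧ + q ^ suc n * ⟦ suc r ⟧) * ⟦ suc (n + r) ⟧!
      ≡⟨ cong₂ _*_ (sym (⟦+⟧ (suc n) (suc r))) (cong ⟦_⟧! (sym (+-suc n r))) ⟩
    ⟦ suc n + suc r ⟧ * ⟦ n + suc r ⟧! ∎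
    where
    open ≡-Reasoning
    re : ∀ a x b n n! r r! → (a + x * b) * (n * n! * (r * r!)) ≡ n * (a * (n! * (r * r!))) + x * r * (b * (n * n! * r!))
    re = solve-∀

-- Insertion of copies of a new largest letter

shuf : ℕ → ℕ → Word → List Word
shuf zero    m p       = [ p ]
shuf (suc r) m []      = map (m ∷_) (shuf r m [])
shuf (suc r) m (x ∷ p) = map (m ∷_) (shuf r m (x ∷ p)) ++ map (x ∷_) (shuf (suc r) m p)

∑-shuf : ∀ r m p w → w ∈ shuf r m p → ∀ f → ∑ w f ≡ ∑ p f + r * f m
∑-shuf zero    m p       .p (here refl) f = sym (+-identityʳ _)
∑-shuf (suc r) m []      w w∈ f with ∈-map⁻ (m ∷_) w∈
... | w′ , w′∈ , refl = cong (f m +_) (∑-shuf r m [] w′ w′∈ f)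
∑-shuf (suc r) m (x ∷ p) w w∈ f with ∈-++⁻ (map (m ∷_) (shuf r m (x ∷ p))) w∈
... | inj₁ w∈₁ with ∈-map⁻ (m ∷_) w∈₁
...   | w′ , w′∈ , refl = trans (cong (f m +_) (∑-shuf r m (x ∷ p) w′ w′∈ f)) (+-exchange (f m) (∑ (x ∷ p) f) (r * f m))
∑-shuf (suc r) m (x ∷ p) w w∈ f | inj₂ w∈₂ with ∈-map⁻ (x ∷_) w∈₂
... | w′ , w′∈ , refl = trans (cong (f x +_) (∑-shuf (suc r) m p w′ w′∈ f)) (sym (+-assoc (f x) _ _))

shuf-≤ : ∀ r m p → All (_< m) p → ∀ w → w ∈ shuf r m p → All (_≤ m) w
shuf-≤ zero    m p       a .p (here refl) = All.map <⇒≤ a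
shuf-≤ (suc r) m []      a w w∈ with ∈-map⁻ (m ∷_) w∈
... | w′ , w′∈ , refl = ≤-refl ∷ shuf-≤ r m [] a w′ w′∈
shuf-≤ (suc r) m (x ∷ p) (x<m ∷ a) w w∈ with ∈-++⁻ (map (m ∷_) (shuf r m (x ∷ p))) w∈
... | inj₁ w∈₁ with ∈-map⁻ (m ∷_) w∈₁
...   | w′ , w′∈ , refl = ≤-refl ∷ shuf-≤ r m (x ∷ p) (x<m ∷ a) w′ w′∈
shuf-≤ (suc r) m (x ∷ p) (x<m ∷ a) w w∈ | inj₂ w∈₂ with ∈-map⁻ (x ∷_) w∈₂
... | w′ , w′∈ , refl = <⇒≤ x<m ∷ shuf-≤ (suc r) m p a w′ w′∈

-- MAK and MAD are both of the following shape (on reversed words): a descent from y down to x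
-- costs b x i - g y plus the number of letters left of it in (x, y], where i is the number of
-- letters x to its left.  The label of a letter x is the increase of the cost when a new largest
-- letter is inserted just before x.
module Cost (b : ℕ → ℕ → ℕ) (g : ℕ → ℕ) where

  B : ℕ → Word → ℕ
  B x p = b x (cnt (_≡ᵇ x) p)

  top : ℕ → Word → ℕ
  top x p = B x p + cnt (x <ᵇ_) p

  desc : ℕ → Word → ℕ
  desc x []      = 0
  desc x (y ∷ p) = if x <ᵇ y then (B x p ∸ g y) + cnt (λ a → (x <ᵇ a) ∧ (a ≤ᵇ y)) p else 0

  label : ℕ → Word → ℕ
  label x []      = top x []
  label x (y ∷ p) = if x <ᵇ y then g y + suc (cnt (y <ᵇ_) p) else top x (y ∷ p)

  cost : Word → ℕ
  cost []      = 0
  cost (x ∷ p) = desc x p + cost p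

  labels : Word → List ℕ
  labels []      = []
  labels (x ∷ p) = label x p ∷ labels p

  -- A larger letter put between y and x replaces the descent from y by one that costs `top x p`,
  -- and the label is the difference. The letters above x split into those up to y and those beyond;
  -- the `suc` in `label` accounts for y itself.
  desc+label : (∀ {x y} i → x < y → g y ≤ b x i) → ∀ x p → desc x p + label x p ≡ top x p
  desc+label g≤b x []      = refl
  desc+label g≤b x (y ∷ p) with x <ᵇ y | <ᵇ-dec x y
  ... | _ | isnt _ = refl
  ... | _ | is x<y rewrite ≡ᵇ-false (>⇒≢ x<y) = begin
      (B x p ∸ g y) + cnt (λ a → (x <ᵇ a) ∧ (a ≤ᵇ y)) p + (g y + suc (cnt (y <ᵇ_) p))
        ≡⟨ re (B x p ∸ g y) _ (g y) _ ⟩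
      (B x p ∸ g y) + g y + suc (cnt (λ a → (x <ᵇ a) ∧ (a ≤ᵇ y)) p + cnt (y <ᵇ_) p)
        ≡⟨ cong₂ (λ u v → u + suc v) (m∸n+n≡m (g≤b (cnt (_≡ᵇ x) p) x<y)) (trans (sym (∑-+ p _ _)) (∑-cong p above)) ⟩
      B x p + suc (cnt (x <ᵇ_) p) ∎
    where
    open ≡-Reasoning
    re : ∀ a c g d → a + c + (g + suc d) ≡ a + g + suc (c + d)
    re = solve-∀
    above : ∀ a → ind ((x <ᵇ a) ∧ (a ≤ᵇ y)) + ind (y <ᵇ a) ≡ ind (x <ᵇ a)
    above a with y <ᵇ a | <ᵇ-dec y a
    ... | _ | is y<a rewrite ≤ᵇ-false y<a | <ᵇ-true (<-trans x<y y<a) = refl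
    ... | _ | isnt a≤y rewrite ≤ᵇ-true a≤y with x <ᵇ a
    ...   | true  = refl
    ...   | false = refl

steps : (ℕ → ℕ) → ℕ → List ℕ
steps μ zero    = []
steps μ (suc r) = μ r ∷ steps μ r

module Twist (q : ℕ) where
  open Elementary q

  -- Dual to multiplication by ∏ (1 + q^ℓ z), as `scale δ` is dual to the substitution z ↦ q^δ z.
  absorb : List ℕ → (ℕ → ℕ) → ℕ → ℕ
  absorb []       c = c
  absorb (ℓ ∷ ls) c = absorb ls (c ⊕ ℓ)

  scale : ℕ → (ℕ → ℕ) → ℕ → ℕ
  scale δ c l = q ^ (δ * l) * c l

  absorb-suc : ∀ ls c l → absorb ls (c ∘ suc) l ≡ absorb ls c (suc l)
  absorb-suc []       c l = refl
  absorb-suc (ℓ ∷ ls) c l = absorb-suc ls (c ⊕ ℓ) l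

  elem-absorb : ∀ ls ls′ c → elem ls (absorb ls′ c) ≡ elem (ls′ ++ ls) c
  elem-absorb ls []        c = refl
  elem-absorb ls (ℓ ∷ ls′) c = trans (elem-absorb ls ls′ (c ⊕ ℓ)) (sym (elem-∷ ℓ (ls′ ++ ls) c))

  elem-scale : ∀ δ ls c → elem ls (scale δ c) ≡ elem (map (δ +_) ls) c
  elem-scale δ []       c = trans (cong (λ y → q ^ y * c 0) (*-zeroʳ δ)) (*-identityˡ (c 0))
  elem-scale δ (ℓ ∷ ls) c = cong₂ _+_ (elem-scale δ ls c) (begin
    q ^ ℓ * elem ls (scale δ c ∘ suc)
      ≡⟨ cong (q ^ ℓ *_) (trans (elem-cong ls (λ l → trans (cong (_* c (suc l)) (trans (cong (q ^_) (*-suc δ l)) (^-distribˡ-+-* q δ (δ * l)))) (*-assoc (q ^ δ) _ _))) (elem-* ls (q ^ δ) (scale δ (c ∘ suc)))) ⟩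
    q ^ ℓ * (q ^ δ * elem ls (scale δ (c ∘ suc))) ≡⟨ re (q ^ ℓ) (q ^ δ) _ ⟩
    q ^ δ * q ^ ℓ * elem ls (scale δ (c ∘ suc)) ≡⟨ cong₂ _*_ (sym (^-distribˡ-+-* q δ ℓ)) (elem-scale δ ls (c ∘ suc)) ⟩
    q ^ (δ + ℓ) * elem (map (δ +_) ls) (c ∘ suc) ∎)
    where
    open ≡-Reasoning
    re : ∀ a b c → a * (b * c) ≡ b * a * c
    re = solve-∀

-- The unprimed data belong to the old word, the primed ones to the enlarged word. All old values
-- rise by the same δ, which cancels in every old descent but shifts every surviving old label; μ i
-- is the label of a new letter with i others to its left.
module Insertion (q m : ℕ) (b b′ : ℕ → ℕ → ℕ) (g g′ : ℕ → ℕ) (δ : ℕ) (μ : ℕ → ℕ)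
  (b-new : ∀ {x} i → x < m → b′ x i ≡ b x i + δ)
  (g-new : ∀ {y} → y < m → g′ y ≡ g y + δ)
  (b-top : ∀ i → b′ m i ≡ μ i)
  (g-top : g′ m ≡ δ)
  (g≤b : ∀ {x y} i → x < y → g y ≤ b x i) where

  open Elementary q
  open Twist q
  open Cost b g
  module New = Cost b′ g′

  -- Supplies what `F` leaves out: the labels of the r new letters and the shift of the old labels
  -- by δ. The further shift by the number of new letters to the left comes from the substitution y
  -- ↦ q y in `Op`.
  C : ℕ → (ℕ → ℕ) → ℕ → ℕ
  C r c = scale δ (absorb (steps μ r) c)

  C-suc : ∀ r c l → C r c (suc l) ≡ q ^ δ * C r (c ∘ suc) l
  C-suc r c l = trans (cong₂ _*_ (trans (cong (q ^_) (*-suc δ l)) (^-distribˡ-+-* q δ (δ * l))) (sym (absorb-suc (steps μ r) c l)))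
    (*-assoc (q ^ δ) _ _)

  weight : Word → (ℕ → ℕ) → ℕ
  weight w c = q ^ New.cost w * elem (New.labels w) c

  -- In `A` the last letter stays last, in `U` new letters may follow it; the corresponding series
  -- are `F` and `partial F`.
  A U : Word → ℕ → (ℕ → ℕ) → ℕ
  U p r c = ∑ (shuf r m p) (λ w → weight w c)
  A [] r c = 0
  A (x ∷ p) r c = ∑ (shuf r m p) (λ w → weight (x ∷ w) c)

  cnt-shuf : ∀ r p w → w ∈ shuf r m p → ∀ f → f m ≡ false → cnt f w ≡ cnt f p
  cnt-shuf r p w w∈ f fm = trans (∑-shuf r m p w w∈ (ind ∘ f)) (trans (cong (λ y → cnt f p + r * ind y) fm) (trans (cong (cnt f p +_) (*-zeroʳ r)) (+-identityʳ _)))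

  cnt-shuf+ : ∀ r p w → w ∈ shuf r m p → ∀ f → f m ≡ true → cnt f w ≡ cnt f p + r
  cnt-shuf+ r p w w∈ f fm = trans (∑-shuf r m p w w∈ (ind ∘ f)) (trans (cong (λ y → cnt f p + r * ind y) fm) (cong (cnt f p +_) (*-identityʳ r)))

  B-new : ∀ {x} r p w → x < m → w ∈ shuf r m p → New.B x w ≡ B x p + δ
  B-new {x} r p w x<m w∈ = trans (cong (b′ x) (cnt-shuf r p w w∈ (_≡ᵇ x) (≡ᵇ-false (>⇒≢ x<m)))) (b-new _ x<m)

  weight-m : ∀ r p → All (_< m) p → ∀ w → w ∈ shuf r m p → ∀ c → weight (m ∷ w) c ≡ weight w (c ⊕ μ r)
  weight-m r p a w w∈ c = trans (cong₂ (λ x y → q ^ (x + New.cost w) * elem (y ∷ New.labels w) c) (desc-m w (shuf-≤ r m p a w w∈)) (label-m w (shuf-≤ r m p a w w∈)))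
      (cong (q ^ New.cost w *_) (elem-∷ (μ r) (New.labels w) c))
    where
    desc-m : ∀ w → All (_≤ m) w → New.desc m w ≡ 0
    desc-m []      _         = refl
    desc-m (y ∷ w) (y≤m ∷ _) rewrite <ᵇ-false y≤m = refl
    cnt-m : cnt (_≡ᵇ m) w ≡ r
    cnt-m = trans (cnt-shuf+ r p w w∈ (_≡ᵇ m) (≡ᵇ-refl m)) (cong (_+ r) (cnt-none (_≡ᵇ m) p (All.map (λ x<m → ≡ᵇ-false (<⇒≢ x<m)) a)))
    top-m : ∀ w → All (_≤ m) w → New.top m w ≡ New.B m w
    top-m w a = trans (cong (New.B m w +_) (cnt-none (m <ᵇ_) w (All.map <ᵇ-false a))) (+-identityʳ _)
    label-top : ∀ w → All (_≤ m) w → New.label m w ≡ New.top m w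
    label-top []      _         = refl
    label-top (y ∷ w) (y≤m ∷ _) rewrite <ᵇ-false y≤m = refl
    label-m : ∀ v → All (_≤ m) v → New.label m w ≡ μ r
    label-m _ _ = trans (label-top w (shuf-≤ r m p a w w∈)) (trans (top-m w (shuf-≤ r m p a w w∈)) (trans (cong (b′ m) cnt-m) (b-top r)))

  U-m : ∀ r p → All (_< m) p → ∀ c → ∑ (shuf r m p) (λ w → weight (m ∷ w) c) ≡ U p r (c ⊕ μ r)
  U-m r p a c = ∑-cong-∈ (shuf r m p) (λ w w∈ → weight-m r p a w w∈ c)

  weight-∷ : ∀ x w s ℓ c → New.desc x w ≡ s → New.label x w ≡ ℓ → weight (x ∷ w) c ≡ q ^ s * (weight w c + q ^ ℓ * weight w (c ∘ suc))
  weight-∷ x w s ℓ c refl refl = trans (cong (_* elem (New.labels (x ∷ w)) c) (^-distribˡ-+-* q (New.desc x w) (New.cost w)))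
      (re (q ^ New.desc x w) (q ^ New.cost w) (elem (New.labels w) c) (q ^ New.label x w) _)
    where
    re : ∀ a b x y z → a * b * (x + y * z) ≡ a * (b * x + y * (b * z))
    re = solve-∀

  -- A new letter now stands just before x. The descent costs `top x p` and one more for each of the
  -- r other copies, while δ cancels against `g′ m`. As nothing exceeds m, the label of x becomes δ
  -- + 1.
  topped : ∀ x r p → x < m → All (_< m) p → ∀ c →
    ∑ (shuf r m p) (λ w → weight (x ∷ m ∷ w) c)
      ≡ q ^ (top x p + r) * (U p r (c ⊕ μ r) + q ^ (δ + 1) * U p r ((c ∘ suc) ⊕ μ r))
  topped x r p x<m a c = begin
    ∑ (shuf r m p) (λ w → weight (x ∷ m ∷ w) c)
      ≡⟨ ∑-cong-∈ (shuf r m p) (λ w w∈ → weight-∷ x (m ∷ w) (top x p + r) (δ + 1) c (desc-x w w∈) (label-x w w∈)) ⟩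
    ∑ (shuf r m p) (λ w → q ^ (top x p + r) * (weight (m ∷ w) c + q ^ (δ + 1) * weight (m ∷ w) (c ∘ suc)))
      ≡⟨ trans (∑-*ˡ (shuf r m p) (q ^ (top x p + r)) _) (cong (q ^ (top x p + r) *_) (trans (∑-+ (shuf r m p) _ _)
           (cong₂ _+_ (U-m r p a c) (trans (∑-*ˡ (shuf r m p) (q ^ (δ + 1)) _) (cong (q ^ (δ + 1) *_) (U-m r p a (c ∘ suc))))))) ⟩
    q ^ (top x p + r) * (U p r (c ⊕ μ r) + q ^ (δ + 1) * U p r ((c ∘ suc) ⊕ μ r)) ∎
    where
    open ≡-Reasoning
    between : ∀ w → All (_≤ m) w → cnt (λ a → (x <ᵇ a) ∧ (a ≤ᵇ m)) w ≡ cnt (x <ᵇ_) w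
    between w a = ∑-cong-∈ w (λ y y∈ → cong ind (trans (cong ((x <ᵇ y) ∧_) (≤ᵇ-true (All.lookup a y∈))) (∧-identityʳ (x <ᵇ y))))
    desc-x : ∀ w → w ∈ shuf r m p → New.desc x (m ∷ w) ≡ top x p + r
    desc-x w w∈ rewrite <ᵇ-true x<m = begin
      (New.B x w ∸ g′ m) + cnt (λ a → (x <ᵇ a) ∧ (a ≤ᵇ m)) w
        ≡⟨ cong₂ _+_ (trans (cong₂ _∸_ (B-new r p w x<m w∈) g-top) (m+n∸n≡m (B x p) δ))
             (trans (between w (shuf-≤ r m p a w w∈)) (cnt-shuf+ r p w w∈ (x <ᵇ_) (<ᵇ-true x<m))) ⟩
      B x p + (cnt (x <ᵇ_) p + r) ≡⟨ sym (+-assoc (B x p) _ r) ⟩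
      top x p + r ∎
    label-x : ∀ w → w ∈ shuf r m p → New.label x (m ∷ w) ≡ δ + 1
    label-x w w∈ rewrite <ᵇ-true x<m | g-top | cnt-none (m <ᵇ_) w (All.map <ᵇ-false (shuf-≤ r m p a w w∈)) = refl

  -- The neighbour of x is unchanged. The cost stays, because δ cancels and no new letter lies in
  -- (x, y]; each of the r new letters, all to the left, raises the label by one.
  untopped : ∀ x y r p → x < m → y < m → ∀ c →
    ∑ (shuf r m p) (λ w → weight (x ∷ y ∷ w) c)
      ≡ q ^ desc x (y ∷ p) * (A (y ∷ p) r c + q ^ (label x (y ∷ p) + (δ + r)) * A (y ∷ p) r (c ∘ suc))
  untopped x y r p x<m y<m c = begin
    ∑ (shuf r m p) (λ w → weight (x ∷ y ∷ w) c)
      ≡⟨ ∑-cong-∈ (shuf r m p) (λ w w∈ → weight-∷ x (y ∷ w) (desc x (y ∷ p)) (label x (y ∷ p) + (δ + r)) c (desc-x w w∈) (label-x w w∈)) ⟩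
    ∑ (shuf r m p) (λ w → q ^ desc x (y ∷ p) * (weight (y ∷ w) c + q ^ (label x (y ∷ p) + (δ + r)) * weight (y ∷ w) (c ∘ suc)))
      ≡⟨ trans (∑-*ˡ (shuf r m p) (q ^ desc x (y ∷ p)) _) (cong (q ^ desc x (y ∷ p) *_) (trans (∑-+ (shuf r m p) _ _)
           (cong (A (y ∷ p) r c +_) (∑-*ˡ (shuf r m p) (q ^ (label x (y ∷ p) + (δ + r))) _)))) ⟩
    q ^ desc x (y ∷ p) * (A (y ∷ p) r c + q ^ (label x (y ∷ p) + (δ + r)) * A (y ∷ p) r (c ∘ suc)) ∎
    where
    open ≡-Reasoning
    desc-x : ∀ w → w ∈ shuf r m p → New.desc x (y ∷ w) ≡ desc x (y ∷ p)
    desc-x w w∈ with x <ᵇ y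
    ... | false = refl
    ... | true  = cong₂ _+_ (trans (cong₂ _∸_ (trans (B-new r p w x<m w∈) (+-comm _ δ)) (trans (g-new y<m) (+-comm _ δ))) ([m+n]∸[m+o]≡n∸o δ (B x p) (g y)))
        (cnt-shuf r p w w∈ (λ a → (x <ᵇ a) ∧ (a ≤ᵇ y)) (trans (cong ((x <ᵇ m) ∧_) (≤ᵇ-false y<m)) (∧-zeroʳ (x <ᵇ m))))
    label-x : ∀ w → w ∈ shuf r m p → New.label x (y ∷ w) ≡ label x (y ∷ p) + (δ + r)
    label-x w w∈ with x <ᵇ y | <ᵇ-dec x y
    ... | _ | is x<y = trans (cong₂ (λ u v → u + suc v) (g-new y<m) (cnt-shuf+ r p w w∈ (y <ᵇ_) (<ᵇ-true y<m))) (re (g y) δ _ r)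
      where
      re : ∀ a d c r → a + d + suc (c + r) ≡ a + suc c + (d + r)
      re = solve-∀
    ... | _ | isnt _ = trans (cong₂ _+_ (trans (cong (b′ x) (cong (ind (y ≡ᵇ x) +_) (cnt-shuf r p w w∈ (_≡ᵇ x) (≡ᵇ-false (>⇒≢ x<m))))) (b-new _ x<m))
                                    (cnt-shuf+ r p w w∈ (x <ᵇ_) (<ᵇ-true x<m)))
                         (+-interchange (B x (y ∷ p)) δ _ r)

  F-C-suc : ∀ ls r k c → q ^ δ * F ls r (C k (c ∘ suc)) ≡ F ls r (C k c ∘ suc)
  F-C-suc ls r k c = sym (trans (F-cong ls r (C-suc k c)) (F-* ls r (q ^ δ) (C k (c ∘ suc))))

  partial-C-suc : ∀ ls r k c → q ^ δ * partial (F ls) r (C k (c ∘ suc)) ≡ partial (F ls) r (C k c ∘ suc)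
  partial-C-suc ls r k c = sym (trans (partial-cong ls r (C-suc k c)) (partial-* ls r (q ^ δ) (C k (c ∘ suc))))

  -- In the mutual induction, a new letter just before x yields the partial-sum part of `Op-suc`,
  -- and an unchanged neighbour yields its remaining term together with the series of the other
  -- labels. Their sum is the recursion of `F`.
  U-closed : ∀ p → All (_< m) p → ∀ r c → U p r c ≡ q ^ cost p * partial (F (labels p)) r (C r c)
  A-closed : ∀ x p → All (_< m) (x ∷ p) → ∀ r c → A (x ∷ p) r c ≡ q ^ cost (x ∷ p) * F (labels (x ∷ p)) r (C r c)
  topped-closed : ∀ x p → All (_< m) (x ∷ p) → ∀ r c →
    ∑ (shuf r m p) (λ w → weight (x ∷ m ∷ w) c) ≡ q ^ cost (x ∷ p) * (q ^ label x p * (q ^ r * (partial (F (labels p)) r (C (suc r) c) + q * partial (F (labels p)) r (C (suc r) c ∘ suc))))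
  untopped-closed : ∀ x y p → All (_< m) (x ∷ y ∷ p) → ∀ r c →
    ∑ (shuf r m p) (λ w → weight (x ∷ y ∷ w) c) ≡ q ^ cost (x ∷ y ∷ p) * (F (labels (y ∷ p)) r (C r c) + q ^ label x (y ∷ p) * (q ^ r * F (labels (y ∷ p)) r (C r c ∘ suc)))

  U-closed [] a zero c = trans (+-identityʳ _) (cong (1 *_) (sym (trans (cong (λ y → q ^ y * c 0) (*-zeroʳ δ)) (*-identityˡ (c 0)))))
  U-closed (x ∷ p) a zero    c = A-closed x p a zero c
  U-closed []      a (suc r) c = begin
    ∑ (map (m ∷_) (shuf r m [])) (λ w → weight w c) ≡⟨ trans (∑-map (m ∷_) (shuf r m []) _) (U-m r [] a c) ⟩
    U [] r (c ⊕ μ r) ≡⟨ U-closed [] a r (c ⊕ μ r) ⟩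
    1 * partial one r (C (suc r) c) ≡⟨ cong (1 *_) (sym (+-identityʳ _)) ⟩
    1 * (partial one r (C (suc r) c) + 0) ∎
    where open ≡-Reasoning
  U-closed (x ∷ p) a (suc r) c = begin
    ∑ (map (m ∷_) (shuf r m (x ∷ p)) ++ map (x ∷_) (shuf (suc r) m p)) (λ w → weight w c)
      ≡⟨ ∑-++ (map (m ∷_) (shuf r m (x ∷ p))) _ _ ⟩
    ∑ (map (m ∷_) (shuf r m (x ∷ p))) (λ w → weight w c) + ∑ (map (x ∷_) (shuf (suc r) m p)) (λ w → weight w c)
      ≡⟨ cong₂ _+_ (trans (∑-map (m ∷_) (shuf r m (x ∷ p)) _) (trans (U-m r (x ∷ p) a c) (U-closed (x ∷ p) a r (c ⊕ μ r))))
                   (trans (∑-map (x ∷_) (shuf (suc r) m p) _) (A-closed x p a (suc r) c)) ⟩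
    q ^ cost (x ∷ p) * partial (F (labels (x ∷ p))) r (C (suc r) c) + q ^ cost (x ∷ p) * F (labels (x ∷ p)) (suc r) (C (suc r) c)
      ≡⟨ sym (*-distribˡ-+ (q ^ cost (x ∷ p)) _ _) ⟩
    q ^ cost (x ∷ p) * partial (F (labels (x ∷ p))) (suc r) (C (suc r) c) ∎
    where open ≡-Reasoning

  A-closed x [] (x<m ∷ []) zero c = begin
    1 * (c 0 + q ^ New.top x [] * c 1) + 0 ≡⟨ cong (λ y → 1 * (c 0 + y * c 1) + 0) (trans (cong (q ^_) ℓ-new) (^-distribˡ-+-* q (top x []) δ)) ⟩
    1 * (c 0 + q ^ top x [] * q ^ δ * c 1) + 0
      ≡⟨ re (c 0) (q ^ top x []) (q ^ δ) (c 1) ⟩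
    1 * (1 * c 0 + q ^ top x [] * (q ^ δ * c 1))
      ≡⟨ cong₂ (λ u v → 1 * (q ^ u * c 0 + q ^ top x [] * (q ^ v * c 1))) (sym (*-zeroʳ δ)) (sym (*-identityʳ δ)) ⟩
    1 * (q ^ (δ * 0) * c 0 + q ^ top x [] * (q ^ (δ * 1) * c 1)) ∎
    where
    open ≡-Reasoning
    ℓ-new : New.top x [] ≡ top x [] + δ
    ℓ-new = trans (cong (_+ 0) (b-new 0 x<m)) (re′ (b x 0) δ)
      where
      re′ : ∀ a d → a + d + 0 ≡ a + 0 + d
      re′ = solve-∀
    re : ∀ a l d e → 1 * (a + l * d * e) + 0 ≡ 1 * (1 * a + l * (d * e))
    re = solve-∀
  A-closed x [] a (suc r) c = begin
    ∑ (map (m ∷_) (shuf r m [])) (λ w → weight (x ∷ w) c)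
      ≡⟨ trans (∑-map (m ∷_) (shuf r m []) _) (topped-closed x [] a r c) ⟩
    q ^ cost (x ∷ []) * (q ^ label x [] * (q ^ r * (partial one r (C (suc r) c) + q * partial one r (C (suc r) c ∘ suc))))
      ≡⟨ cong (λ y → q ^ cost (x ∷ []) * (q ^ label x [] * y)) (sym (trans (Op-suc one r (C (suc r) c)) (cong (_+ q ^ r * (partial one r (C (suc r) c) + q * partial one r (C (suc r) c ∘ suc))) (*-zeroʳ (q ^ suc r))))) ⟩
    q ^ cost (x ∷ []) * (q ^ label x [] * Op one (suc r) (C (suc r) c)) ∎
    where open ≡-Reasoning
  A-closed x (y ∷ p) a zero c = trans (untopped-closed x y p a zero c)
    (cong (λ z → q ^ cost (x ∷ y ∷ p) * (F (labels (y ∷ p)) 0 (C 0 c) + q ^ label x (y ∷ p) * z)) (*-identityˡ _))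
  A-closed x (y ∷ p) a (suc r) c = begin
    ∑ (map (m ∷_) (shuf r m (y ∷ p)) ++ map (y ∷_) (shuf (suc r) m p)) (λ w → weight (x ∷ w) c)
      ≡⟨ trans (∑-++ (map (m ∷_) (shuf r m (y ∷ p))) _ _) (cong₂ _+_ (∑-map (m ∷_) (shuf r m (y ∷ p)) _) (∑-map (y ∷_) (shuf (suc r) m p) _)) ⟩
    ∑ (shuf r m (y ∷ p)) (λ w → weight (x ∷ m ∷ w) c) + ∑ (shuf (suc r) m p) (λ w → weight (x ∷ y ∷ w) c)
      ≡⟨ cong₂ _+_ (topped-closed x (y ∷ p) a r c) (untopped-closed x y p a (suc r) c) ⟩
    k * (ℓ * (q ^ r * S)) + k * (F ls (suc r) c′ + ℓ * (q ^ suc r * F ls (suc r) (c′ ∘ suc)))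
      ≡⟨ re k ℓ (q ^ r * S) (F ls (suc r) c′) (q ^ suc r * F ls (suc r) (c′ ∘ suc)) ⟩
    k * (F ls (suc r) c′ + ℓ * (q ^ suc r * F ls (suc r) (c′ ∘ suc) + q ^ r * S))
      ≡⟨ cong (λ y → k * (F ls (suc r) c′ + ℓ * y)) (sym (Op-suc (F ls) r c′)) ⟩
    k * (F ls (suc r) c′ + ℓ * Op (F ls) (suc r) c′) ∎
    where
    open ≡-Reasoning
    k ℓ S : ℕ
    k = q ^ cost (x ∷ y ∷ p)
    ℓ = q ^ label x (y ∷ p)
    ls : List ℕ
    ls = labels (y ∷ p)
    c′ : ℕ → ℕ
    c′ = C (suc r) c
    S = partial (F ls) r c′ + q * partial (F ls) r (c′ ∘ suc)
    re : ∀ k l s f t → k * (l * s) + k * (f + l * t) ≡ k * (f + l * (t + s))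
    re = solve-∀

  topped-closed x p (x<m ∷ a) r c = begin
    ∑ (shuf r m p) (λ w → weight (x ∷ m ∷ w) c) ≡⟨ topped x r p x<m a c ⟩
    q ^ (top x p + r) * (U p r (c ⊕ μ r) + q ^ (δ + 1) * U p r ((c ∘ suc) ⊕ μ r))
      ≡⟨ cong₂ (λ u v → q ^ (top x p + r) * (u + q ^ (δ + 1) * v)) (U-closed p a r (c ⊕ μ r)) (U-closed p a r ((c ∘ suc) ⊕ μ r)) ⟩
    q ^ (top x p + r) * (q ^ cost p * P c′ + q ^ (δ + 1) * (q ^ cost p * P (C (suc r) (c ∘ suc))))
      ≡⟨ cong₂ (λ u v → u * (q ^ cost p * P c′ + v * (q ^ cost p * P (C (suc r) (c ∘ suc)))))
           (trans (cong (λ y → q ^ (y + r)) (sym (desc+label g≤b x p))) (trans (^-distribˡ-+-* q (desc x p + label x p) r) (cong (_* q ^ r) (^-distribˡ-+-* q (desc x p) (label x p)))))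
           (trans (^-distribˡ-+-* q δ 1) (cong (q ^ δ *_) (*-identityʳ q))) ⟩
    q ^ desc x p * q ^ label x p * q ^ r * (q ^ cost p * P c′ + q ^ δ * q * (q ^ cost p * P (C (suc r) (c ∘ suc))))
      ≡⟨ re (q ^ desc x p) (q ^ label x p) (q ^ r) (q ^ cost p) (P c′) (q ^ δ) q (P (C (suc r) (c ∘ suc))) ⟩
    q ^ desc x p * q ^ cost p * (q ^ label x p * (q ^ r * (P c′ + q * (q ^ δ * P (C (suc r) (c ∘ suc))))))
      ≡⟨ cong₂ (λ u v → u * (q ^ label x p * (q ^ r * (P c′ + q * v)))) (sym (^-distribˡ-+-* q (desc x p) (cost p))) (partial-C-suc (labels p) r (suc r) c) ⟩
    q ^ cost (x ∷ p) * (q ^ label x p * (q ^ r * (P c′ + q * P (c′ ∘ suc)))) ∎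
    where
    open ≡-Reasoning
    P : (ℕ → ℕ) → ℕ
    P = partial (F (labels p)) r
    c′ : ℕ → ℕ
    c′ = C (suc r) c
    re : ∀ s l r k u d q v → s * l * r * (k * u + d * q * (k * v)) ≡ s * k * (l * (r * (u + q * (d * v))))
    re = solve-∀

  untopped-closed x y p (x<m ∷ y<m ∷ a) r c = begin
    ∑ (shuf r m p) (λ w → weight (x ∷ y ∷ w) c) ≡⟨ untopped x y r p x<m y<m c ⟩
    q ^ s * (A (y ∷ p) r c + q ^ (ℓ + (δ + r)) * A (y ∷ p) r (c ∘ suc))
      ≡⟨ cong₂ (λ u v → q ^ s * (u + q ^ (ℓ + (δ + r)) * v)) (A-closed y p (y<m ∷ a) r c) (A-closed y p (y<m ∷ a) r (c ∘ suc)) ⟩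
    q ^ s * (k * F ls r (C r c) + q ^ (ℓ + (δ + r)) * (k * F ls r (C r (c ∘ suc))))
      ≡⟨ cong (λ u → q ^ s * (k * F ls r (C r c) + u * (k * F ls r (C r (c ∘ suc))))) (trans (^-distribˡ-+-* q ℓ (δ + r)) (cong (q ^ ℓ *_) (^-distribˡ-+-* q δ r))) ⟩
    q ^ s * (k * F ls r (C r c) + q ^ ℓ * (q ^ δ * q ^ r) * (k * F ls r (C r (c ∘ suc))))
      ≡⟨ re (q ^ s) k (F ls r (C r c)) (q ^ ℓ) (q ^ δ) (q ^ r) (F ls r (C r (c ∘ suc))) ⟩
    q ^ s * k * (F ls r (C r c) + q ^ ℓ * (q ^ r * (q ^ δ * F ls r (C r (c ∘ suc)))))
      ≡⟨ cong₂ (λ u v → u * (F ls r (C r c) + q ^ ℓ * (q ^ r * v))) (sym (^-distribˡ-+-* q s (cost (y ∷ p)))) (F-C-suc ls r r c) ⟩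
    q ^ cost (x ∷ y ∷ p) * (F ls r (C r c) + q ^ ℓ * (q ^ r * F ls r (C r c ∘ suc))) ∎
    where
    open ≡-Reasoning
    s ℓ k : ℕ
    s = desc x (y ∷ p)
    ℓ = label x (y ∷ p)
    k = q ^ cost (y ∷ p)
    ls : List ℕ
    ls = labels (y ∷ p)
    re : ∀ s k u l d r v → s * (k * u + l * (d * r) * (k * v)) ≡ s * k * (u + l * (r * (d * v)))
    re = solve-∀

  -- Words of 𝒫_M end in their largest letter, so one copy is fixed at the end and the other r are
  -- inserted freely.
  insert-total : ∀ p → All (_< m) p → ∀ r c →
    ∑ (shuf r m p) (λ w → weight (m ∷ w) c) ≡ q ^ cost p * elem (labels p) (λ l → partial (power l) r (C (suc r) c))
  insert-total p a r c = trans (U-m r p a c) (trans (U-closed p a r (c ⊕ μ r)) (cong (q ^ cost p *_) (partial-elem (labels p) r (C (suc r) c))))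

-- Words built up by their largest letters, and the two cost families

-- ks lists the multiplicities of the letters from the largest to 1
insWords : List ℕ → List Word
insWords []       = [ [] ]
insWords (k ∷ ks) = concatMap (λ u → map (suc (length ks) ∷_) (shuf (pred k) (suc (length ks)) u)) (insWords ks)

∈insWords⁻ : ∀ k ks v → v ∈ insWords (k ∷ ks) →
  ∃ λ u → ∃ λ w → u ∈ insWords ks × w ∈ shuf (pred k) (suc (length ks)) u × v ≡ suc (length ks) ∷ w
∈insWords⁻ k ks v v∈ with find (∈-concatMap⁻ _ {xs = insWords ks} v∈)
... | u , u∈ , v∈u with ∈-map⁻ (suc (length ks) ∷_) v∈u
...   | w , w∈ , eq = u , w , u∈ , w∈ , eq

∈insWords⁺ : ∀ k ks u w → u ∈ insWords ks → w ∈ shuf (pred k) (suc (length ks)) u → suc (length ks) ∷ w ∈ insWords (k ∷ ks)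
∈insWords⁺ k ks u w u∈ w∈ = ∈-concatMap⁺ _ {xs = insWords ks} (lose u∈ (∈-map⁺ (suc (length ks) ∷_) w∈))

insWords-< : ∀ ks v → v ∈ insWords ks → All (_< suc (length ks)) v
insWords-< []       .[] (here refl) = []
insWords-< (k ∷ ks) v v∈ with ∈insWords⁻ k ks v v∈
... | u , w , u∈ , w∈ , refl = ≤-refl ∷ All.map s≤s (shuf-≤ (pred k) (suc (length ks)) u (insWords-< ks u u∈) w w∈)

length-shuf : ∀ r m u w → w ∈ shuf r m u → length w ≡ length u + r
length-shuf r m u w w∈ = trans (length-∑ w) (trans (∑-shuf r m u w w∈ (λ _ → 1)) (cong₂ _+_ (sym (length-∑ u)) (*-identityʳ r)))

insWords-length : ∀ ks → All (1 ≤_) ks → ∀ v → v ∈ insWords ks → length v ≡ sum ks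
insWords-length []       _        .[] (here refl) = refl
insWords-length (k ∷ ks) (1≤k ∷ a) v v∈ with ∈insWords⁻ k ks v v∈
... | u , w , u∈ , w∈ , refl = begin
    suc (length w) ≡⟨ cong suc (length-shuf (pred k) _ u w w∈) ⟩
    suc (length u + pred k) ≡⟨ sym (+-suc (length u) (pred k)) ⟩
    length u + suc (pred k) ≡⟨ cong₂ _+_ (insWords-length ks a u u∈) (suc-pred k {{>-nonZero 1≤k}}) ⟩
    sum ks + k ≡⟨ +-comm (sum ks) k ⟩
    k + sum ks ∎
  where open ≡-Reasoning

cost-cong : ∀ {b b′ g g′} → (∀ x i → b x i ≡ b′ x i) → (∀ y → g y ≡ g′ y) → ∀ v → Cost.cost b g v ≡ Cost.cost b′ g′ v
cost-cong {b} {b′} {g} {g′} hb hg []      = refl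
cost-cong {b} {b′} {g} {g′} hb hg (x ∷ []) = refl
cost-cong {b} {b′} {g} {g′} hb hg (x ∷ y ∷ p) = cong₂ _+_
  (cong₂ (λ u v → if x <ᵇ y then (u ∸ v) + cnt (λ a → (x <ᵇ a) ∧ (a ≤ᵇ y)) p else 0) (hb x _) (hg y)) (cost-cong hb hg (y ∷ p))

labels-cong : ∀ {b b′ g g′} → (∀ x i → b x i ≡ b′ x i) → (∀ y → g y ≡ g′ y) → ∀ v → Cost.labels b g v ≡ Cost.labels b′ g′ v
labels-cong hb hg []      = refl
labels-cong hb hg (x ∷ []) = cong (λ y → y + 0 ∷ []) (hb x 0)
labels-cong hb hg (x ∷ y ∷ p) = cong₂ _∷_
  (cong₂ (λ u v → if x <ᵇ y then v + suc (cnt (y <ᵇ_) p) else u + cnt (x <ᵇ_) (y ∷ p)) (hb x _) (hg y)) (labels-cong hb hg (y ∷ p))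

∑-replicate : ∀ r m u (f : ℕ → ℕ) → ∑ (replicate r m ++ u) f ≡ ∑ u f + r * f m
∑-replicate zero    m u f = sym (+-identityʳ _)
∑-replicate (suc r) m u f = trans (cong (f m +_) (∑-replicate r m u f)) (+-exchange (f m) (∑ u f) (r * f m))

-- δ and μ describe how b and g change when r + 1 letters m, larger than those of u, are added to u.
record Family : Set where
  field
    b : Word → ℕ → ℕ → ℕ
    g : Word → ℕ → ℕ
    δ : ℕ → ℕ
    μ : ℕ → ℕ → ℕ → ℕ
    b-count : ∀ {W W′} → (∀ f → ∑ W f ≡ ∑ W′ f) → ∀ x i → b W x i ≡ b W′ x i
    g-count : ∀ {W W′} → (∀ f → ∑ W f ≡ ∑ W′ f) → ∀ y → g W y ≡ g W′ y
    b-new : ∀ u m r → All (_< m) u → ∀ {x} i → x < m → b (replicate (suc r) m ++ u) x i ≡ b u x i + δ r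
    g-new : ∀ u m r → All (_< m) u → ∀ {y} → y < m → g (replicate (suc r) m ++ u) y ≡ g u y + δ r
    b-top : ∀ u m r → All (_< m) u → ∀ i → b (replicate (suc r) m ++ u) m i ≡ μ (length u) r i
    g-top : ∀ u m r → All (_< m) u → g (replicate (suc r) m ++ u) m ≡ δ r
    g≤b : ∀ u {x y} i → x < y → g u y ≤ b u x i
    μ-down : ∀ n r → steps (μ n r) (suc r) ++ map (δ r +_) (down n) ↭ down (n + suc r)

module FamilyTotal (q : ℕ) (𝓕 : Family) where
  open Family 𝓕
  open Elementary q
  open Twist q

  cost : Word → ℕ
  cost v = Cost.cost (b v) (g v) v

  labels : Word → List ℕ
  labels v = Cost.labels (b v) (g v) v

  total : List ℕ → ℕ
  total []       = 1
  total (k ∷ ks) = total ks * H (sum ks) (pred k)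

  -- The claim for every functional `c` makes the induction work: an insertion turns `c` into
  -- another functional `c′`, and the hypothesis for `c′` replaces the unknown labels of the words u
  -- by 1,...,N₀, where `F-down` gives a closed form. `μ-down` then assembles old and new labels
  -- into 1,...,N₀ + r + 1.
  family-total : ∀ ks → All (1 ≤_) ks → ∀ c →
    ∑ (insWords ks) (λ v → q ^ cost v * elem (labels v) c) ≡ total ks * elem (down (sum ks)) c
  family-total []       _         c = +-identityʳ _
  family-total (k ∷ ks) (1≤k ∷ a) c = begin
    ∑ (insWords (k ∷ ks)) (λ v → q ^ cost v * elem (labels v) c)
      ≡⟨ ∑-concatMap _ (insWords ks) _ ⟩
    ∑ (insWords ks) (λ u → ∑ (map (m ∷_) (shuf r m u)) (λ v → q ^ cost v * elem (labels v) c))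
      ≡⟨ ∑-cong-∈ (insWords ks) (λ u u∈ → trans (∑-map (m ∷_) (shuf r m u) _) (inserted u u∈)) ⟩
    ∑ (insWords ks) (λ u → q ^ cost u * elem (labels u) c′) ≡⟨ family-total ks a c′ ⟩
    total ks * elem (down N₀) c′
      ≡⟨ cong (total ks *_) (trans (sym (partial-elem (down N₀) r C′)) (trans (partial-down N₀ r C′)
           (cong (H N₀ r *_) (trans (elem-scale (δ r) (down N₀) _) (trans (elem-absorb (map (δ r +_) (down N₀)) (steps (μ N₀ r) (suc r)) c) (elem-↭ (μ-down N₀ r) c)))))) ⟩
    total ks * (H N₀ r * elem (down (N₀ + suc r)) c)
      ≡⟨ sym (*-assoc (total ks) _ _) ⟩
    total ks * H N₀ r * elem (down (N₀ + suc r)) c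
      ≡⟨ cong (λ y → total ks * H N₀ r * elem (down y) c) (trans (cong (N₀ +_) (suc-pred k {{>-nonZero 1≤k}})) (+-comm N₀ k)) ⟩
    total (k ∷ ks) * elem (down (k + N₀)) c ∎
    where
    open ≡-Reasoning
    m r N₀ : ℕ
    m = suc (length ks)
    r = pred k
    N₀ = sum ks
    C′ c′ : ℕ → ℕ
    C′ = scale (δ r) (absorb (steps (μ N₀ r) (suc r)) c)
    c′ l = partial (power l) r C′
    inserted : ∀ u → u ∈ insWords ks → ∑ (shuf r m u) (λ w → q ^ cost (m ∷ w) * elem (labels (m ∷ w)) c) ≡ q ^ cost u * elem (labels u) c′
    inserted u u∈ = trans (∑-cong-∈ (shuf r m u) (λ w w∈ → cong₂ (λ x y → q ^ x * elem y c)
          (cost-cong (b-count (same w w∈)) (g-count (same w w∈)) (m ∷ w)) (labels-cong (b-count (same w w∈)) (g-count (same w w∈)) (m ∷ w))))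
        (Ins.insert-total u small r c)
      where
      small : All (_< m) u
      small = insWords-< ks u u∈
      -- The parameters depend only on the content of a word, so one representative serves all
      -- insertions into u.
      W₀ : Word
      W₀ = replicate (suc r) m ++ u
      same : ∀ w → w ∈ shuf r m u → ∀ f → ∑ (m ∷ w) f ≡ ∑ W₀ f
      same w w∈ f = trans (cong (f m +_) (∑-shuf r m u w w∈ f)) (sym (cong (f m +_) (∑-replicate r m u f)))
      module Ins = Insertion q m (b u) (b W₀) (g u) (g W₀) (δ r) (μ N₀ r)
        (b-new u m r small) (g-new u m r small)
        (λ i → trans (b-top u m r small i) (cong (λ n → μ n r i) (insWords-length ks a u u∈)))
        (g-top u m r small) (g≤b u)

  insWords-total : ∀ ks → All (1 ≤_) ks → ∑ (insWords ks) (λ v → q ^ cost v) ≡ total ks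
  insWords-total ks a = begin
    ∑ (insWords ks) (λ v → q ^ cost v) ≡⟨ ∑-cong (insWords ks) (λ v → sym (trans (cong (q ^ cost v *_) (elem-unit (labels v))) (*-identityʳ _))) ⟩
    ∑ (insWords ks) (λ v → q ^ cost v * elem (labels v) unit) ≡⟨ family-total ks a unit ⟩
    total ks * elem (down (sum ks)) unit ≡⟨ trans (cong (total ks *_) (elem-unit (down (sum ks)))) (*-identityʳ _) ⟩
    total ks ∎
    where
    open ≡-Reasoning
    -- Evaluation at z = 0, which forgets the labels.
    unit : ℕ → ℕ
    unit zero    = 1
    unit (suc _) = 0
    elem-zero : ∀ ls → elem ls (λ _ → 0) ≡ 0
    elem-zero []       = refl
    elem-zero (ℓ ∷ ls) rewrite elem-zero ls = *-zeroʳ (q ^ ℓ)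
    elem-unit : ∀ ls → elem ls unit ≡ 1
    elem-unit []       = refl
    elem-unit (ℓ ∷ ls) = cong₂ _+_ (elem-unit ls) (trans (cong (q ^ ℓ *_) (elem-zero ls)) (*-zeroʳ (q ^ ℓ)))

cnt-∀ : ∀ f w → All (λ x → f x ≡ true) w → cnt f w ≡ length w
cnt-∀ f []      []      = refl
cnt-∀ f (x ∷ w) (e ∷ a) rewrite e = cong suc (cnt-∀ f w a)

cnt-replicate-false : ∀ r m u f → f m ≡ false → cnt f (replicate (suc r) m ++ u) ≡ cnt f u
cnt-replicate-false r m u f e = trans (∑-replicate (suc r) m u (ind ∘ f)) (trans (cong (λ y → cnt f u + suc r * ind y) e) (trans (cong (cnt f u +_) (*-zeroʳ (suc r))) (+-identityʳ _)))

cnt-replicate-true : ∀ r m u f → f m ≡ true → cnt f (replicate (suc r) m ++ u) ≡ cnt f u + suc r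
cnt-replicate-true r m u f e = trans (∑-replicate (suc r) m u (ind ∘ f)) (trans (cong (λ y → cnt f u + suc r * ind y) e) (cong (cnt f u +_) (*-identityʳ (suc r))))

-- `b x i` is the value of the copy of x that has i copies before it. The old labels stay, and the
-- new letters receive n + 1,...,n + r + 1.
makFamily : Family
makFamily = record
  { b = λ W x i → suc (cnt (_<ᵇ x) W) + i
  ; g = λ _ _ → 0
  ; δ = λ _ → 0
  ; μ = λ n _ i → suc n + i
  ; b-count = λ h x i → cong (λ y → suc y + i) (h (λ a → ind (a <ᵇ x)))
  ; g-count = λ _ _ → refl
  ; b-new = λ u m r a {x} i x<m → trans (cong (λ y → suc y + i) (cnt-replicate-false r m u (_<ᵇ x) (<ᵇ-false (<⇒≤ x<m)))) (sym (+-identityʳ _))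
  ; g-new = λ _ _ _ _ _ → refl
  ; b-top = λ u m r a i → cong (λ y → suc y + i) (trans (cnt-replicate-false r m u (_<ᵇ m) (<ᵇ-false (≤-refl {m}))) (cnt-∀ (_<ᵇ m) u (All.map <ᵇ-true a)))
  ; g-top = λ _ _ _ _ → refl
  ; g≤b = λ _ _ _ → z≤n
  ; μ-down = λ n r → Perm.↭-reflexive (trans (cong (steps (λ i → suc n + i) (suc r) ++_) (map-id (down n))) (aux n (suc r)))
  }
  where
  aux : ∀ n j → steps (λ i → suc n + i) j ++ down n ≡ down (n + j)
  aux n zero    = cong down (sym (+-identityʳ n))
  aux n (suc j) = trans (cong (suc n + j ∷_) (aux n j)) (cong down (sym (+-suc n j)))

-- `b x i - g y` is the height of y minus the value of x, both counted from the top so that larger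
-- letters raise them equally. The new letters receive the labels 1,...,r + 1 and push the old ones
-- up by r + 1.
madFamily : Family
madFamily = record
  { b = λ W x i → cnt (x <ᵇ_) W + (cnt (_≡ᵇ x) W ∸ i)
  ; g = λ W y → cnt (y ≤ᵇ_) W
  ; δ = suc
  ; μ = λ _ r i → suc r ∸ i
  ; b-count = λ h x i → cong₂ (λ y z → y + (z ∸ i)) (h (λ a → ind (x <ᵇ a))) (h (λ a → ind (a ≡ᵇ x)))
  ; g-count = λ h y → h (λ a → ind (y ≤ᵇ a))
  ; b-new = λ u m r a {x} i x<m → trans (cong₂ (λ y z → y + (z ∸ i)) (cnt-replicate-true r m u (x <ᵇ_) (<ᵇ-true x<m))
               (cnt-replicate-false r m u (_≡ᵇ x) (≡ᵇ-false (>⇒≢ x<m)))) (re (cnt (x <ᵇ_) u) (suc r) _)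
  ; g-new = λ u m r a {y} y<m → cnt-replicate-true r m u (y ≤ᵇ_) (≤ᵇ-true (<⇒≤ y<m))
  ; b-top = λ u m r a i → cong₂ (λ y z → y + (z ∸ i))
      (trans (cnt-replicate-false r m u (m <ᵇ_) (<ᵇ-false (≤-refl {m}))) (cnt-none (m <ᵇ_) u (All.map (λ x<m → <ᵇ-false (<⇒≤ x<m)) a)))
      (trans (cnt-replicate-true r m u (_≡ᵇ m) (≡ᵇ-refl m)) (cong (_+ suc r) (cnt-none (_≡ᵇ m) u (All.map (λ x<m → ≡ᵇ-false (<⇒≢ x<m)) a))))
  ; g-top = λ u m r a → trans (cnt-replicate-true r m u (m ≤ᵇ_) (≤ᵇ-true (≤-refl {m}))) (cong (_+ suc r) (cnt-none (m ≤ᵇ_) u (All.map (λ x<m → ≤ᵇ-false x<m) a)))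
  ; g≤b = λ u {x} {y} i x<y → ≤-trans (fewer u x<y) (m≤m+n _ _)
  ; μ-down = λ n r → Perm.↭-trans (↭.++-comm (steps (λ i → suc r ∸ i) (suc r)) (map (suc r +_) (down n)))
      (Perm.↭-trans (↭.++⁺ˡ (map (suc r +_) (down n)) (collect-all (suc r)))
        (Perm.↭-reflexive (shifted n (suc r))))
  }
  where
  re : ∀ a k c → a + k + c ≡ a + c + k
  re = solve-∀
  fewer : ∀ u {x y} → x < y → cnt (y ≤ᵇ_) u ≤ cnt (x <ᵇ_) u
  fewer []      x<y = z≤n
  fewer (a ∷ u) {x} {y} x<y with y ≤ᵇ a | ≤ᵇ-dec y a
  ... | _ | is y≤a rewrite <ᵇ-true (<-≤-trans x<y y≤a) = s≤s (fewer u x<y)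
  ... | _ | isnt _ = ≤-trans (fewer u x<y) (m≤n+m _ _)
  collect : ∀ k j → j ≤ k → steps (λ i → k ∸ i) j ++ down (k ∸ j) ↭ down k
  collect k zero    _   = Perm.↭-refl
  collect k (suc j) j<k = Perm.↭-trans (Perm.↭-sym (↭.shift (k ∸ j) (steps (λ i → k ∸ i) j) (down (k ∸ suc j))))
    (Perm.↭-trans (Perm.↭-reflexive (cong (steps (λ i → k ∸ i) j ++_) (aux (k ∸ j) (k ∸ suc j) (sym (+-∸-assoc 1 j<k)))))
      (collect k j (<⇒≤ j<k)))
    where
    aux : ∀ s t → suc t ≡ s → s ∷ down t ≡ down s
    aux s t refl = refl
  collect-all : ∀ k → steps (λ i → k ∸ i) k ↭ down k
  collect-all k = Perm.↭-trans (Perm.↭-sym (↭.++-identityʳ _))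
    (subst (λ l → steps (λ i → k ∸ i) k ++ down l ↭ down k) (n∸n≡0 k) (collect k k ≤-refl))
  shifted : ∀ n k → map (k +_) (down n) ++ down k ≡ down (n + k)
  shifted zero    k = refl
  shifted (suc n) k = cong₂ _∷_ (+-comm k (suc n)) (shifted n k)

-- MAK and MAD as sums over descents

dsum : (ℕ → ℕ → Word → ℕ) → Word → ℕ
dsum G []          = 0
dsum G (x ∷ [])    = 0
dsum G (x ∷ y ∷ p) = (if x <ᵇ y then G x y p else 0) + dsum G (y ∷ p)

dsum-cong : ∀ {G G′} → (∀ x y p → x < y → G x y p ≡ G′ x y p) → ∀ v → dsum G v ≡ dsum G′ v
dsum-cong h []          = refl
dsum-cong h (x ∷ [])    = refl
dsum-cong {G} {G′} h (x ∷ y ∷ p) = cong₂ _+_ aux (dsum-cong h (y ∷ p))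
  where
  aux : (if x <ᵇ y then G x y p else 0) ≡ (if x <ᵇ y then G′ x y p else 0)
  aux with x <ᵇ y | <ᵇ-dec x y
  ... | _ | is x<y = h x y p x<y
  ... | _ | isnt _ = refl

dsum-+ : ∀ G G′ v → dsum G v + dsum G′ v ≡ dsum (λ x y p → G x y p + G′ x y p) v
dsum-+ G G′ []          = refl
dsum-+ G G′ (x ∷ [])    = refl
dsum-+ G G′ (x ∷ y ∷ p) = trans (+-interchange (if x <ᵇ y then G x y p else 0) _ _ _) (cong₂ _+_ aux (dsum-+ G G′ (y ∷ p)))
  where
  aux : (if x <ᵇ y then G x y p else 0) + (if x <ᵇ y then G′ x y p else 0) ≡ (if x <ᵇ y then G x y p + G′ x y p else 0)
  aux with x <ᵇ y
  ... | true  = refl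
  ... | false = refl

cost-dsum : ∀ b g v → Cost.cost b g v ≡ dsum (λ x y p → (b x (cnt (_≡ᵇ x) p) ∸ g y) + cnt (λ a → (x <ᵇ a) ∧ (a ≤ᵇ y)) p) v
cost-dsum b g []          = refl
cost-dsum b g (x ∷ [])    = refl
cost-dsum b g (x ∷ y ∷ p) = cong (Cost.desc b g x (y ∷ p) +_) (cost-dsum b g (y ∷ p))

-- `ψ` receives the bottom, the top and a sum over the letters left of the bottom; the latter is
-- what the value of a descent bottom requires.
des-reverse : ∀ (ψ : ℕ → ℕ → ℕ → ℕ) (e : ℕ → ℕ → ℕ) v →
  ∑ (range (length v ∸ 1)) (λ i → if atʳ v (suc i) <ᵇ atʳ v i then ψ (atʳ v (suc i)) (atʳ v i) (∑ (range i) (λ j → e (atʳ v j) (atʳ v (suc i)))) else 0)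
    ≡ dsum (λ x y p → ψ x y (∑ (y ∷ p) (λ a → e a x))) v
des-reverse ψ e []          = refl
des-reverse ψ e (x ∷ [])    = refl
des-reverse ψ e (x ∷ y ∷ p) = trans (∑-range-suc (length p) _)
  (trans (cong₂ _+_ (trans (∑-range-cong (length p) old) (des-reverse ψ e (y ∷ p))) new) (+-comm _ (if x <ᵇ y then ψ x y (∑ (y ∷ p) (λ a → e a x)) else 0)))
  where
  term : ℕ → ℕ → ℕ → ℕ
  term a b s = if a <ᵇ b then ψ a b s else 0
  old : ∀ i → 1 ≤ i → i ≤ length p → _ ≡ _
  old i _ i≤ = trans (cong₂ (λ a b → term a b (∑ (range i) (λ j → e (atʳ (x ∷ y ∷ p) j) (atʳ (x ∷ y ∷ p) (suc i))))) at-suc at-i)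
      (cong (term (atʳ (y ∷ p) (suc i)) (atʳ (y ∷ p) i)) (∑-range-cong i (λ j _ j≤i → cong₂ e (atʳ-old x (y ∷ p) j (≤-trans j≤i (m≤n⇒m≤1+n i≤))) at-suc)))
    where
    at-suc : atʳ (x ∷ y ∷ p) (suc i) ≡ atʳ (y ∷ p) (suc i)
    at-suc = atʳ-old x (y ∷ p) (suc i) (s≤s i≤)
    at-i : atʳ (x ∷ y ∷ p) i ≡ atʳ (y ∷ p) i
    at-i = atʳ-old x (y ∷ p) i (m≤n⇒m≤1+n i≤)
  n : ℕ
  n = suc (length p)
  new : term (atʳ (x ∷ y ∷ p) (suc n)) (atʳ (x ∷ y ∷ p) n) (∑ (range n) (λ j → e (atʳ (x ∷ y ∷ p) j) (atʳ (x ∷ y ∷ p) (suc n)))) ≡ term x y (∑ (y ∷ p) (λ a → e a x))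
  new = trans (cong₂ (λ a b → term a b (∑ (range n) (λ j → e (atʳ (x ∷ y ∷ p) j) (atʳ (x ∷ y ∷ p) (suc n))))) (atʳ-new x (y ∷ p)) (trans (atʳ-old x (y ∷ p) n ≤-refl) (atʳ-new y p)))
    (cong (term x y) (trans (∑-range-cong n (λ j _ j≤n → cong₂ e (atʳ-old x (y ∷ p) j j≤n) (atʳ-new x (y ∷ p)))) (∑-atʳ (y ∷ p) (λ a → e a x))))

height-reverse : ∀ v a → height (reverse v) a ≡ suc (cnt (_<ᵇ a) v)
height-reverse v a = cong suc (trans (length-filterᵇ (_<ᵇ a) (reverse v)) (cnt-reverse (_<ᵇ a) v))

Dtop-reverse : ∀ v → Dtop (reverse v) ≡ dsum (λ x y p → suc (cnt (_<ᵇ y) v)) v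
Dtop-reverse v = trans (cong (λ n → ∑ (range (n ∸ 1)) (λ i → if atʳ v (suc i) <ᵇ atʳ v i then height (reverse v) (atʳ v i) else 0)) (length-reverse v))
  (trans (∑-cong (range (length v ∸ 1)) (λ i → cong (λ y → if atʳ v (suc i) <ᵇ atʳ v i then y else 0) (height-reverse v (atʳ v i))))
    (des-reverse (λ x y _ → suc (cnt (_<ᵇ y) v)) (λ _ _ → 0) v))

Dbot-reverse : ∀ v → Dbot (reverse v) ≡ dsum (λ x y p → suc (cnt (_<ᵇ x) v) + cnt (_≡ᵇ x) p) v
Dbot-reverse v = trans (cong (λ n → ∑ (range (n ∸ 1)) (λ i → if atʳ v (suc i) <ᵇ atʳ v i then val (reverse v) (suc i) else 0)) (length-reverse v))
  (trans (∑-cong (range (length v ∸ 1)) (λ i → cong (λ y → if atʳ v (suc i) <ᵇ atʳ v i then y else 0)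
      (cong₂ _+_ (height-reverse v (atʳ v (suc i))) (length-filterᵇ (λ j → atʳ v j ≡ᵇ atʳ v (suc i)) (range i)))))
    (trans (des-reverse (λ x y s → suc (cnt (_<ᵇ x) v) + s) (λ a x → ind (a ≡ᵇ x)) v)
      (dsum-cong (λ x y p x<y → cong (λ z → suc (cnt (_<ᵇ x) v) + (ind z + cnt (_≡ᵇ x) p)) (≡ᵇ-false (>⇒≢ x<y))) v)))

-- Right embracing numbers: a proper block embraces a letter a iff exactly one of its descents passes a.

passes : ℕ → Word → ℕ
passes a []          = 0
passes a (y ∷ [])    = 0
passes a (y ∷ z ∷ w) = ind ((a ≤ᵇ y) ∧ (z <ᵇ a)) + passes a (z ∷ w)

-- Excludes the branches of `blocks` in which the remaining word has no first block or an empty one,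
-- and keeps what is needed of the decrease along a block.
record FirstBlock (z : ℕ) (w : Word) : Set where
  constructor firstBlock
  field
    {rest}   : Word
    {others} : List Word
    eq       : blocks (z ∷ w) ≡ (z ∷ rest) ∷ others
    last≤    : lastL (z ∷ rest) ≤ z

blocks-∷ : ∀ {y z w b bs} → blocks (z ∷ w) ≡ (z ∷ b) ∷ bs → blocks (y ∷ z ∷ w) ≡ (if z <ᵇ y then (y ∷ z ∷ b) ∷ bs else [ y ] ∷ (z ∷ b) ∷ bs)
blocks-∷ {z = z} {w} e with blocks (z ∷ w) | e
... | _ | refl = refl

first-block : ∀ z w → FirstBlock z w
first-block z [] = firstBlock refl ≤-refl
first-block z (y ∷ w) with first-block y w
... | firstBlock {b} {bs} eq l≤ with y <ᵇ z in lt
...   | true  = firstBlock (trans (blocks-∷ {z} {y} {w} eq) (cong (λ x → if x then (z ∷ y ∷ b) ∷ bs else [ z ] ∷ (y ∷ b) ∷ bs) lt))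
                           (≤-trans l≤ (<⇒≤ (<ᵇ⇒< y z (subst T (sym lt) tt))))
...   | false = firstBlock (trans (blocks-∷ {z} {y} {w} eq) (cong (λ x → if x then (z ∷ y ∷ b) ∷ bs else [ z ] ∷ (y ∷ b) ∷ bs) lt)) ≤-refl

-- For a > z the rest cannot embrace a, and the whole block does iff a ≤ y, since its last letter is
-- at most z. For a ≤ z the first descent misses a, and the block embraces a iff the rest does.
embrace-step : ∀ {y z b} a → z < y → lastL (z ∷ b) ≤ z →
  ind (embraces (y ∷ z ∷ b) a) ≡ ind ((a ≤ᵇ y) ∧ (z <ᵇ a)) + ind (embraces (z ∷ b) a)
embrace-step {y} {z} {b} a z<y l≤z with z <ᵇ a | <ᵇ-dec z a
... | _ | is z<a rewrite ≤ᵇ-false z<a | <ᵇ-true (≤-<-trans l≤z z<a) | ∧-zeroʳ (proper (z ∷ b)) = sym (+-identityʳ _)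
embrace-step {y} {z} {[]}    a z<y l≤z | _ | isnt a≤z rewrite ≤ᵇ-true (≤-trans a≤z (<⇒≤ z<y)) | <ᵇ-false a≤z = refl
embrace-step {y} {z} {c ∷ b} a z<y l≤z | _ | isnt a≤z rewrite ≤ᵇ-true (≤-trans a≤z (<⇒≤ z<y)) | ≤ᵇ-true a≤z = refl

embraced-∷ : ∀ a y z w → FirstBlock z w → ∑ (blocks (z ∷ w)) (λ b → ind (embraces b a)) ≡ passes a (z ∷ w) →
  ∑ (blocks (y ∷ z ∷ w)) (λ b → ind (embraces b a)) ≡ passes a (y ∷ z ∷ w)
embraced-∷ a y z w (firstBlock {b} {bs} eq l≤z) ih = trans (cong (λ l → ∑ l (λ b → ind (embraces b a))) (blocks-∷ {y} {z} {w} eq))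
    (trans step (cong (ind ((a ≤ᵇ y) ∧ (z <ᵇ a)) +_) (trans (cong (λ l → ∑ l (λ b → ind (embraces b a))) (sym eq)) ih)))
  where
  step : ∑ (if z <ᵇ y then (y ∷ z ∷ b) ∷ bs else [ y ] ∷ (z ∷ b) ∷ bs) (λ b → ind (embraces b a))
       ≡ ind ((a ≤ᵇ y) ∧ (z <ᵇ a)) + ∑ ((z ∷ b) ∷ bs) (λ b → ind (embraces b a))
  step with z <ᵇ y | <ᵇ-dec z y
  ... | _ | is z<y = trans (cong (_+ ∑ bs (λ b → ind (embraces b a))) (embrace-step {b = b} a z<y l≤z)) (+-assoc (ind ((a ≤ᵇ y) ∧ (z <ᵇ a))) _ _)
  ... | _ | isnt y≤z = cong (λ x → ind x + ∑ ((z ∷ b) ∷ bs) (λ b → ind (embraces b a))) (sym none)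
    where
    none : ((a ≤ᵇ y) ∧ (z <ᵇ a)) ≡ false
    none with a ≤ᵇ y | ≤ᵇ-dec a y
    ... | _ | is a≤y = <ᵇ-false (≤-trans a≤y y≤z)
    ... | _ | isnt _ = refl

embraced : ∀ a w → ∑ (blocks w) (λ b → ind (embraces b a)) ≡ passes a w
embraced a []          = refl
embraced a (y ∷ [])    = refl
embraced a (y ∷ z ∷ w) = embraced-∷ a y z w (first-block z w) (embraced a (z ∷ w))

rightBlocks : ℕ → ℕ → ℕ → List Word → ℕ
rightBlocks p i a bs = ∑ (withStarts p bs) (λ sb → ind ((i <ᵇ proj₁ sb) ∧ embraces (proj₂ sb) a))

rightBlocks-all : ∀ p i a bs → i < p → rightBlocks p i a bs ≡ ∑ bs (λ b → ind (embraces b a))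
rightBlocks-all p i a []       i<p = refl
rightBlocks-all p i a (b ∷ bs) i<p rewrite <ᵇ-true i<p = cong (ind (embraces b a) +_) (rightBlocks-all (p + length b) i a bs (≤-trans i<p (m≤m+n p (length b))))

rightBlocks-∷ : ∀ p i a y w → p ≤ i → (p ≡ i → a ≡ y) → rightBlocks p i a (blocks (y ∷ w)) ≡ rightBlocks (suc p) i a (blocks w)
rightBlocks-∷ p i a y [] p≤i h rewrite <ᵇ-false p≤i = refl
rightBlocks-∷ p i a y (z ∷ w) p≤i h with first-block z w
... | firstBlock {b} {bs} eq l≤z = trans (cong (rightBlocks p i a) (blocks-∷ {y} {z} {w} eq)) (trans step (cong (rightBlocks (suc p) i a) (sym eq)))
  where
  step : rightBlocks p i a (if z <ᵇ y then (y ∷ z ∷ b) ∷ bs else [ y ] ∷ (z ∷ b) ∷ bs) ≡ rightBlocks (suc p) i a ((z ∷ b) ∷ bs)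
  step with z <ᵇ y | <ᵇ-dec z y
  ... | _ | isnt _ rewrite <ᵇ-false p≤i | +-comm p 1 = refl
  ... | _ | is z<y rewrite <ᵇ-false p≤i = cong₂ _+_ (sym own) (cong (λ s → rightBlocks s i a bs) (+-suc p (suc (length b))))
    where
    -- Without y the block starts at p + 1, hence to the right of i when i = p. But then a = y > z,
    -- and the shortened block does not embrace a.
    own : ind ((i <ᵇ suc p) ∧ embraces (z ∷ b) a) ≡ 0
    own with m≤n⇒m<n∨m≡n p≤i
    ... | inj₁ p<i rewrite <ᵇ-false p<i = refl
    ... | inj₂ refl rewrite h refl | ≤ᵇ-false z<y | ∧-zeroʳ (proper (z ∷ b)) | ∧-zeroʳ (i <ᵇ suc i) = refl

rightBlocks-at : ∀ w p o → o < length w → rightBlocks p (p + o) (at w (suc o)) (blocks w) ≡ passes (at w (suc o)) (drop (suc o) w)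
rightBlocks-at (y ∷ w) p zero _ = trans (rightBlocks-∷ p (p + 0) y y w (m≤m+n p 0) (λ _ → refl))
  (trans (rightBlocks-all (suc p) (p + 0) y (blocks w) (s≤s (≤-reflexive (+-identityʳ p)))) (embraced y w))
rightBlocks-at (y ∷ w) p (suc o) (s≤s o<) = trans (rightBlocks-∷ p (p + suc o) a y w (m≤m+n p (suc o)) (λ e → contradiction (trans e (+-suc p o)) (<⇒≢ (s≤s (m≤m+n p o)))))
  (trans (cong (λ i → rightBlocks (suc p) i a (blocks w)) (+-suc p o)) (rightBlocks-at w (suc p) o o<))
  where
  a : ℕ
  a = at w (suc o)

eR-passes : ∀ w o → o < length w → eR w (suc o) ≡ passes (at w (suc o)) (drop (suc o) w)
eR-passes w o o< = trans (length-filterᵇ _ (withStarts 1 (blocks w))) (rightBlocks-at w 1 o o<)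

resᶠ : Word → ℕ
resᶠ []      = 0
resᶠ (y ∷ w) = passes y w + resᶠ w

∑-upTo-suc : ∀ n (f : ℕ → ℕ) → ∑ (upTo (suc n)) f ≡ f 0 + ∑ (upTo n) (f ∘ suc)
∑-upTo-suc n f = cong (f 0 +_) (trans (cong (λ l → ∑ l f) (sym (map-applyUpTo id suc n))) (∑-map suc (upTo n) f))

Res-resᶠ : ∀ w → Res w ≡ resᶠ w
Res-resᶠ w = trans (∑-range-cong (length w) {eR w} {λ i → passes (at w i) (drop i w)} (λ { (suc o) _ o< → eR-passes w o o< }))
  (trans (∑-map suc (upTo (length w)) _) (go w))
  where
  go : ∀ w → ∑ (upTo (length w)) (λ o → passes (at w (suc o)) (drop (suc o) w)) ≡ resᶠ w
  go []      = refl
  go (y ∷ w) = trans (∑-upTo-suc (length w) _) (cong (passes y w +_) (go w))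

passes-∷ʳ : ∀ a w y x → passes a (w ∷ʳ y ∷ʳ x) ≡ passes a (w ∷ʳ y) + ind ((a ≤ᵇ y) ∧ (x <ᵇ a))
passes-∷ʳ a []          y x = +-identityʳ _
passes-∷ʳ a (z ∷ [])    y x = re (ind ((a ≤ᵇ z) ∧ (y <ᵇ a))) (ind ((a ≤ᵇ y) ∧ (x <ᵇ a)))
  where
  re : ∀ i j → i + (j + 0) ≡ i + 0 + j
  re = solve-∀
passes-∷ʳ a (z ∷ t ∷ w) y x = trans (cong (ind ((a ≤ᵇ z) ∧ (t <ᵇ a)) +_) (passes-∷ʳ a (t ∷ w) y x)) (sym (+-assoc (ind ((a ≤ᵇ z) ∧ (t <ᵇ a))) _ _))

resᶠ-∷ʳ : ∀ w y x → resᶠ (w ∷ʳ y ∷ʳ x) ≡ resᶠ (w ∷ʳ y) + cnt (λ a → (a ≤ᵇ y) ∧ (x <ᵇ a)) w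
resᶠ-∷ʳ []      y x = refl
resᶠ-∷ʳ (a ∷ w) y x = trans (cong₂ _+_ (passes-∷ʳ a w y x) (resᶠ-∷ʳ w y x)) (+-interchange (passes a (w ∷ʳ y)) _ _ _)

-- Summed by descents instead of letters: the one from y to x counts once for each letter of (x, y]
-- to the left of y. If x < y fails, this interval is empty.
resᶠ-reverse : ∀ v → resᶠ (reverse v) ≡ dsum (λ x y p → cnt (λ a → (x <ᵇ a) ∧ (a ≤ᵇ y)) p) v
resᶠ-reverse []          = refl
resᶠ-reverse (x ∷ [])    = refl
resᶠ-reverse (x ∷ y ∷ p) = begin
  resᶠ (reverse (x ∷ y ∷ p)) ≡⟨ cong resᶠ (trans (unfold-reverse x (y ∷ p)) (cong (_∷ʳ x) (unfold-reverse y p))) ⟩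
  resᶠ (reverse p ∷ʳ y ∷ʳ x) ≡⟨ resᶠ-∷ʳ (reverse p) y x ⟩
  resᶠ (reverse p ∷ʳ y) + cnt (λ a → (a ≤ᵇ y) ∧ (x <ᵇ a)) (reverse p)
    ≡⟨ cong₂ _+_ (trans (cong resᶠ (sym (unfold-reverse y p))) (resᶠ-reverse (y ∷ p))) (trans (cnt-reverse _ p) guard) ⟩
  dsum _ (y ∷ p) + (if x <ᵇ y then cnt (λ a → (x <ᵇ a) ∧ (a ≤ᵇ y)) p else 0) ≡⟨ +-comm (dsum _ (y ∷ p)) _ ⟩
  dsum _ (x ∷ y ∷ p) ∎
  where
  open ≡-Reasoning
  guard : cnt (λ a → (a ≤ᵇ y) ∧ (x <ᵇ a)) p ≡ (if x <ᵇ y then cnt (λ a → (x <ᵇ a) ∧ (a ≤ᵇ y)) p else 0)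
  guard with x <ᵇ y | <ᵇ-dec x y
  ... | _ | is _ = ∑-cong p (λ a → cong ind (∧-comm (a ≤ᵇ y) (x <ᵇ a)))
  ... | _ | isnt y≤x = trans (∑-cong p none) (∑-zero p)
    where
    none : ∀ a → ind ((a ≤ᵇ y) ∧ (x <ᵇ a)) ≡ 0
    none a with a ≤ᵇ y | ≤ᵇ-dec a y
    ... | _ | is a≤y rewrite <ᵇ-false (≤-trans a≤y y≤x) = refl
    ... | _ | isnt _ = refl

familyCost : Family → Word → ℕ
familyCost 𝓕 v = Cost.cost (Family.b 𝓕 v) (Family.g 𝓕 v) v

MAK-reverse : ∀ v → MAK (reverse v) ≡ familyCost makFamily v
MAK-reverse v = trans (cong₂ _+_ (Dbot-reverse v) (trans (Res-resᶠ (reverse v)) (resᶠ-reverse v)))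
  (trans (dsum-+ _ _ v) (sym (cost-dsum _ _ v)))

-- `Ddif` is a truncated difference of two sums. It is computed by writing the height of each top as
-- the value of its bottom plus `diff`, which follows from counting all letters relative to y and
-- relative to x.
MAD-reverse : ∀ v → MAD (reverse v) ≡ familyCost madFamily v
MAD-reverse v = trans (cong₂ _+_ difference (trans (Res-resᶠ (reverse v)) (resᶠ-reverse v))) (trans (dsum-+ _ _ v) (sym (cost-dsum _ _ v)))
  where
  open ≡-Reasoning
  E : ℕ → ℕ
  E x = cnt (_≡ᵇ x) v
  diff : ℕ → ℕ → Word → ℕ
  diff x y p = cnt (x <ᵇ_) v + (E x ∸ cnt (_≡ᵇ x) p) ∸ cnt (y ≤ᵇ_) v
  bot : ℕ → ℕ → Word → ℕ
  bot x y p = suc (cnt (_<ᵇ x) v) + cnt (_≡ᵇ x) p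
  split : ∀ {x y} → x < y → cnt (_<ᵇ y) v + cnt (y ≤ᵇ_) v ≡ cnt (_<ᵇ x) v + (E x + cnt (x <ᵇ_) v)
  split {x} {y} x<y = trans (sym (∑-+ v _ _)) (trans (∑-cong v aux) (trans (∑-+ v _ _) (cong (cnt (_<ᵇ x) v +_) (∑-+ v _ _))))
    where
    one : ∀ a → ind (a <ᵇ y) + ind (y ≤ᵇ a) ≡ 1
    one a with a <ᵇ y | <ᵇ-dec a y
    ... | _ | is h rewrite ≤ᵇ-false h = refl
    ... | _ | isnt h rewrite ≤ᵇ-true h = refl
    three : ∀ a → ind (a <ᵇ x) + (ind (a ≡ᵇ x) + ind (x <ᵇ a)) ≡ 1
    three a with a <ᵇ x | <ᵇ-dec a x
    ... | _ | is h rewrite ≡ᵇ-false (<⇒≢ h) | <ᵇ-false (<⇒≤ h) = refl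
    ... | _ | isnt h with a ≡ᵇ x | ≡ᵇ-dec a x
    ...   | _ | is refl rewrite <ᵇ-false (≤-refl {a}) = refl
    ...   | _ | isnt ne rewrite <ᵇ-true (≤∧≢⇒< h (ne ∘ sym)) = refl
    aux : ∀ a → ind (a <ᵇ y) + ind (y ≤ᵇ a) ≡ ind (a <ᵇ x) + (ind (a ≡ᵇ x) + ind (x <ᵇ a))
    aux a = trans (one a) (sym (three a))
  pointwise : ∀ x y p → x < y → cnt (_≡ᵇ x) p ≤ E x → suc (cnt (_<ᵇ y) v) ≡ bot x y p + diff x y p
  pointwise x y p x<y i≤E = +-cancelʳ-≡ (cnt (y ≤ᵇ_) v) _ _ (begin
    suc (cnt (_<ᵇ y) v) + cnt (y ≤ᵇ_) v ≡⟨ cong suc (split x<y) ⟩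
    suc (cnt (_<ᵇ x) v + (E x + cnt (x <ᵇ_) v)) ≡⟨ cong (λ e → suc (cnt (_<ᵇ x) v + (e + cnt (x <ᵇ_) v))) (sym (m+[n∸m]≡n i≤E)) ⟩
    suc (cnt (_<ᵇ x) v + (cnt (_≡ᵇ x) p + (E x ∸ cnt (_≡ᵇ x) p) + cnt (x <ᵇ_) v)) ≡⟨ re (cnt (_<ᵇ x) v) (cnt (_≡ᵇ x) p) _ _ ⟩
    bot x y p + (cnt (x <ᵇ_) v + (E x ∸ cnt (_≡ᵇ x) p)) ≡⟨ cong (bot x y p +_) (sym (m∸n+n≡m (Family.g≤b madFamily v (cnt (_≡ᵇ x) p) x<y))) ⟩
    bot x y p + (diff x y p + cnt (y ≤ᵇ_) v) ≡⟨ sym (+-assoc (bot x y p) _ _) ⟩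
    bot x y p + diff x y p + cnt (y ≤ᵇ_) v ∎)
    where
    re : ∀ a i e c → suc (a + (i + e + c)) ≡ suc a + i + (c + e)
    re = solve-∀
  tops : ∀ u → (∀ x → cnt (_≡ᵇ x) u ≤ E x) → dsum (λ x y p → suc (cnt (_<ᵇ y) v)) u ≡ dsum (λ x y p → bot x y p + diff x y p) u
  tops []          h = refl
  tops (x ∷ [])    h = refl
  tops (x ∷ y ∷ p) h = cong₂ _+_ aux (tops (y ∷ p) (λ a → ≤-trans (m≤n+m _ (ind (x ≡ᵇ a))) (h a)))
    where
    aux : (if x <ᵇ y then suc (cnt (_<ᵇ y) v) else 0) ≡ (if x <ᵇ y then bot x y p + diff x y p else 0)
    aux with x <ᵇ y | <ᵇ-dec x y
    ... | _ | is x<y = pointwise x y p x<y (≤-trans (m≤n+m _ (ind (y ≡ᵇ x))) (≤-trans (m≤n+m _ (ind (x ≡ᵇ x))) (h x)))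
    ... | _ | isnt _ = refl
  difference : Ddif (reverse v) ≡ dsum diff v
  difference = begin
    Dtop (reverse v) ∸ Dbot (reverse v)
      ≡⟨ cong₂ _∸_ (trans (Dtop-reverse v) (trans (tops v (λ _ → ≤-refl)) (sym (dsum-+ bot diff v)))) (Dbot-reverse v) ⟩
    dsum bot v + dsum diff v ∸ dsum bot v ≡⟨ m+n∸m≡n (dsum bot v) (dsum diff v) ⟩
    dsum diff v ∎

-- Both enumerations list exactly the words of 𝒫_M

-- For κ i = k_i and t = m these are the reversals of the words of 𝒫_M.
record Admissible (m : ℕ) (κ : ℕ → ℕ) (t : ℕ) (v : Word) : Set where
  constructor admissible
  field
    letter : ∀ x → x ∈ v → 1 ≤ x × x ≤ m
    count  : ∀ i → 1 ≤ i → i ≤ m → cnt (_≡ᵇ i) v ≡ κ i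
    order  : ∀ i → 1 ≤ i → i < t → bef (suc i) i v ≡ true
open Admissible

bef-∷-other : ∀ {b a c} v → b ≢ a → b ≢ c → bef c a (b ∷ v) ≡ bef c a v
bef-∷-other v b≢a b≢c = bef-skip b≢a b≢c [] v

bef-∷-true : ∀ c a v → bef c a (c ∷ v) ≡ true
bef-∷-true c a v rewrite ≡ᵇ-refl c = refl

bef-∷-false : ∀ a v → bef (suc a) a (a ∷ v) ≡ false
bef-∷-false a v rewrite ≡ᵇ-false (<⇒≢ (n<1+n a)) | ≡ᵇ-refl a = refl

cnt-pos : ∀ b v → 1 ≤ cnt (_≡ᵇ b) (b ∷ v)
cnt-pos b v rewrite ≡ᵇ-refl b = s≤s z≤n

module EnumerateByLastLetter (m : ℕ) where
  open LastLetter m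
  open LastLetterStatistics 0 m using (E-≤m)
  open ZStatistic 0 m using (E-cnt≡)
  open DenStatistic 0 m using (E-≥1)

  E-order : ∀ n {κ t} → State n κ t → ∀ v → v ∈ E n κ t → ∀ i → 1 ≤ i → i < t → bef (suc i) i v ≡ true
  E-order zero {κ} S v v∈ i 1≤i i<t = contradiction (≤-trans (≤-trans (pos S (suc i) (s≤s z≤n) i<t) (m≤n+m (κ (suc i)) (N κ i)))
      (≤-trans (N-mono κ (≤-trans i<t (t≤m S))) (≤-reflexive (tot S)))) λ ()
  E-order (suc n) {κ} {t} S v v∈ i 1≤i i<t with ∈E⁻ S v∈
  ... | b , v′ , A , refl , v′∈ with suc i ≡ᵇ b | ≡ᵇ-dec (suc i) b
  ...   | _ | is refl = bef-∷-true (suc i) i v′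
  ...   | _ | isnt si≢b = trans (bef-∷-other v′ (>⇒≢ (<-≤-trans i<t (t≤b A))) (si≢b ∘ sym)) (E-order n (next S A) v′ v′∈ i 1≤i lower-bound)
    where
    lower-bound : i < lower t b
    lower-bound with b ≡ᵇ t | ≡ᵇ-dec b t
    ... | _ | is refl = s≤s⁻¹ (subst (suc (suc i) ≤_) (sym (suc-pred b {{>-nonZero (1≤b S A)}})) (≤∧≢⇒< i<t si≢b))
    ... | _ | isnt _  = i<t

  E-sound : ∀ n {κ t} → State n κ t → ∀ v → v ∈ E n κ t → Admissible m κ t v
  E-sound n S v v∈ = admissible (λ x x∈ → E-≥1 n S v v∈ x x∈ , E-≤m n S v v∈ x x∈) (E-cnt≡ n S v v∈) (E-order n S v v∈)

  -- The last letter b is at least t: for b < t the order condition would demand a later b + 1.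
  E-complete : ∀ n {κ t} → State n κ t → ∀ v → length v ≡ n → Admissible m κ t v → v ∈ E n κ t
  E-complete .0 S [] refl P = here refl
  E-complete (suc n) {κ} {t} S (b ∷ v) len P = ∈E⁺ {n} A (E-complete n (next S A) v (suc-injective len) P′)
    where
    b-range : 1 ≤ b × b ≤ m
    b-range = letter P b (here refl)
    b≥t : t ≤ b
    b≥t = ≮⇒≥ (λ b<t → contradiction (trans (sym (order P b (proj₁ b-range) b<t)) (bef-∷-false b v)) λ ())
    A : Allowed κ t b
    A = allowed b≥t (proj₂ b-range) (subst (1 ≤_) (count P b (proj₁ b-range) (proj₂ b-range)) (cnt-pos b v))
    count′ : ∀ i → 1 ≤ i → i ≤ m → cnt (_≡ᵇ i) v ≡ (κ ⊖ b) i
    count′ i 1≤i i≤m with i ≡ᵇ b | ≡ᵇ-dec i b | count P i 1≤i i≤m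
    ... | _ | is refl | e rewrite ≡ᵇ-refl b = cong pred e
    ... | _ | isnt ne | e rewrite ≡ᵇ-false (ne ∘ sym) = e
    order′ : ∀ i → 1 ≤ i → i < lower t b → bef (suc i) i v ≡ true
    order′ i 1≤i i< = trans (sym (bef-∷-other v (>⇒≢ (<-trans (n<1+n i) si<b)) (>⇒≢ si<b))) (order P i 1≤i (≤-trans i< (lower-≤ t b)))
      where
      si<b : suc i < b
      si<b with b ≡ᵇ t | ≡ᵇ-dec b t
      ... | _ | is refl = subst (suc (suc i) ≤_) (suc-pred b {{>-nonZero (1≤b S A)}}) (s≤s i<)
      ... | _ | isnt ne = ≤-<-trans i< (≤∧≢⇒< b≥t (ne ∘ sym))
    P′ : Admissible m (κ ⊖ b) (lower t b) v
    P′ = admissible (λ x x∈ → letter P x (there x∈)) count′ order′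

shuf-All : ∀ {P : ℕ → Set} r m p → P m → All P p → ∀ w → w ∈ shuf r m p → All P w
shuf-All zero    m p       pm a .p (here refl) = a
shuf-All (suc r) m []      pm a w w∈ with ∈-map⁻ (m ∷_) w∈
... | w′ , w′∈ , refl = pm ∷ shuf-All r m [] pm a w′ w′∈
shuf-All (suc r) m (x ∷ p) pm (px ∷ a) w w∈ with ∈-++⁻ (map (m ∷_) (shuf r m (x ∷ p))) w∈
... | inj₁ w∈₁ with ∈-map⁻ (m ∷_) w∈₁
...   | w′ , w′∈ , refl = pm ∷ shuf-All r m (x ∷ p) pm (px ∷ a) w′ w′∈
shuf-All (suc r) m (x ∷ p) pm (px ∷ a) w w∈ | inj₂ w∈₂ with ∈-map⁻ (x ∷_) w∈₂
... | w′ , w′∈ , refl = px ∷ shuf-All (suc r) m p pm a w′ w′∈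

delete : ℕ → Word → Word
delete m = filterᵇ (λ x → not (x ≡ᵇ m))

delete-m : ∀ m w → delete m (m ∷ w) ≡ delete m w
delete-m m w rewrite ≡ᵇ-refl m = refl

delete-other : ∀ m {x} w → x ≢ m → delete m (x ∷ w) ≡ x ∷ delete m w
delete-other m w ne rewrite ≡ᵇ-false ne = refl

shuf-delete : ∀ r m p → All (_< m) p → ∀ w → w ∈ shuf r m p → delete m w ≡ p
shuf-delete zero    m []      []        .[] (here refl) = refl
shuf-delete zero    m (x ∷ p) (x<m ∷ a) .(x ∷ p) (here refl) = trans (delete-other m p (<⇒≢ x<m)) (cong (x ∷_) (shuf-delete 0 m p a p (here refl)))
shuf-delete (suc r) m []      a w w∈ with ∈-map⁻ (m ∷_) w∈
... | w′ , w′∈ , refl = trans (delete-m m w′) (shuf-delete r m [] a w′ w′∈)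
shuf-delete (suc r) m (x ∷ p) (x<m ∷ a) w w∈ with ∈-++⁻ (map (m ∷_) (shuf r m (x ∷ p))) w∈
... | inj₁ w∈₁ with ∈-map⁻ (m ∷_) w∈₁
...   | w′ , w′∈ , refl = trans (delete-m m w′) (shuf-delete r m (x ∷ p) (x<m ∷ a) w′ w′∈)
shuf-delete (suc r) m (x ∷ p) (x<m ∷ a) w w∈ | inj₂ w∈₂ with ∈-map⁻ (x ∷_) w∈₂
... | w′ , w′∈ , refl = trans (delete-other m w′ (<⇒≢ x<m)) (cong (x ∷_) (shuf-delete (suc r) m p a w′ w′∈))

∈-shuf-delete : ∀ m w → w ∈ shuf (cnt (_≡ᵇ m) w) m (delete m w)
∈-shuf-delete m [] = here refl
∈-shuf-delete m (x ∷ w) with x ≡ᵇ m | ≡ᵇ-dec x m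
... | _ | is refl = add (delete x w) (∈-shuf-delete x w)
  where
  add : ∀ {r} p → w ∈ shuf r x p → x ∷ w ∈ shuf (suc r) x p
  add []      w∈ = ∈-map⁺ (x ∷_) w∈
  add (y ∷ p) w∈ = ∈-++⁺ˡ (∈-map⁺ (x ∷_) w∈)
... | _ | isnt _ = add (cnt (_≡ᵇ m) w) (∈-shuf-delete m w)
  where
  add : ∀ r → w ∈ shuf r m (delete m w) → x ∷ w ∈ shuf r m (x ∷ delete m w)
  add zero    (here eq) = here (cong (x ∷_) eq)
  add (suc r) w∈ = ∈-++⁺ʳ (map (m ∷_) (shuf r m (x ∷ delete m w))) (∈-map⁺ (x ∷_) w∈)

bef-delete : ∀ m {a c} → m ≢ a → m ≢ c → ∀ w → bef c a (delete m w) ≡ bef c a w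
bef-delete m m≢a m≢c [] = refl
bef-delete m {a} {c} m≢a m≢c (x ∷ w) with x ≡ᵇ m | ≡ᵇ-dec x m
... | _ | is refl = trans (bef-delete x m≢a m≢c w) (sym (bef-∷-other w m≢a m≢c))
... | _ | isnt _ with x ≡ᵇ c | x ≡ᵇ a
...   | true  | _     = refl
...   | false | true  = refl
...   | false | false = bef-delete m m≢a m≢c w

delete-All : ∀ m w → All (_≢ m) (delete m w)
delete-All m [] = []
delete-All m (x ∷ w) with x ≡ᵇ m | ≡ᵇ-dec x m
... | _ | is _   = delete-All m w
... | _ | isnt n = n ∷ delete-All m w

delete-⊆ : ∀ m w {x} → x ∈ delete m w → x ∈ w
delete-⊆ m (y ∷ w) x∈ with y ≡ᵇ m
... | true  = there (delete-⊆ m w x∈)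
delete-⊆ m (y ∷ w) (here refl) | false = here refl
delete-⊆ m (y ∷ w) (there x∈)  | false = there (delete-⊆ m w x∈)

cnt-delete : ∀ m {i} → i ≢ m → ∀ w → cnt (_≡ᵇ i) (delete m w) ≡ cnt (_≡ᵇ i) w
cnt-delete m i≢m [] = refl
cnt-delete m {i} i≢m (x ∷ w) with x ≡ᵇ m | ≡ᵇ-dec x m
... | _ | is refl rewrite ≡ᵇ-false (i≢m ∘ sym) = cnt-delete x i≢m w
... | _ | isnt _  = cong (ind (x ≡ᵇ i) +_) (cnt-delete m i≢m w)

insWords-sound : ∀ ks → All (1 ≤_) ks → ∀ v → v ∈ insWords ks → Admissible (length ks) (atʳ ks) (length ks) v
insWords-sound [] _ .[] (here refl) = admissible (λ _ ()) (λ { (suc i) _ () }) (λ { _ _ () })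
insWords-sound (k ∷ ks) (1≤k ∷ a) v v∈ with ∈insWords⁻ k ks v v∈
... | u , w , u∈ , w∈ , refl = admissible letter′ count′ order′
  where
  m : ℕ
  m = suc (length ks)
  small : All (_< m) u
  small = insWords-< ks u u∈
  P : Admissible (length ks) (atʳ ks) (length ks) u
  P = insWords-sound ks a u u∈
  letter′ : ∀ x → x ∈ m ∷ w → 1 ≤ x × x ≤ m
  letter′ x (here refl) = s≤s z≤n , ≤-refl
  letter′ x (there x∈) = All.lookup (shuf-All (pred k) m u (s≤s z≤n , ≤-refl)
    (All.tabulate (λ y∈ → proj₁ (letter P _ y∈) , m≤n⇒m≤1+n (proj₂ (letter P _ y∈)))) w w∈) x∈
  count′ : ∀ i → 1 ≤ i → i ≤ m → cnt (_≡ᵇ i) (m ∷ w) ≡ atʳ (k ∷ ks) i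
  count′ i 1≤i i≤m with m≤n⇒m<n∨m≡n i≤m
  ... | inj₁ (s≤s i≤) rewrite ≡ᵇ-false (>⇒≢ (s≤s i≤)) = trans (∑-shuf (pred k) m u w w∈ (λ x → ind (x ≡ᵇ i)))
        (trans (cong₂ (λ x y → x + pred k * ind y) (count P i 1≤i i≤) (≡ᵇ-false (>⇒≢ (s≤s i≤))))
          (trans (cong (atʳ ks i +_) (*-zeroʳ (pred k))) (trans (+-identityʳ _) (sym (atʳ-old k ks i i≤)))))
  ... | inj₂ refl = trans (cong₂ (λ x y → ind x + y) (≡ᵇ-refl m) (∑-shuf (pred k) m u w w∈ (λ x → ind (x ≡ᵇ m))))
        (trans (cong₂ (λ x y → suc (x + pred k * ind y)) (cnt-none (_≡ᵇ m) u (All.map (λ x<m → ≡ᵇ-false (<⇒≢ x<m)) small)) (≡ᵇ-refl m))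
          (trans (cong suc (*-identityʳ (pred k))) (trans (suc-pred k {{>-nonZero 1≤k}}) (sym (atʳ-new k ks)))))
  order′ : ∀ i → 1 ≤ i → i < m → bef (suc i) i (m ∷ w) ≡ true
  order′ i 1≤i i<m with m≤n⇒m<n∨m≡n i<m
  ... | inj₂ refl = bef-∷-true m i w
  ... | inj₁ si<m = trans (bef-∷-other w m≢i m≢si)
        (trans (sym (bef-delete m m≢i m≢si w)) (trans (cong (bef (suc i) i) (shuf-delete (pred k) m u small w w∈)) (order P i 1≤i (s≤s⁻¹ si<m))))
    where
    m≢si : m ≢ suc i
    m≢si e = <⇒≢ si<m (sym e)
    m≢i : m ≢ i
    m≢i e = <⇒≢ i<m (sym e)

-- The last letter must be the largest, since a smaller x would have to be followed by x + 1.
-- Deleting all copies of the largest letter leaves an admissible word, and the original is one of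
-- its shuffles.
insWords-complete : ∀ ks → All (1 ≤_) ks → ∀ v → Admissible (length ks) (atʳ ks) (length ks) v → v ∈ insWords ks
insWords-complete [] _ [] P = here refl
insWords-complete [] _ (x ∷ v) P = contradiction (≤-trans (proj₁ (letter P x (here refl))) (proj₂ (letter P x (here refl)))) λ ()
insWords-complete (k ∷ ks) (1≤k ∷ a) [] P = contradiction (subst (1 ≤_) (sym (trans (count P (suc (length ks)) (s≤s z≤n) ≤-refl) (atʳ-new k ks))) 1≤k) λ ()
insWords-complete (k ∷ ks) (1≤k ∷ a) (x ∷ v) P with m≤n⇒m<n∨m≡n (proj₂ (letter P x (here refl)))
... | inj₁ x<m = contradiction (trans (sym (order P x (proj₁ (letter P x (here refl))) x<m)) (bef-∷-false x v)) λ ()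
... | inj₂ refl = ∈insWords⁺ k ks (delete m v) v (insWords-complete ks a (delete m v) P′)
      (subst (λ r → v ∈ shuf r m (delete m v)) times (∈-shuf-delete m v))
  where
  m : ℕ
  m = suc (length ks)
  times : cnt (_≡ᵇ m) v ≡ pred k
  times = cong pred (trans (cong (λ y → ind y + cnt (_≡ᵇ m) v) (sym (≡ᵇ-refl m))) (trans (count P m (s≤s z≤n) ≤-refl) (atʳ-new k ks)))
  P′ : Admissible (length ks) (atʳ ks) (length ks) (delete m v)
  P′ = admissible
    (λ y y∈ → proj₁ (letter P y (there (delete-⊆ m v y∈))) , s≤s⁻¹ (≤∧≢⇒< (proj₂ (letter P y (there (delete-⊆ m v y∈)))) (All.lookup (delete-All m v) y∈)))
    (λ i 1≤i i≤ → trans (cnt-delete m (<⇒≢ (s≤s i≤)) v)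
      (trans (cong (λ y → ind y + cnt (_≡ᵇ i) v) (sym (≡ᵇ-false (>⇒≢ (s≤s i≤))))) (trans (count P i 1≤i (m≤n⇒m≤1+n i≤)) (atʳ-old k ks i i≤))))
    (λ i 1≤i i< → trans (bef-delete m (>⇒≢ (m≤n⇒m≤1+n i<)) (>⇒≢ (s≤s i<)) v)
      (trans (sym (bef-∷-other v (>⇒≢ (m≤n⇒m≤1+n i<)) (>⇒≢ (s≤s i<)))) (order P i 1≤i (m≤n⇒m≤1+n i<))))

∈-filterᵇ⁻ : {A : Set} (p : A → Bool) (xs : List A) {x : A} → x ∈ filterᵇ p xs → x ∈ xs × p x ≡ true
∈-filterᵇ⁻ p (y ∷ xs) x∈ with p y in eq
∈-filterᵇ⁻ p (y ∷ xs) (here refl) | true = here refl , eq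
∈-filterᵇ⁻ p (y ∷ xs) (there x∈)  | true with ∈-filterᵇ⁻ p xs x∈
... | x∈′ , px = there x∈′ , px
∈-filterᵇ⁻ p (y ∷ xs) x∈ | false with ∈-filterᵇ⁻ p xs x∈
... | x∈′ , px = there x∈′ , px

∈-filterᵇ⁺ : {A : Set} (p : A → Bool) (xs : List A) {x : A} → x ∈ xs → p x ≡ true → x ∈ filterᵇ p xs
∈-filterᵇ⁺ p (y ∷ xs) (here refl) px rewrite px = here refl
∈-filterᵇ⁺ p (y ∷ xs) (there x∈) px with p y
... | true  = there (∈-filterᵇ⁺ p xs x∈ px)
... | false = ∈-filterᵇ⁺ p xs x∈ px

filterᵇ-unique : {A : Set} (p : A → Bool) (xs : List A) → Unique xs → Unique (filterᵇ p xs)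
filterᵇ-unique p []       _        = []
filterᵇ-unique p (x ∷ xs) (x∉ ∷ u) with p x
... | true  = All.tabulate (λ y∈ → All.lookup x∉ (proj₁ (∈-filterᵇ⁻ p xs y∈))) ∷ filterᵇ-unique p xs u
... | false = filterᵇ-unique p xs u

∧-true⁻ : ∀ {a b} → (a ∧ b) ≡ true → a ≡ true × b ≡ true
∧-true⁻ {true} e = refl , e

∧-true⁺ : ∀ {a b} → a ≡ true → b ≡ true → (a ∧ b) ≡ true
∧-true⁺ refl refl = refl

and-map⁻ : (f : ℕ → Bool) (xs : List ℕ) → and (map f xs) ≡ true → ∀ x → x ∈ xs → f x ≡ true
and-map⁻ f (y ∷ xs) e x (here refl) = proj₁ (∧-true⁻ e)
and-map⁻ f (y ∷ xs) e x (there x∈)  = and-map⁻ f xs (proj₂ (∧-true⁻ {f y} e)) x x∈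

and-map⁺ : (f : ℕ → Bool) (xs : List ℕ) → (∀ x → x ∈ xs → f x ≡ true) → and (map f xs) ≡ true
and-map⁺ f []       h = refl
and-map⁺ f (y ∷ xs) h = ∧-true⁺ (h y (here refl)) (and-map⁺ f xs (λ x → h x ∘ there))

∈-range⁻ : ∀ {i} n → i ∈ range n → 1 ≤ i × i ≤ n
∈-range⁻ n i∈ with ∈-map⁻ suc i∈
... | j , j∈ , refl = s≤s z≤n , ∈-upTo⁻ j∈

∈-range⁺ : ∀ {i} n → 1 ≤ i → i ≤ n → i ∈ range n
∈-range⁺ {suc i} n _ i<n = ∈-map⁺ suc (∈-upTo⁺ i<n)

true-≡ᵇ : ∀ {a b} → (a ≡ᵇ b) ≡ true → a ≡ b
true-≡ᵇ {a} {b} e with a ≡ᵇ b | ≡ᵇ-dec a b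
true-≡ᵇ refl | _ | is h = h

lp : ℕ → Word → ℕ
lp a []      = 0
lp a (x ∷ v) = if x ≡ᵇ a then suc (length v) else lp a v

lp-≤ : ∀ a v → lp a v ≤ length v
lp-≤ a [] = z≤n
lp-≤ a (x ∷ v) with x ≡ᵇ a
... | true  = ≤-refl
... | false = m≤n⇒m≤1+n (lp-≤ a v)

lp-bef : ∀ {a c} → a ≢ c → ∀ v → (lp a v <ᵇ lp c v) ≡ bef c a v
lp-bef a≢c [] = refl
lp-bef {a} {c} a≢c (x ∷ v) with x ≡ᵇ c | ≡ᵇ-dec x c
... | _ | is refl rewrite ≡ᵇ-false (a≢c ∘ sym) = <ᵇ-true (s≤s (lp-≤ a v))
... | _ | isnt _ with x ≡ᵇ a
...   | true  = <ᵇ-false (m≤n⇒m≤1+n (lp-≤ c v))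
...   | false = lp-bef a≢c v

lastPos-reverse : ∀ a v → lastPos a (reverse v) ≡ lp a v
lastPos-reverse a v = trans (cong (λ n → foldr _⊔_ 0 (filterᵇ (λ j → atʳ v j ≡ᵇ a) (range n))) (length-reverse v)) (go v)
  where
  max : List ℕ → ℕ
  max = foldr _⊔_ 0
  max-∷ʳ : ∀ l x → max (l ∷ʳ x) ≡ max l ⊔ x
  max-∷ʳ []      x = ⊔-identityʳ x
  max-∷ʳ (y ∷ l) x = trans (cong (y ⊔_) (max-∷ʳ l x)) (sym (⊔-assoc y (max l) x))
  filterᵇ-cong : ∀ (p r : ℕ → Bool) l → (∀ x → x ∈ l → p x ≡ r x) → filterᵇ p l ≡ filterᵇ r l
  filterᵇ-cong p r []      h = refl
  filterᵇ-cong p r (x ∷ l) h = cong₂ (λ b t → if b then x ∷ t else t) (h x (here refl)) (filterᵇ-cong p r l (λ y → h y ∘ there))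
  go : ∀ v → max (filterᵇ (λ j → atʳ v j ≡ᵇ a) (range (length v))) ≡ lp a v
  go []      = refl
  go (x ∷ v) = begin
    max (filterᵇ p (range (suc n))) ≡⟨ cong max (trans (cong (filterᵇ p) (range-suc n)) (filterᵇ-∷ʳ p (range n) (suc n))) ⟩
    max (if p (suc n) then filterᵇ p (range n) ∷ʳ suc n else filterᵇ p (range n))
      ≡⟨ cong₂ (λ b l → max (if b then l ∷ʳ suc n else l)) (cong (_≡ᵇ a) (atʳ-new x v))
           (filterᵇ-cong p (λ j → atʳ v j ≡ᵇ a) (range n) (λ j j∈ → cong (_≡ᵇ a) (atʳ-old x v j (proj₂ (∈-range⁻ n j∈))))) ⟩
    max (if x ≡ᵇ a then old ∷ʳ suc n else old) ≡⟨ last (x ≡ᵇ a) ⟩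
    lp a (x ∷ v) ∎
    where
    open ≡-Reasoning
    n : ℕ
    n = length v
    p : ℕ → Bool
    p j = atʳ (x ∷ v) j ≡ᵇ a
    old : List ℕ
    old = filterᵇ (λ j → atʳ v j ≡ᵇ a) (range n)
    last : ∀ b → max (if b then old ∷ʳ suc n else old) ≡ (if b then suc n else lp a v)
    last false = go v
    last true  = trans (max-∷ʳ old (suc n)) (trans (cong (_⊔ suc n) (go v)) (m≤n⇒m⊔n≡n (m≤n⇒m≤1+n (lp-≤ a v))))

words-∈⁻ : ∀ n m w → w ∈ words n m → length w ≡ n × (∀ x → x ∈ w → 1 ≤ x × x ≤ m)
words-∈⁻ zero    m .[] (here refl) = refl , λ _ ()
words-∈⁻ (suc n) m w w∈ with find (∈-concatMap⁻ _ {xs = range m} w∈)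
... | a , a∈ , w∈a with ∈-map⁻ (a ∷_) w∈a
...   | w′ , w′∈ , refl with words-∈⁻ n m w′ w′∈
...     | len , rng = cong suc len , λ { x (here refl) → ∈-range⁻ m a∈ ; x (there x∈) → rng x x∈ }

words-∈⁺ : ∀ m w → (∀ x → x ∈ w → 1 ≤ x × x ≤ m) → w ∈ words (length w) m
words-∈⁺ m []      rng = here refl
words-∈⁺ m (a ∷ w) rng = ∈-concatMap⁺ _ {xs = range m} (lose (∈-range⁺ m (proj₁ (rng a (here refl))) (proj₂ (rng a (here refl)))) (∈-map⁺ (a ∷_) (words-∈⁺ m w (λ x → rng x ∘ there))))

-- `tag` recovers the branch from any of its elements, so different branches are disjoint.
concatMap-unique : {A B : Set} (g : A → List B) (tag : B → A) (xs : List A) → Unique xs →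
  (∀ a → a ∈ xs → Unique (g a)) → (∀ a → a ∈ xs → ∀ v → v ∈ g a → tag v ≡ a) → Unique (concatMap g xs)
concatMap-unique g tag []       _        _  _ = []
concatMap-unique g tag (a ∷ xs) (a∉ ∷ u) ug tg = Unique.++⁺ (ug a (here refl))
    (concatMap-unique g tag xs u (λ b → ug b ∘ there) (λ b → tg b ∘ there)) disjoint
  where
  disjoint : ∀ {v} → v ∈ g a × v ∈ concatMap g xs → ⊥
  disjoint {v} (v∈a , v∈) with find (∈-concatMap⁻ g {xs = xs} v∈)
  ... | b , b∈ , v∈b = All.lookup a∉ b∈ (trans (sym (tg a (here refl) v v∈a)) (tg b (there b∈) v v∈b))

map-∷-unique : ∀ (a : ℕ) {ws : List Word} → Unique ws → Unique (map (a ∷_) ws)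
map-∷-unique a = Unique.map⁺ ∷-injectiveʳ

range-unique : ∀ n → Unique (range n)
range-unique n = Unique.map⁺ suc-injective (Unique.upTo⁺ n)

hd-map : ∀ (a : ℕ) (ws : List Word) v → v ∈ map (a ∷_) ws → hd v ≡ a
hd-map a ws v v∈ with ∈-map⁻ (a ∷_) v∈
... | w , _ , refl = refl

words-unique : ∀ n m → Unique (words n m)
words-unique zero    m = [] ∷ []
words-unique (suc n) m = concatMap-unique _ hd (range m) (range-unique m) (λ a _ → map-∷-unique a (words-unique n m)) (λ a _ v v∈ → hd-map a (words n m) v v∈)

module _ (m : ℕ) where
  open LastLetter m

  E-unique : ∀ n κ t → Unique (E n κ t)
  E-unique zero    κ t = [] ∷ []
  E-unique (suc n) κ t = concatMap-unique _ hd (letters t) (from-unique t (suc m ∸ t)) each tag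
    where
    each : ∀ b → b ∈ letters t → Unique (if 1 ≤ᵇ κ b then map (b ∷_) (E n (κ ⊖ b) (lower t b)) else [])
    each b _ with 1 ≤ᵇ κ b
    ... | true  = map-∷-unique b (E-unique n (κ ⊖ b) (lower t b))
    ... | false = []
    tag : ∀ b → b ∈ letters t → ∀ v → v ∈ (if 1 ≤ᵇ κ b then map (b ∷_) (E n (κ ⊖ b) (lower t b)) else []) → hd v ≡ b
    tag b _ v v∈ with 1 ≤ᵇ κ b
    ... | true = hd-map b (E n (κ ⊖ b) (lower t b)) v v∈

shuf-unique : ∀ r m p → All (_< m) p → Unique (shuf r m p)
shuf-unique zero    m p       a = [] ∷ []
shuf-unique (suc r) m []      a = map-∷-unique m (shuf-unique r m [] a)
shuf-unique (suc r) m (x ∷ p) (x<m ∷ a) = Unique.++⁺ (map-∷-unique m (shuf-unique r m (x ∷ p) (x<m ∷ a))) (map-∷-unique x (shuf-unique (suc r) m p a))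
  (λ { {v} (v∈₁ , v∈₂) → <⇒≢ x<m (trans (sym (hd-map x (shuf (suc r) m p) v v∈₂)) (hd-map m (shuf r m (x ∷ p)) v v∈₁)) })

insWords-unique : ∀ ks → Unique (insWords ks)
insWords-unique []       = [] ∷ []
insWords-unique (k ∷ ks) = concatMap-unique _ (delete (suc (length ks))) (insWords ks) (insWords-unique ks)
    (λ u u∈ → map-∷-unique _ (shuf-unique (pred k) _ u (insWords-< ks u u∈))) tag
  where
  tag : ∀ u → u ∈ insWords ks → ∀ v → v ∈ map (suc (length ks) ∷_) (shuf (pred k) (suc (length ks)) u) → delete (suc (length ks)) v ≡ u
  tag u u∈ v v∈ with ∈-map⁻ (suc (length ks) ∷_) v∈
  ... | w , w∈ , refl = trans (delete-m (suc (length ks)) w) (shuf-delete (pred k) (suc (length ks)) u (insWords-< ks u u∈) w w∈)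

PM-sound : ∀ k w → w ∈ PM k → length w ≡ sum k × Admissible (length k) (at k) (length k) (reverse w)
PM-sound k w w∈ with ∈-filterᵇ⁻ (λ w → inSM k w ∧ lastInOrder (length k) w) (words (sum k) (length k)) w∈
... | w∈W , test with words-∈⁻ (sum k) (length k) w w∈W | ∧-true⁻ {inSM k w} test
...   | len , rng | inS , lastO = len , admissible
    (λ x x∈ → rng x (subst (x ∈_) (reverse-involutive w) (∈-reverse x∈)))
    (λ i 1≤i i≤m → trans (cnt-reverse (_≡ᵇ i) w) (trans (sym (length-filterᵇ (_≡ᵇ i) w))
      (true-≡ᵇ (and-map⁻ (λ i → countL i w ≡ᵇ at k i) (range (length k)) (proj₂ (∧-true⁻ {and (map (λ x → (1 ≤ᵇ x) ∧ (x ≤ᵇ length k)) w)} inS)) i (∈-range⁺ (length k) 1≤i i≤m)))))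
    (λ i 1≤i i<m → trans (sym (ordered i)) (and-map⁻ (λ i → lastPos i w <ᵇ lastPos (suc i) w) (range (length k ∸ 1)) lastO i
      (∈-range⁺ (length k ∸ 1) 1≤i (∸-monoˡ-≤ 1 i<m))))
  where
  ∈-reverse : ∀ {x} {u : Word} → x ∈ u → x ∈ reverse u
  ∈-reverse {u = u} x∈ = ↭.∈-resp-↭ (↭-sym (↭.↭-reverse u)) x∈
  ordered : ∀ i → (lastPos i w <ᵇ lastPos (suc i) w) ≡ bef (suc i) i (reverse w)
  ordered i = trans (cong (λ u → lastPos i u <ᵇ lastPos (suc i) u) (sym (reverse-involutive w)))
    (trans (cong₂ _<ᵇ_ (lastPos-reverse i (reverse w)) (lastPos-reverse (suc i) (reverse w))) (lp-bef (<⇒≢ (n<1+n i)) (reverse w)))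

PM-complete : ∀ k v → length v ≡ sum k → Admissible (length k) (at k) (length k) v → reverse v ∈ PM k
PM-complete k v len P = ∈-filterᵇ⁺ (λ w → inSM k w ∧ lastInOrder (length k) w) (words (sum k) (length k))
    (subst (λ n → reverse v ∈ words n (length k)) (trans (length-reverse v) len) (words-∈⁺ (length k) (reverse v) rng))
    (∧-true⁺ (∧-true⁺ (and-map⁺ (λ x → (1 ≤ᵇ x) ∧ (x ≤ᵇ length k)) (reverse v) (λ x x∈ → ∧-true⁺ (≤ᵇ-true (proj₁ (rng x x∈))) (≤ᵇ-true (proj₂ (rng x x∈)))))
                      (and-map⁺ (λ i → countL i (reverse v) ≡ᵇ at k i) (range (length k)) counts))
             (and-map⁺ (λ i → lastPos i (reverse v) <ᵇ lastPos (suc i) (reverse v)) (range (length k ∸ 1)) orders))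
  where
  rng : ∀ x → x ∈ reverse v → 1 ≤ x × x ≤ length k
  rng x x∈ = letter P x (↭.∈-resp-↭ (↭.↭-reverse v) x∈)
  counts : ∀ i → i ∈ range (length k) → (countL i (reverse v) ≡ᵇ at k i) ≡ true
  counts i i∈ = trans (cong (_≡ᵇ at k i) (trans (length-filterᵇ (_≡ᵇ i) (reverse v)) (trans (cnt-reverse (_≡ᵇ i) v)
    (count P i (proj₁ (∈-range⁻ (length k) i∈)) (proj₂ (∈-range⁻ (length k) i∈)))))) (≡ᵇ-refl (at k i))
  orders : ∀ i → i ∈ range (length k ∸ 1) → (lastPos i (reverse v) <ᵇ lastPos (suc i) (reverse v)) ≡ true
  orders i i∈ = trans (cong₂ _<ᵇ_ (lastPos-reverse i v) (lastPos-reverse (suc i) v)) (trans (lp-bef (<⇒≢ (n<1+n i)) v)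
    (order P i (proj₁ (∈-range⁻ (length k ∸ 1) i∈)) (bound (length k) (proj₁ (∈-range⁻ (length k ∸ 1) i∈)) (proj₂ (∈-range⁻ (length k ∸ 1) i∈)))))
    where
    bound : ∀ m {i} → 1 ≤ i → i ≤ m ∸ 1 → i < m
    bound zero    1≤i i≤ = contradiction (≤-trans 1≤i i≤) λ ()
    bound (suc m) 1≤i i≤ = s≤s i≤

PM-unique : ∀ k → Unique (PM k)
PM-unique k = filterᵇ-unique _ (words (sum k) (length k)) (words-unique (sum k) (length k))

-- Two lists without repetitions and with the same members are permutations of each other; any such
-- enumeration may therefore replace the filtered list.
∑-PM : ∀ k (L : List Word) → Unique L →
  (∀ v → v ∈ L → length v ≡ sum k × Admissible (length k) (at k) (length k) v) →
  (∀ v → length v ≡ sum k → Admissible (length k) (at k) (length k) v → v ∈ L) →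
  ∀ (f : Word → ℕ) → ∑ (PM k) f ≡ ∑ L (f ∘ reverse)
∑-PM k L u sound complete f = trans (∑-↭ f (∼bag⇒↭ (unique∧set⇒bag (PM-unique k) (Unique.map⁺ reverse-injective u) (mk⇔ to from′)))) (∑-map reverse L f)
  where
  to : ∀ {w} → w ∈ PM k → w ∈ map reverse L
  to {w} w∈ with PM-sound k w w∈
  ... | len , P = subst (_∈ map reverse L) (reverse-involutive w) (∈-map⁺ reverse (complete (reverse w) (trans (length-reverse w) len) P))
  from′ : ∀ {w} → w ∈ map reverse L → w ∈ PM k
  from′ w∈ with ∈-map⁻ reverse w∈
  ... | v , v∈ , refl = PM-complete k v (proj₁ (sound v v∈)) (proj₂ (sound v v∈))

-- A polynomial with natural coefficients is determined by its values: read the base-q digits.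

zeros : List ℕ → ℕ
zeros []           = 0
zeros (zero ∷ xs)  = suc (zeros xs)
zeros (suc x ∷ xs) = zeros xs

shift : List ℕ → List ℕ
shift []           = []
shift (zero ∷ xs)  = shift xs
shift (suc x ∷ xs) = x ∷ shift xs

zeros-≤ : ∀ xs → zeros xs ≤ length xs
zeros-≤ []           = z≤n
zeros-≤ (zero ∷ xs)  = s≤s (zeros-≤ xs)
zeros-≤ (suc x ∷ xs) = m≤n⇒m≤1+n (zeros-≤ xs)

eval-split : ∀ q xs → ∑ xs (q ^_) ≡ zeros xs + ∑ (shift xs) (q ^_) * q
eval-split q []           = refl
eval-split q (zero ∷ xs)  = cong suc (eval-split q xs)
eval-split q (suc x ∷ xs) = trans (cong (q * q ^ x +_) (eval-split q xs)) (re q (q ^ x) (zeros xs) _)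
  where
  re : ∀ q a z s → q * a + (z + s * q) ≡ z + (a + s) * q
  re = solve-∀

digits-unique : ∀ q {a b X Y} → a < suc q → b < suc q → a + X * suc q ≡ b + Y * suc q → a ≡ b × X ≡ Y
digits-unique q {a} {b} {X} {Y} a<q b<q e = a≡b , *-cancelʳ-≡ X Y (suc q) (+-cancelˡ-≡ a _ _ (trans e (cong (_+ Y * suc q) (sym a≡b))))
  where
  a≡b : a ≡ b
  a≡b = trans (sym (m<n⇒m%n≡m a<q)) (trans (sym ([m+kn]%n≡m%n a X (suc q))) (trans (cong (_% suc q) e) (trans ([m+kn]%n≡m%n b Y (suc q)) (m<n⇒m%n≡m b<q))))

count-zero : ∀ xs → ∑ xs (λ x → ind (x ≡ᵇ 0)) ≡ zeros xs
count-zero []           = refl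
count-zero (zero ∷ xs)  = cong suc (count-zero xs)
count-zero (suc x ∷ xs) = count-zero xs

count-suc : ∀ e xs → ∑ xs (λ x → ind (x ≡ᵇ suc e)) ≡ ∑ (shift xs) (λ x → ind (x ≡ᵇ e))
count-suc e []           = refl
count-suc e (zero ∷ xs)  = count-suc e xs
count-suc e (suc x ∷ xs) = cong (ind (x ≡ᵇ e) +_) (count-suc e xs)

coefficients : ∀ B xs ys → (∀ q → B ≤ q → ∑ xs (suc q ^_) ≡ ∑ ys (suc q ^_)) → ∀ e → ∑ xs (λ x → ind (x ≡ᵇ e)) ≡ ∑ ys (λ x → ind (x ≡ᵇ e))
coefficients B xs ys eq e = go e
  where
  -- The base q + 1 must exceed both constant terms, which the lengths bound, so that they are
  -- digits. For the shifted lists equality is then known only from `B′` on; hence the parameter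
  -- `B`.
  B′ : ℕ
  B′ = B ⊔ (length xs ⊔ length ys)
  digit : ∀ q → B′ ≤ q → zeros xs ≡ zeros ys × ∑ (shift xs) (suc q ^_) ≡ ∑ (shift ys) (suc q ^_)
  digit q B′≤q = digits-unique q
    (s≤s (≤-trans (zeros-≤ xs) (≤-trans (m≤m⊔n (length xs) (length ys)) (≤-trans (m≤n⊔m B _) B′≤q))))
    (s≤s (≤-trans (zeros-≤ ys) (≤-trans (m≤n⊔m (length xs) (length ys)) (≤-trans (m≤n⊔m B _) B′≤q))))
    (trans (sym (eval-split (suc q) xs)) (trans (eq q (≤-trans (m≤m⊔n B _) B′≤q)) (eval-split (suc q) ys)))
  go : ∀ e → ∑ xs (λ x → ind (x ≡ᵇ e)) ≡ ∑ ys (λ x → ind (x ≡ᵇ e))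
  go zero    = trans (count-zero xs) (trans (proj₁ (digit B′ ≤-refl)) (sym (count-zero ys)))
  go (suc e) = trans (count-suc e xs) (trans (coefficients B′ (shift xs) (shift ys) (λ q B′≤q → proj₂ (digit q B′≤q)) e) (sym (count-suc e ys)))

coeff-cong : ∀ k (f g : Word → ℕ) → (∀ q → ∑ (PM k) (λ w → q ^ f w) ≡ ∑ (PM k) (λ w → q ^ g w)) → ∀ e → coeff k f e ≡ coeff k g e
coeff-cong k f g eq e = trans (as-∑ f) (trans (coefficients 0 (map f (PM k)) (map g (PM k))
    (λ q _ → trans (∑-map f (PM k) (suc q ^_)) (trans (eq (suc q)) (sym (∑-map g (PM k) (suc q ^_))))) e) (sym (as-∑ g)))
  where
  as-∑ : ∀ f → coeff k f e ≡ ∑ (map f (PM k)) (λ x → ind (x ≡ᵇ e))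
  as-∑ f = trans (length-filterᵇ (λ w → f w ≡ᵇ e) (PM k)) (sym (∑-map f (PM k) (λ x → ind (x ≡ᵇ e))))

-- The common generating function

N-atʳ : ∀ ks → N (atʳ ks) (length ks) ≡ sum ks
N-atʳ ks = trans (sym (∑-range-N (atʳ ks) (length ks))) (trans (∑-atʳ ks id) (cong sum (map-id ks)))

module _ (q : ℕ) (𝓕 : Family) where
  open QNumbers q
  open Elementary q
  open FamilyTotal q 𝓕

  module H′ (m : ℕ) = Hooks q m

  D-cong : ∀ m m′ {κ κ′ t t′} i → i ≤ t → i ≤ t′ → (∀ j → j ≤ i → κ j ≡ κ′ j) → H′.D m i κ t ≡ H′.D m′ i κ′ t′
  D-cong m m′ zero    _   _    same = refl
  D-cong m m′ {κ} {κ′} (suc i) i≤t i≤t′ same rewrite ≤ᵇ-true i≤t | ≤ᵇ-true i≤t′ = cong₂ _*_ (D-cong m m′ i (<⇒≤ i≤t) (<⇒≤ i≤t′) (λ j j≤i → same j (m≤n⇒m≤1+n j≤i)))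
      (cong₂ (λ x y → ⟦ x ⟧ * ⟦ pred y ⟧!) (N-cong (suc i) same) (same (suc i) ≤-refl))
    where
    N-cong : ∀ i → (∀ j → j ≤ i → κ j ≡ κ′ j) → N κ i ≡ N κ′ i
    N-cong zero    h = refl
    N-cong (suc i) h = cong₂ _+_ (N-cong i (λ j j≤i → h j (m≤n⇒m≤1+n j≤i))) (h (suc i) ≤-refl)

  -- Here the two methods meet. With N = `sum ks`, the hook factor [N + k] [k - 1]! times the
  -- q-binomial coefficient [N + k - 1]! / ([N]! [k - 1]!) of the insertion is [N + k]! / [N]!.
  total-hooks : ∀ ks → All (1 ≤_) ks → total ks * H′.D (length ks) (length ks) (atʳ ks) (length ks) ≡ ⟦ sum ks ⟧!
  total-hooks []       _         = refl
  total-hooks (k ∷ ks) (1≤k ∷ a) = begin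
    total ks * H (sum ks) (pred k) * (H′.D (suc l) l κ (suc l) * H′.φ (suc l) κ (suc l) (suc l))
      ≡⟨ cong₂ (λ x y → total ks * H (sum ks) (pred k) * (x * y)) (D-cong (suc l) l {t = suc l} {t′ = l} l (n≤1+n l) ≤-refl (λ j j≤l → atʳ-old k ks j j≤l)) φ-top ⟩
    total ks * H (sum ks) (pred k) * (H′.D l l (atʳ ks) l * (⟦ suc (sum ks + pred k) ⟧ * ⟦ pred k ⟧!))
      ≡⟨ re (total ks) (H (sum ks) (pred k)) (H′.D l l (atʳ ks) l) ⟦ suc (sum ks + pred k) ⟧ ⟦ pred k ⟧! ⟩
    ⟦ suc (sum ks + pred k) ⟧ * (H (sum ks) (pred k) * (total ks * H′.D l l (atʳ ks) l * ⟦ pred k ⟧!))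
      ≡⟨ cong (λ y → ⟦ suc (sum ks + pred k) ⟧ * (H (sum ks) (pred k) * (y * ⟦ pred k ⟧!))) (total-hooks ks a) ⟩
    ⟦ suc (sum ks + pred k) ⟧ * (H (sum ks) (pred k) * (⟦ sum ks ⟧! * ⟦ pred k ⟧!))
      ≡⟨ cong (⟦ suc (sum ks + pred k) ⟧ *_) (H-factorial (sum ks) (pred k)) ⟩
    ⟦ suc (sum ks + pred k) ⟧! ≡⟨ cong ⟦_⟧! size ⟩
    ⟦ k + sum ks ⟧! ∎
    where
    open ≡-Reasoning
    l : ℕ
    l = length ks
    κ : ℕ → ℕ
    κ = atʳ (k ∷ ks)
    size : suc (sum ks + pred k) ≡ k + sum ks
    size = trans (sym (+-suc (sum ks) (pred k))) (trans (cong (sum ks +_) (suc-pred k {{>-nonZero 1≤k}})) (+-comm (sum ks) k))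
    re : ∀ t h d n p → t * h * (d * (n * p)) ≡ n * (h * (t * d * p))
    re = solve-∀
    φ-top : H′.φ (suc l) κ (suc l) (suc l) ≡ ⟦ suc (sum ks + pred k) ⟧ * ⟦ pred k ⟧!
    φ-top rewrite ≤ᵇ-true (≤-refl {suc l}) = cong₂ (λ x y → ⟦ x ⟧ * ⟦ pred y ⟧!) (trans (N-atʳ (k ∷ ks)) (sym size)) (atʳ-new k ks)

module _ (k : List ℕ) (k≥1 : All (1 ≤_) k) where

  private
    m n : ℕ
    m = length k
    n = sum k

  open LastLetter m
  open EnumerateByLastLetter m

  initial : State n (at k) m
  initial = record
    { κ0  = at-0 k
    ; pos = at-pos k k≥1
    ; t≤m = ≤-refl
    ; tot = subst₂ (λ l j → N (at l) j ≡ sum k) (reverse-involutive k) (length-reverse k) (trans (N-atʳ (reverse k)) (sum-↭ (↭.↭-reverse k)))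
    }
    where
    at-0 : ∀ w → at w 0 ≡ 0
    at-0 []      = refl
    at-0 (x ∷ w) = refl
    at-pos : ∀ k → All (1 ≤_) k → ∀ i → 1 ≤ i → i ≤ length k → 1 ≤ at k i
    at-pos (x ∷ k) (p ∷ a) (suc zero)    _ _       = p
    at-pos (x ∷ k) (p ∷ a) (suc (suc i)) _ (s≤s h) = at-pos k a (suc i) (s≤s z≤n) h

  ∑-PM-E : ∀ f → ∑ (PM k) f ≡ ∑ (E n (at k) m) (f ∘ reverse)
  ∑-PM-E = ∑-PM k (E n (at k) m) (E-unique m n (at k) m)
    (λ v v∈ → E-length n initial v v∈ , E-sound n initial v v∈) (λ v → E-complete n initial v)

  reverse≥1 : All (1 ≤_) (reverse k)
  reverse≥1 = All.tabulate (λ x∈ → All.lookup k≥1 (↭.∈-resp-↭ (↭.↭-reverse k) x∈))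

  ∑-PM-ins : ∀ f → ∑ (PM k) f ≡ ∑ (insWords (reverse k)) (f ∘ reverse)
  ∑-PM-ins = ∑-PM k (insWords (reverse k)) (insWords-unique (reverse k))
    (λ v v∈ → trans (insWords-length (reverse k) reverse≥1 v v∈) (sum-↭ (↭.↭-reverse k))
            , subst₂ (λ j l → Admissible j (at l) j v) (length-reverse k) (reverse-involutive k) (insWords-sound (reverse k) reverse≥1 v v∈))
    (λ v _ P → insWords-complete (reverse k) reverse≥1 v (subst₂ (λ j l → Admissible j (at l) j v) (sym (length-reverse k)) (sym (reverse-involutive k)) P))

  module _ (q : ℕ) where
    open QNumbers q
    open Hooks q m
    open LastLetterStatistics q m
    open ZStatistic q m
    open DenStatistic q m

    inv-GF : ℕ
    inv-GF = ∑ (E n (at k) m) (λ v → q ^ inv v)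

    on-E : ∀ (stat f : Word → ℕ) → (∀ v → v ∈ E n (at k) m → stat (reverse v) ≡ f v) → ∑ (PM k) (λ w → q ^ stat w) ≡ ∑ (E n (at k) m) (λ v → q ^ f v)
    on-E stat f eq = trans (∑-PM-E (λ w → q ^ stat w)) (∑-cong-∈ (E n (at k) m) (λ v v∈ → cong (q ^_) (eq v v∈)))

    from-hooks : ∀ {x} → x * D m (at k) m ≡ ⟦ n ⟧! → x ≡ inv-GF
    from-hooks e = cancel-D initial e (inv-total n initial)

    INV-GF : ∑ (PM k) (λ w → q ^ INV w) ≡ inv-GF
    INV-GF = on-E INV inv (λ v _ → INV-reverse v)

    rMAJ-GF : ∀ r → ∑ (PM k) (λ w → q ^ rMAJ (suc r) w) ≡ inv-GF
    rMAJ-GF r = trans (on-E (rMAJ (suc r)) (rmaj (suc r)) (λ v _ → rMAJ-reverse (suc r) v)) (rmaj-total r n initial)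

    MAJ-GF : ∑ (PM k) (λ w → q ^ MAJ w) ≡ inv-GF
    MAJ-GF = trans (∑-cong (PM k) (λ w → cong (q ^_) (MAJ-rMAJ w))) (rMAJ-GF 0)

    MAJd-GF : ∀ d → ∑ (PM k) (λ w → q ^ MAJd (suc d) w) ≡ inv-GF
    MAJd-GF d = trans (on-E (MAJd (suc d)) (majd d) (λ v _ → MAJd-reverse d v)) (majd-total d n initial)

    Z-GF : ∑ (PM k) (λ w → q ^ Z m w) ≡ inv-GF
    Z-GF = trans (on-E (Z m) (Zᴸ m (down m)) (λ v _ → Z-reverse m v))
      -- At the start all letters are constrained, so τ is empty and the order is the natural one.
      (from-hooks (Z-total n initial [] (subst (λ s → [] ↭ from (suc m) s) (sym (n∸n≡0 m)) Perm.refl)))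

    DEN-GF : ∑ (PM k) (λ w → q ^ DEN w) ≡ inv-GF
    DEN-GF = trans (on-E DEN (den (λ x → N (at k) (pred x))) (λ v v∈ → DEN-den n initial v v∈))
      (from-hooks (den-total (at k) n initial (λ _ _ → refl) (≤-reflexive (sym (tot initial)))))

    family-GF : ∀ 𝓕 (stat : Word → ℕ) → (∀ v → stat (reverse v) ≡ familyCost 𝓕 v) → ∑ (PM k) (λ w → q ^ stat w) ≡ inv-GF
    family-GF 𝓕 stat eq = trans (∑-PM-ins (λ w → q ^ stat w)) (trans (∑-cong (insWords (reverse k)) (λ v → cong (q ^_) (eq v)))
      (trans (FamilyTotal.insWords-total q 𝓕 (reverse k) reverse≥1) (from-hooks
        (trans (subst₂ (λ j l → FamilyTotal.total q 𝓕 (reverse k) * Hooks.D q j j (at l) j ≡ ⟦ sum (reverse k) ⟧!) (length-reverse k) (reverse-involutive k) (total-hooks q 𝓕 (reverse k) reverse≥1))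
          (cong ⟦_⟧! (sum-↭ (↭.↭-reverse k)))))))

    MAK-GF : ∑ (PM k) (λ w → q ^ MAK w) ≡ inv-GF
    MAK-GF = family-GF makFamily MAK MAK-reverse

    MAD-GF : ∑ (PM k) (λ w → q ^ MAD w) ≡ inv-GF
    MAD-GF = family-GF madFamily MAD MAD-reverse

theorem2p1 : (k : List ℕ) → All (λ ki → 1 ≤ ki) k → (d r : ℕ) → 1 ≤ d → 1 ≤ r → (e : ℕ) →
    (coeff k INV e ≡ coeff k MAJ e)
    × (coeff k MAJ e ≡ coeff k (MAJd d) e)
    × (coeff k (MAJd d) e ≡ coeff k (Z (length k)) e)
    × (coeff k (Z (length k)) e ≡ coeff k (rMAJ r) e)
    × (coeff k (rMAJ r) e ≡ coeff k DEN e)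
    × (coeff k DEN e ≡ coeff k MAK e)
    × (coeff k MAK e ≡ coeff k MAD e)
theorem2p1 k k≥1 (suc d) (suc r) (s≤s _) (s≤s _) e =
    same INV MAJ (INV-GF k k≥1) (MAJ-GF k k≥1)
  , same MAJ (MAJd (suc d)) (MAJ-GF k k≥1) (λ q → MAJd-GF k k≥1 q d)
  , same (MAJd (suc d)) (Z (length k)) (λ q → MAJd-GF k k≥1 q d) (Z-GF k k≥1)
  , same (Z (length k)) (rMAJ (suc r)) (Z-GF k k≥1) (λ q → rMAJ-GF k k≥1 q r)
  , same (rMAJ (suc r)) DEN (λ q → rMAJ-GF k k≥1 q r) (DEN-GF k k≥1)
  , same DEN MAK (DEN-GF k k≥1) (MAK-GF k k≥1)
  , same MAK MAD (MAK-GF k k≥1) (MAD-GF k k≥1)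
  where
  same : ∀ f g → (∀ q → ∑ (PM k) (λ w → q ^ f w) ≡ inv-GF k k≥1 q) → (∀ q → ∑ (PM k) (λ w → q ^ g w) ≡ inv-GF k k≥1 q) → coeff k f e ≡ coeff k g e
  same f g F G = coeff-cong k f g (λ q → trans (F q) (sym (G q))) e
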